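{- For every prime $p$, one has $M(p)\le \frac{2}{3}p$.
   Context: For a positive integer $n$, the $n$-th cyclotomic polynomial is $\Phi_n(x)=\prod_{1\le j\le n,\ \gcd(j,n)=1}(x-e^{2\pi i j/n})=\sum_{k=0}^{\varphi(n)}a_n(k)x^k$, which has integer coefficients. The height of $\Phi_n$ is $A(n)=\max\{|a_n(k)|:0\le k\le\varphi(n)\}$. For a prime $p$, $M(p)=\max\{A(pqr): q,r \text{ primes with } p<q<r\}$ (this maximum exists since $A(pqr)\le p-1$). -}

module Defs where

open import Data.Nat as ℕ using (ℕ; zero; suc; _∸_; _⊔_)
open import Data.Nat.Divisibility using (_∣?_)
open import Data.Integer as ℤ using (ℤ; +_; -_; ∣_∣)
open import Data.List using (List; []; _∷_; _++_; [_]; length; foldr; map; replicate)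
open import Data.Bool using (if_then_else_)
open import Relation.Nullary using (does)

-- Integer polynomials as coefficient lists, lowest degree first:
-- a₀ ∷ a₁ ∷ … represents a₀ + a₁ x + …
Poly : Set
Poly = List ℤ

infixl 6 _+ₚ_
_+ₚ_ : Poly → Poly → Poly
[]       +ₚ q        = q
(a ∷ p)  +ₚ []       = a ∷ p
(a ∷ p)  +ₚ (b ∷ q)  = (a ℤ.+ b) ∷ (p +ₚ q)

scale : ℤ → Poly → Poly
scale c = map (c ℤ.*_)

infixl 7 _*ₚ_
_*ₚ_ : Poly → Poly → Poly
[]      *ₚ q = []
(a ∷ p) *ₚ q = scale a q +ₚ (+ 0 ∷ (p *ₚ q))

head0 : Poly → ℤ
head0 []      = + 0
head0 (a ∷ _) = a

tail0 : Poly → Poly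
tail0 []      = []
tail0 (_ ∷ p) = p

-- Exact division f / g by a polynomial g with constant term ±1,
-- computing k quotient coefficients from the lowest degree upward.
divLow : ℕ → Poly → Poly → Poly
divLow zero    f g = []
divLow (suc k) f g =
  let c = head0 f ℤ.* head0 g
  in c ∷ divLow k (tail0 (f +ₚ scale (- c) g)) g

xPowMinusOne : ℕ → Poly
xPowMinusOne zero    = []
xPowMinusOne (suc m) = (- (+ 1)) ∷ (replicate m (+ 0) ++ [ + 1 ])

prodDiv : ℕ → ℕ → List Poly → Poly
prodDiv m i []        = [ + 1 ]
prodDiv m i (φ ∷ t)   =
  if does (i ∣? m) then φ *ₚ prodDiv m (suc i) t else prodDiv m (suc i) t

-- Φ_m = (x^m - 1) / ∏_{d ∣ m, d < m} Φ_d, given the table [Φ_1, …, Φ_{m-1}]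
nextCyclo : ℕ → List Poly → Poly
nextCyclo m t =
  let g = prodDiv m 1 t
  in divLow (suc (suc m) ∸ length g) (xPowMinusOne m) g

cycloTable : ℕ → List Poly
cycloTable zero    = []
cycloTable (suc n) = cycloTable n ++ [ nextCyclo (suc n) (cycloTable n) ]

-- Φ_n, the n-th cyclotomic polynomial (n ≥ 1; Φ_0 is a dummy value)
Φ : ℕ → Poly
Φ zero    = [ + 1 ]
Φ (suc n) = nextCyclo (suc n) (cycloTable n)

height : Poly → ℕ
height = foldr (λ a m → ∣ a ∣ ⊔ m) 0

A : ℕ → ℕ
A n = height (Φ n)

{-# OPTIONS --safe #-}

-- For M = n + pqr - i write a·qr + b·pr + c·pq + pqr = M + pqr·N with 0 ≤ a < p, 0 ≤ b < q, 0 ≤ c < r and put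
-- X(M) = [N = 0]. As (1 - x^pqr) / ((1 - x^pq) (1 - x^pr) (1 - x^qr)) generates k ↦ X(k + pqr) below degree pqr, the
-- coefficient of x^n in Φ_pqr is the sum over i < p of X(M) - X(M - q) - X(M - r) + X(M - q - r).
--
-- Let αq ≡ ±1 and βr ≡ ±1 mod p with α, β ≤ p/2, and α ≤ β after exchanging q and r if necessary. Moving M by r
-- lowers a by α, moving it by q lowers a by β, and each residue a occurs once in the window. Comparing a with α, β
-- and α + β shows that, up to a global sign, the summand is 0 or 1 for a < α or a ≥ α + β, and -1 or 0 otherwise.
-- Hence the sum is at least -β and equals p - β - D, where D counts the a at which the upper bound is missed.
--
-- If p - β - D > 2p/3, then 3(β + D) < p and few a miss the bound. Take x < α with N = 0 and v in [β, α + β), both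
-- attaining it. For a and a + v - x of type N = 2 the equation x + (a + v - x) = v + a must fail for the positions
-- in the window, where it holds up to ±p only: otherwise v would be of type N = 2 as well, and these residues lie in
-- a range shorter than α + β. So adding v - x to a moves the position by a fixed amount in a fixed direction, and a
-- chain of such hops through residues of type N = 2 contradicts a similar relation between its two ends.
module Submission where

-- About the residues that miss the bound nothing is known but their number D, so every pattern of
-- residues has to be found by pigeonhole, among D + 1 disjoint translates. This dictates the hop
-- length d = β + D + 1 - α: it carries the last D + 1 residues below α onto D + 1 residues from β
-- on, and d > D makes the translates of a progression of step d disjoint. The number of hops is
-- then chosen so that the path closes up at a residue of type N = 2 near p. Room for D + 1
-- translates can be lacking only if p = 1 + 3(β + D) and d divides β + D. Counting D translates
-- then shows that no residue below α + β misses the bound. If d > 1, this leaves enough freedom for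
-- a first hop of length d + 1, which shortens the path. If d = 1, then D = 0 and α = β, nothing is
-- left to vary, and the case falls to congruences modulo p.

open import Defs
open import Algebra.Properties.CommutativeSemigroup using () renaming (x∙yz≈y∙xz to left-swap)
open import Data.Bool using (Bool; true; false; T; _∧_; if_then_else_)
open import Data.Empty using (⊥; ⊥-elim)
open import Data.List using (List; []; _∷_; [_]; _++_; filter; foldr; length; map; replicate)
open import Data.List.Membership.Propositional using (_∈_)
open import Data.List.Membership.Propositional.Properties using (∈-filter⁺; ∈-filter⁻)
open import Data.List.Membership.Propositional.Properties.WithK using (unique∧set⇒bag)
open import Data.List.Properties using (length-map; length-replicate; map-++)
open import Data.List.Relation.Binary.BagAndSetEquality using (∼bag⇒↭)
open import Data.List.Relation.Binary.Permutation.Propositional using (_↭_; prep; ↭-sym)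
  renaming (refl to ↭-refl; swap to ↭-swap; trans to ↭-trans)
open import Data.List.Relation.Binary.Permutation.Propositional.Properties using (All-resp-↭; map⁺)
  renaming (shift to ↭-shift)
open import Data.List.Relation.Unary.All as All using (All; []; _∷_)
open import Data.List.Relation.Unary.AllPairs using ([]; _∷_)
open import Data.List.Relation.Unary.Any using (here; there)
open import Data.List.Relation.Unary.Unique.Propositional using (Unique)
open import Data.List.Relation.Unary.Unique.Propositional.Properties using (filter⁺)
open import Data.Maybe using (Maybe; just; nothing)
open import Data.Nat
open import Data.Nat.Coprimality as Coprimality using (Coprime; 1-coprimeTo; coprime-Bézout; coprime-divisor; prime⇒coprime)
open import Data.Nat.DivMod using (_/_; _%_; m%n<n; m<n⇒m%n≡m; m≡m%n+[m/n]*n; [m+kn]%n≡m%n)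
open import Data.Nat.Divisibility
  using (_∣_; _∣?_; divides; 0∣⇒≡0; 1∣_; ∣-trans; ∣m+n∣m⇒∣n; ∣⇒≤; m∣m*n; n∣m*n; *-cancelˡ-∣)
open import Data.Nat.GCD using (module Bézout)
open import Data.Nat.ListAction using () renaming (sum to sumᴸ)
open import Data.Nat.ListAction.Properties using (sum-↭)
open import Data.Nat.Primality using (Prime; euclidsLemma; prime⇒irreducible; prime⇒nonTrivial; prime⇒nonZero)
open import Data.Nat.Properties
open import Data.Product using (_×_; _,_; ∃; ∃₂; proj₁; proj₂)
open import Data.Sum using (_⊎_; inj₁; inj₂; [_,_]′)
open import Data.Unit using (⊤; tt)
open import Function using (_∘_; case_of_)
open import Function.Bundles using (mk⇔)
open import Relation.Binary.Definitions using (tri<; tri≈; tri>)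
open import Relation.Binary.PropositionalEquality hiding ([_])
open import Relation.Nullary

-- Certificates for polynomial inequalities over ℕ

infixl 7 _⊕_
infixl 8 _⊗_
infix  9 #_ ‵_
data Exp : Set where
  #_ ‵_ : ℕ → Exp
  _⊕_ _⊗_ : Exp → Exp → Exp

Env Mono Polynomial : Set
Env  = List ℕ
Mono = List ℕ
Polynomial = List (Mono × ℕ)

at : Env → ℕ → ℕ
at []      _       = 0
at (x ∷ ρ) zero    = x
at (x ∷ ρ) (suc i) = at ρ i

⟦_⟧ : Exp → Env → ℕ
⟦ # i ⟧   ρ = at ρ i
⟦ ‵ k ⟧   ρ = k
⟦ e ⊕ f ⟧ ρ = ⟦ e ⟧ ρ + ⟦ f ⟧ ρ
⟦ e ⊗ f ⟧ ρ = ⟦ e ⟧ ρ * ⟦ f ⟧ ρ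

⟦_⟧ᵐ : Mono → Env → ℕ
⟦ μ ⟧ᵐ ρ = foldr (λ i → at ρ i *_) 1 μ

⟦_⟧ᵖ : Polynomial → Env → ℕ
⟦ P ⟧ᵖ ρ = foldr (λ t → proj₂ t * ⟦ proj₁ t ⟧ᵐ ρ +_) 0 P

insertᵐ : ℕ → Mono → Mono
insertᵐ i []      = i ∷ []
insertᵐ i (j ∷ μ) = if i ≤ᵇ j then i ∷ j ∷ μ else j ∷ insertᵐ i μ

_·ᵐ_ : Mono → Mono → Mono
μ ·ᵐ ν = foldr insertᵐ ν μ

_==_ : Mono → Mono → Bool
[]      == []      = true
(i ∷ μ) == (j ∷ ν) = (i ≡ᵇ j) ∧ (μ == ν)
_       == _       = false

addᵗ : Mono → ℕ → Polynomial → Polynomial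
addᵗ μ c []            = (μ , c) ∷ []
addᵗ μ c ((ν , d) ∷ P) = if μ == ν then (ν , c + d) ∷ P else (ν , d) ∷ addᵗ μ c P

_+ᵖ_ : Polynomial → Polynomial → Polynomial
P +ᵖ Q = foldr (λ t → addᵗ (proj₁ t) (proj₂ t)) Q P

_*ᵗ_ : Mono × ℕ → Polynomial → Polynomial
(μ , c) *ᵗ Q = foldr (λ t → addᵗ (μ ·ᵐ proj₁ t) (c * proj₂ t)) [] Q

_*ᵖ_ : Polynomial → Polynomial → Polynomial
P *ᵖ Q = foldr (λ t → (t *ᵗ Q) +ᵖ_) [] P

nf : Exp → Polynomial
nf (# i)         = (i ∷ [] , 1) ∷ []
nf (‵ zero)      = []
nf (‵ k@(suc _)) = ([] , k) ∷ []
nf (e ⊕ f)       = nf e +ᵖ nf f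
nf (e ⊗ f)       = nf e *ᵖ nf f

takeᵗ : Mono → ℕ → Polynomial → Maybe Polynomial
takeᵗ μ c []            = if c ≡ᵇ 0 then just [] else nothing
takeᵗ μ c ((ν , d) ∷ Q) with μ == ν
... | true  = if c ≤ᵇ d then just ((ν , d ∸ c) ∷ Q) else nothing
... | false with takeᵗ μ c Q
...   | just Q′ = just ((ν , d) ∷ Q′)
...   | nothing = nothing

-- A sufficient test only: each term of P is taken out of Q, and what remains of Q cannot be
-- negative, as all coefficients and values are natural numbers.
_⊑_ : Polynomial → Polynomial → Bool
[]            ⊑ Q = true
((μ , c) ∷ P) ⊑ Q with takeᵗ μ c Q
... | just Q′ = P ⊑ Q′
... | nothing = false

+*-assoc : ∀ c d m r → (c + d) * m + r ≡ c * m + (d * m + r)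
+*-assoc c d m r = trans (cong (_+ r) (*-distribʳ-+ m c d)) (+-assoc (c * m) (d * m) r)

module _ (ρ : Env) where

  insertᵐ-sound : ∀ i μ → ⟦ insertᵐ i μ ⟧ᵐ ρ ≡ at ρ i * ⟦ μ ⟧ᵐ ρ
  insertᵐ-sound i []      = refl
  insertᵐ-sound i (j ∷ μ) with i ≤ᵇ j
  ... | true  = refl
  ... | false = trans (cong (at ρ j *_) (insertᵐ-sound i μ)) (left-swap *-commutativeSemigroup (at ρ j) (at ρ i) (⟦ μ ⟧ᵐ ρ))

  ·ᵐ-sound : ∀ μ ν → ⟦ μ ·ᵐ ν ⟧ᵐ ρ ≡ ⟦ μ ⟧ᵐ ρ * ⟦ ν ⟧ᵐ ρ
  ·ᵐ-sound []      ν = sym (+-identityʳ _)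
  ·ᵐ-sound (i ∷ μ) ν = trans (insertᵐ-sound i (μ ·ᵐ ν))
    (trans (cong (at ρ i *_) (·ᵐ-sound μ ν)) (sym (*-assoc (at ρ i) _ _)))

  ==-sound : ∀ μ ν → (μ == ν) ≡ true → μ ≡ ν
  ==-sound []      []      _ = refl
  ==-sound (i ∷ μ) (j ∷ ν) e with i ≡ᵇ j in eq
  ... | true = cong₂ _∷_ (≡ᵇ⇒≡ i j (subst T (sym eq) tt)) (==-sound μ ν e)

  addᵗ-sound : ∀ μ c P → ⟦ addᵗ μ c P ⟧ᵖ ρ ≡ c * ⟦ μ ⟧ᵐ ρ + ⟦ P ⟧ᵖ ρ
  addᵗ-sound μ c []            = refl
  addᵗ-sound μ c ((ν , d) ∷ P) with μ == ν in eq
  ... | true rewrite ==-sound μ ν eq = +*-assoc c d (⟦ ν ⟧ᵐ ρ) (⟦ P ⟧ᵖ ρ)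
  ... | false = trans (cong (d * ⟦ ν ⟧ᵐ ρ +_) (addᵗ-sound μ c P)) (left-swap +-commutativeSemigroup (d * ⟦ ν ⟧ᵐ ρ) (c * ⟦ μ ⟧ᵐ ρ) (⟦ P ⟧ᵖ ρ))

  +ᵖ-sound : ∀ P Q → ⟦ P +ᵖ Q ⟧ᵖ ρ ≡ ⟦ P ⟧ᵖ ρ + ⟦ Q ⟧ᵖ ρ
  +ᵖ-sound []            Q = refl
  +ᵖ-sound ((μ , c) ∷ P) Q = trans (addᵗ-sound μ c (P +ᵖ Q))
    (trans (cong (c * ⟦ μ ⟧ᵐ ρ +_) (+ᵖ-sound P Q)) (sym (+-assoc (c * ⟦ μ ⟧ᵐ ρ) _ _)))

  *ᵗ-sound : ∀ μ c Q → ⟦ (μ , c) *ᵗ Q ⟧ᵖ ρ ≡ c * ⟦ μ ⟧ᵐ ρ * ⟦ Q ⟧ᵖ ρ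
  *ᵗ-sound μ c []            = sym (*-zeroʳ (c * ⟦ μ ⟧ᵐ ρ))
  *ᵗ-sound μ c ((ν , d) ∷ Q) = trans (addᵗ-sound (μ ·ᵐ ν) (c * d) ((μ , c) *ᵗ Q))
    (trans (cong₂ (λ x y → c * d * x + y) (·ᵐ-sound μ ν) (*ᵗ-sound μ c Q))
           (trans (cong (_+ c * ⟦ μ ⟧ᵐ ρ * ⟦ Q ⟧ᵖ ρ) ([m*n]*[o*p]≡[m*o]*[n*p] c d (⟦ μ ⟧ᵐ ρ) (⟦ ν ⟧ᵐ ρ)))
           (sym (*-distribˡ-+ (c * ⟦ μ ⟧ᵐ ρ) (d * ⟦ ν ⟧ᵐ ρ) (⟦ Q ⟧ᵖ ρ)))))

  *ᵖ-sound : ∀ P Q → ⟦ P *ᵖ Q ⟧ᵖ ρ ≡ ⟦ P ⟧ᵖ ρ * ⟦ Q ⟧ᵖ ρ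
  *ᵖ-sound []            Q = refl
  *ᵖ-sound ((μ , c) ∷ P) Q = trans (+ᵖ-sound ((μ , c) *ᵗ Q) (P *ᵖ Q))
    (trans (cong₂ _+_ (*ᵗ-sound μ c Q) (*ᵖ-sound P Q)) (sym (*-distribʳ-+ (⟦ Q ⟧ᵖ ρ) (c * ⟦ μ ⟧ᵐ ρ) _)))

  nf-sound : ∀ e → ⟦ nf e ⟧ᵖ ρ ≡ ⟦ e ⟧ ρ
  nf-sound (# i)         = trans (+-identityʳ _) (trans (+-identityʳ _) (*-identityʳ _))
  nf-sound (‵ zero)      = refl
  nf-sound (‵ k@(suc _)) = trans (+-identityʳ _) (*-identityʳ k)
  nf-sound (e ⊕ f)       = trans (+ᵖ-sound (nf e) (nf f)) (cong₂ _+_ (nf-sound e) (nf-sound f))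
  nf-sound (e ⊗ f)       = trans (*ᵖ-sound (nf e) (nf f)) (cong₂ _*_ (nf-sound e) (nf-sound f))

  takeᵗ-sound : ∀ μ c Q {Q′} → takeᵗ μ c Q ≡ just Q′ → ⟦ Q ⟧ᵖ ρ ≡ c * ⟦ μ ⟧ᵐ ρ + ⟦ Q′ ⟧ᵖ ρ
  takeᵗ-sound μ zero    []            refl = refl
  takeᵗ-sound μ c ((ν , d) ∷ Q) e with μ == ν in eq
  takeᵗ-sound μ c ((ν , d) ∷ Q) e | true with c ≤ᵇ d in le
  takeᵗ-sound μ c ((ν , d) ∷ Q) refl | true | true rewrite ==-sound μ ν eq =
    trans (cong (λ x → x * ⟦ ν ⟧ᵐ ρ + ⟦ Q ⟧ᵖ ρ) (sym (m+[n∸m]≡n (≤ᵇ⇒≤ c d (subst T (sym le) tt)))))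
          (+*-assoc c (d ∸ c) (⟦ ν ⟧ᵐ ρ) (⟦ Q ⟧ᵖ ρ))
  takeᵗ-sound μ c ((ν , d) ∷ Q) e | false with takeᵗ μ c Q in eq′
  takeᵗ-sound μ c ((ν , d) ∷ Q) refl | false | just Q′ =
    trans (cong (d * ⟦ ν ⟧ᵐ ρ +_) (takeᵗ-sound μ c Q eq′)) (left-swap +-commutativeSemigroup (d * ⟦ ν ⟧ᵐ ρ) (c * ⟦ μ ⟧ᵐ ρ) (⟦ Q′ ⟧ᵖ ρ))

  ⊑-sound : ∀ P Q → (P ⊑ Q) ≡ true → ⟦ P ⟧ᵖ ρ ≤ ⟦ Q ⟧ᵖ ρ
  ⊑-sound []            Q e = z≤n
  ⊑-sound ((μ , c) ∷ P) Q e with takeᵗ μ c Q in eq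
  ... | just Q′ = subst (_ ≤_) (sym (takeᵗ-sound μ c Q eq)) (+-monoʳ-≤ (c * ⟦ μ ⟧ᵐ ρ) (⊑-sound P Q′ e))

-- (m , l , r) is the hypothesis l ≤ r (or l ≡ r) together with the polynomial m it is to be multiplied by.
-- After multiplying and adding up, the conclusion is a coefficientwise comparison.
Ineq : Set
Ineq = Exp × Exp × Exp

infix 6 _≼_ _≺_
_≼_ _≺_ : Exp → Exp → Ineq
l ≼ r = ‵ 1 , l , r
l ≺ r = ‵ 1 , ‵ 1 ⊕ l , r

Holds : Env → List Ineq → Set
Holds ρ []                = ⊤
Holds ρ ((_ , l , r) ∷ Γ) = ⟦ l ⟧ ρ ≤ ⟦ r ⟧ ρ × Holds ρ Γ

Σˡ Σʳ : List Ineq → Exp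
Σˡ = foldr (λ { (m , l , r) e → m ⊗ l ⊕ e }) (‵ 0)
Σʳ = foldr (λ { (m , l , r) e → m ⊗ r ⊕ e }) (‵ 0)

Σ-mono : ∀ ρ Γ → Holds ρ Γ → ⟦ Σˡ Γ ⟧ ρ ≤ ⟦ Σʳ Γ ⟧ ρ
Σ-mono ρ []                _        = z≤n
Σ-mono ρ ((m , l , r) ∷ Γ) (h , hs) = +-mono-≤ (*-monoʳ-≤ (⟦ m ⟧ ρ) h) (Σ-mono ρ Γ hs)

Contradictory : List Ineq → Set
Contradictory Γ = (nf (‵ 1 ⊕ Σʳ Γ) ⊑ nf (Σˡ Γ)) ≡ true

-- A Positivstellensatz certificate. The multipliers in Γ make the weighted sum of the left sides
-- exceed that of the right sides by at least 1, coefficient by coefficient; this is checked by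
-- evaluation, hence the `refl` at every use.
refute : ∀ ρ Γ → Contradictory Γ → Holds ρ Γ → ⊥
refute ρ Γ e hs = <-irrefl refl (≤-trans
  (subst₂ _≤_ (nf-sound ρ (‵ 1 ⊕ Σʳ Γ)) (nf-sound ρ (Σˡ Γ)) (⊑-sound ρ (nf (‵ 1 ⊕ Σʳ Γ)) (nf (Σˡ Γ)) e))
  (Σ-mono ρ Γ hs))

-- The negated conclusion joins the hypotheses with its own multiplier `m`. A nonconstant `m`, such
-- as a product of the primes, amounts to dividing an inequality between multiples by that product.
entail : ∀ ρ m l r Γ → Contradictory ((m , ‵ 1 ⊕ r , l) ∷ Γ) → Holds ρ Γ → ⟦ l ⟧ ρ ≤ ⟦ r ⟧ ρ
entail ρ m l r Γ e hs = ≮⇒≥ λ r<l → refute ρ ((m , ‵ 1 ⊕ r , l) ∷ Γ) e (r<l , hs)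

Holds≡ : Env → List Ineq → Set
Holds≡ ρ []                = ⊤
Holds≡ ρ ((_ , l , r) ∷ Γ) = ⟦ l ⟧ ρ ≡ ⟦ r ⟧ ρ × Holds≡ ρ Γ

Σ-cong : ∀ ρ Γ → Holds≡ ρ Γ → ⟦ Σˡ Γ ⟧ ρ ≡ ⟦ Σʳ Γ ⟧ ρ
Σ-cong ρ []                _        = refl
Σ-cong ρ ((m , l , r) ∷ Γ) (h , hs) = cong₂ _+_ (cong (⟦ m ⟧ ρ *_) h) (Σ-cong ρ Γ hs)

_≈ₑ_ : Exp → Exp → Set
e ≈ₑ f = (nf e ⊑ nf f) ∧ (nf f ⊑ nf e) ≡ true

identity : ∀ ρ e f → e ≈ₑ f → ⟦ e ⟧ ρ ≡ ⟦ f ⟧ ρ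
identity ρ e f eq with nf e ⊑ nf f in le | nf f ⊑ nf e in ge
... | true | true = ≤-antisym (subst₂ _≤_ (nf-sound ρ e) (nf-sound ρ f) (⊑-sound ρ (nf e) (nf f) le))
                              (subst₂ _≤_ (nf-sound ρ f) (nf-sound ρ e) (⊑-sound ρ (nf f) (nf e) ge))

-- Multipliers are natural, so an equation can be added in one direction only; this is why many
-- hypotheses enter through `sym`.
equate : ∀ ρ n {{_ : NonZero n}} l r Γ → (‵ n ⊗ l ⊕ Σʳ Γ) ≈ₑ (‵ n ⊗ r ⊕ Σˡ Γ) → Holds≡ ρ Γ → ⟦ l ⟧ ρ ≡ ⟦ r ⟧ ρ
equate ρ n l r Γ e hs = *-cancelˡ-≡ (⟦ l ⟧ ρ) (⟦ r ⟧ ρ) n (+-cancelʳ-≡ (⟦ Σʳ Γ ⟧ ρ) _ _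
  (trans (identity ρ (‵ n ⊗ l ⊕ Σʳ Γ) (‵ n ⊗ r ⊕ Σˡ Γ) e) (cong (n * ⟦ r ⟧ ρ +_) (Σ-cong ρ Γ hs))))

-- Sums and pigeonholes

sum : (ℕ → ℕ) → ℕ → ℕ
sum f zero    = 0
sum f (suc n) = sum f n + f n

sum-cong : ∀ {f g} → (∀ i → f i ≡ g i) → ∀ n → sum f n ≡ sum g n
sum-cong e zero    = refl
sum-cong e (suc n) = cong₂ _+_ (sum-cong e n) (e n)

sum-+ : ∀ f g n → sum (λ i → f i + g i) n ≡ sum f n + sum g n
sum-+ f g zero    = refl
sum-+ f g (suc n) = trans (cong (_+ (f n + g n)) (sum-+ f g n)) (shuffle (sum f n) (sum g n) (f n) (g n))
  where shuffle : ∀ a b c d → a + b + (c + d) ≡ a + c + (b + d)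
        shuffle a b c d = (identity (a ∷ b ∷ c ∷ d ∷ []) (# 0 ⊕ # 1 ⊕ (# 2 ⊕ # 3)) (# 0 ⊕ # 2 ⊕ (# 1 ⊕ # 3)) refl)

sum-0 : ∀ n → sum (λ _ → 0) n ≡ 0
sum-0 zero    = refl
sum-0 (suc n) = cong (_+ 0) (sum-0 n)

sum-swap : ∀ (F : ℕ → ℕ → ℕ) m n → sum (λ i → sum (F i) m) n ≡ sum (λ j → sum (λ i → F i j) n) m
sum-swap F zero    n = sum-0 n
sum-swap F (suc m) n = trans (sum-+ (λ i → sum (F i) m) (λ i → F i m) n)
  (cong (_+ sum (λ i → F i m) n) (sum-swap F m n))

sum-split : ∀ f m n → sum f (m + n) ≡ sum f m + sum (λ i → f (m + i)) n
sum-split f m zero    = trans (cong (sum f) (+-identityʳ m)) (sym (+-identityʳ _))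
sum-split f m (suc n) = trans (cong (sum f) (+-suc m n))
  (trans (cong (_+ f (m + n)) (sum-split f m n)) (+-assoc (sum f m) _ _))

sum-mono : ∀ f {m n} → m ≤ n → sum f m ≤ sum f n
sum-mono f {m} {n} m≤n with n ∸ m | m+[n∸m]≡n m≤n
... | k | refl = subst (sum f m ≤_) (sym (sum-split f m k)) (m≤m+n _ _)

interval : (ℕ → ℕ) → ℕ → ℕ → ℕ
interval f lo n = sum (λ i → f (lo + i)) n

interval-after : ∀ f lo n {hi} → lo + n ≤ hi → sum f lo + interval f lo n ≤ sum f hi
interval-after f lo n le = subst (_≤ _) (sum-split f lo n) (sum-mono f le)

sum≡0⇒ : ∀ f n → sum f n ≡ 0 → ∀ {i} → i < n → f i ≡ 0
sum≡0⇒ f (suc n) e {i} i<1+n with m≤n⇒m<n∨m≡n (s≤s⁻¹ i<1+n)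
... | inj₁ i<n  = sum≡0⇒ f n (m+n≡0⇒m≡0 (sum f n) e) i<n
... | inj₂ refl = m+n≡0⇒n≡0 (sum f n) e

pigeonhole : ∀ f n → (∃ λ i → i < n × f i ≡ 0) ⊎ n ≤ sum f n
pigeonhole f zero = inj₂ z≤n
pigeonhole f (suc n) with pigeonhole f n
... | inj₁ (i , i<n , e) = inj₁ (i , m<n⇒m<1+n i<n , e)
... | inj₂ n≤ with f n in eq
...   | zero  = inj₁ (n , ≤-refl , eq)
...   | suc k = inj₂ (entail (n ∷ (sum f n) ∷ k ∷ []) (‵ 1) (‵ 1 ⊕ # 0) (# 1 ⊕ (‵ 1 ⊕ # 2)) (# 0 ≼ # 1 ∷ []) refl (n≤ ,
  tt))

find-zero : ∀ f n {D} → sum f n ≤ D → D < n → ∃ λ i → i < n × f i ≡ 0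
find-zero f n s≤D D<n with pigeonhole f n
... | inj₁ r  = r
... | inj₂ n≤ = ⊥-elim (<-irrefl refl (≤-trans D<n (≤-trans n≤ s≤D)))

-- The zeros are wanted at one common offset. The three intervals are disjoint, so the sum of the
-- three translates of `f` still has total at most D over n > D places.
find-zero³ : ∀ f {a b c n D hi} → sum f hi ≤ D → D < n → a + n ≤ b → b + n ≤ c → c + n ≤ hi →
  ∃ λ i → i < n × f (a + i) ≡ 0 × f (b + i) ≡ 0 × f (c + i) ≡ 0
find-zero³ f {a} {b} {c} {n} {D} {hi} S≤D D<n ab bc chi
  with find-zero (λ i → f (a + i) + f (b + i) + f (c + i)) n total D<n
  where
  I₁ = interval-after f a n ab
  I₂ = interval-after f b n bc
  I₃ = interval-after f c n chi
  total : sum (λ i → f (a + i) + f (b + i) + f (c + i)) n ≤ D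
  total = subst (_≤ D)
    (sym (trans (sum-+ (λ i → f (a + i) + f (b + i)) (λ i → f (c + i)) n)
                (cong (_+ interval f c n) (sum-+ (λ i → f (a + i)) (λ i → f (b + i)) n))))
    (entail ((sum f a) ∷ (interval f a n) ∷ (sum f b) ∷ (interval f b n) ∷ (sum f c) ∷ (interval f c n) ∷ (sum f hi) ∷ D
      ∷ []) (‵ 1) (# 1 ⊕ # 3 ⊕ # 5) (# 7) (# 0 ⊕ # 1 ≼ # 2 ∷ # 2 ⊕ # 3 ≼ # 4 ∷ # 4 ⊕ # 5 ≼ # 6 ∷ # 6 ≼ # 7 ∷ []) refl
      (I₁ , I₂ , I₃ , S≤D , tt))
... | i , i<n , e = i , i<n , m+n≡0⇒m≡0 _ (m+n≡0⇒m≡0 _ e) , m+n≡0⇒n≡0 (f (a + i)) (m+n≡0⇒m≡0 _ e) , m+n≡0⇒n≡0 (f (a + i) + f (b + i)) e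

find-zero¹ : ∀ f {a n D hi} → sum f hi ≤ D → D < n → a + n ≤ hi → ∃ λ i → i < n × f (a + i) ≡ 0
find-zero¹ f {a} {n} S≤D D<n le = find-zero (λ i → f (a + i)) n
  (≤-trans (m≤n+m _ (sum f a)) (≤-trans (interval-after f a n le) S≤D)) D<n

-- The translates by i < n of the offsets e 0, …, e J are disjoint because consecutive offsets are n apart.
spaced : ∀ f o (e : ℕ → ℕ) n → (∀ j → e j + n ≤ e (suc j)) → ∀ J →
  sum f (o + e 0) + sum (λ i → sum (λ j → f (o + e j + i)) (suc J)) n ≤ sum f (o + e J + n)
spaced f o e n gap J = subst (λ s → sum f (o + e 0) + s ≤ sum f (o + e J + n))
  (sym (sum-swap (λ i j → f (o + e j + i)) (suc J) n)) (go J)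
  where
  go : ∀ J → sum f (o + e 0) + sum (λ j → interval f (o + e j) n) (suc J) ≤ sum f (o + e J + n)
  go zero    = interval-after f (o + e 0) n ≤-refl
  go (suc J) = (entail ((sum f (o + e 0)) ∷ (sum (λ j → interval f (o + e j) n) (suc J)) ∷ (sum f (o + e J + n)) ∷ (sum
    f (o + e (suc J))) ∷ (interval f (o + e (suc J)) n) ∷ (sum f (o + e (suc J) + n)) ∷ []) (‵ 1) (# 0 ⊕ (# 1 ⊕ # 4)) (#
    5) (# 0 ⊕ # 1 ≼ # 2 ∷ # 2 ≼ # 3 ∷ # 3 ⊕ # 4 ≼ # 5 ∷ []) refl (go J , sum-mono f step , interval-after f (o + e (suc
    J)) n ≤-refl , tt))
    where step : o + e J + n ≤ o + e (suc J)
          step = subst (_≤ o + e (suc J)) (sym (+-assoc o (e J) n)) (+-monoʳ-≤ o (gap J))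

-- The second alternative keeps the part of the sum that precedes all translates. With n = D + 1 it
-- is absurd; with n = D it forces that part to vanish.
find-spaced : ∀ f o (e : ℕ → ℕ) n → (∀ j → e j + n ≤ e (suc j)) → ∀ J {D hi} → sum f hi ≤ D → o + e J + n ≤ hi →
  (∃ λ i → i < n × (∀ {j} → j ≤ J → f (o + e j + i) ≡ 0)) ⊎ sum f (o + e 0) + n ≤ D
find-spaced f o e n gap J {D} {hi} S≤D le with pigeonhole (λ i → sum (λ j → f (o + e j + i)) (suc J)) n
... | inj₁ (i , i<n , z) = inj₁ (i , i<n , λ j≤J → sum≡0⇒ (λ j → f (o + e j + i)) (suc J) z (s≤s j≤J))
... | inj₂ n≤ = inj₂ (≤-trans (+-monoʳ-≤ (sum f (o + e 0)) n≤) (≤-trans (spaced f o e n gap J) (≤-trans (sum-mono f le) S≤D)))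

-- Positions in the window

Off Near : ℕ → ℕ → ℕ → Set
Off  p s t = s + p ≡ t ⊎ s ≡ t + p
Near p s t = s ≡ t ⊎ Off p s t

-- Used with u = m x, z = m v and x + d = v: the relation x + (q + d) = v + q holds for positions up
-- to a multiple of p, and equality is excluded.
Jump : ℕ → (ℕ → Set) → (ℕ → ℕ) → ℕ → ℕ → ℕ → Set
Jump p High m u z d = ∀ q → High q → High (q + d) → Off p (u + m (q + d)) (z + m q)

module _ {p : ℕ} {High : ℕ → Set} {m : ℕ → ℕ} (m<p : ∀ {a} → High a → m a < p) where

  -- Positions lie below p, so u < z rules out one of the two signs. Every hop then lowers `m` by
  -- the same positive amount u + p - z.
  jump-down : ∀ {u z d} → u < z → Jump p High m u z d →
    ∀ {q} → High q → High (q + d) → m q + z ≡ u + p + m (q + d)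
  jump-down {u} {z} {d} u<z J {q} hq ht with J q hq ht
  ... | inj₁ e = (equate (u ∷ (m (q + d)) ∷ p ∷ z ∷ (m q) ∷ []) 1 (# 4 ⊕ # 3) (# 0 ⊕ # 2 ⊕ # 1) (# 3 ⊕ # 4 ≼ # 0 ⊕ # 1 ⊕
    # 2 ∷ []) refl (sym e , tt))
  ... | inj₂ e = ⊥-elim (refute (u ∷ (m (q + d)) ∷ z ∷ (m q) ∷ p ∷ []) (# 2 ⊕ # 3 ⊕ # 4 ≼ # 0 ⊕ # 1 ∷ # 1 ≺ # 4 ∷ # 0 ≺
    # 2 ∷ []) refl (≤-reflexive (sym e) , m<p ht , u<z , tt))

  jumps-descend : ∀ {u z d t} → u < z → z < p → Jump p High m u z d →
    ∀ n → (∀ {j} → j ≤ n → High (t + j * d)) → m (t + n * d) ≤ m t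
  jumps-descend {t = t} u<z z<p J zero    h = ≤-reflexive (cong m (+-identityʳ t))
  jumps-descend {u} {z} {d} {t} u<z z<p J (suc n) h =
    (entail ((m (t + n * d)) ∷ (m t) ∷ z ∷ u ∷ p ∷ (m (t + n * d + d)) ∷ (m (t + suc n * d)) ∷ []) (‵ 1) (# 6) (# 1) (#
      0 ≼ # 1 ∷ # 3 ⊕ # 4 ⊕ # 5 ≼ # 0 ⊕ # 2 ∷ # 6 ≼ # 5 ∷ # 2 ≺ # 4 ∷ []) refl (jumps-descend u<z z<p J n (λ j≤n → h
      (m≤n⇒m≤1+n j≤n)) , ≤-reflexive (sym (jump-down u<z J (h (n≤1+n n)) (subst High next (h ≤-refl)))) , ≤-reflexive
      (cong m next) , z<p , tt))
    where next : t + suc n * d ≡ t + n * d + d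
          next = (identity (t ∷ d ∷ n ∷ []) (# 0 ⊕ (# 1 ⊕ # 2 ⊗ # 1)) (# 0 ⊕ # 2 ⊗ # 1 ⊕ # 1) refl)

  -- Hops by d all lower m, and by the same amount, so the end of a long path cannot be one wrap away from its start.
  no-path-↓ : ∀ {u z z′ w d d′ ℓ q t} → u < z → z < p → z′ < p → w < p →
    Jump p High m u z d → Jump p High m u z′ d′ →
    High q → High (q + d) → High (q + d′) →
    High t → (∀ {j} → j ≤ suc ℓ → High (t + d′ + j * d)) →
    ¬ Off p (u + m t) (w + m (t + d′ + ℓ * d))
  no-path-↓ {u} {z} {z′} {w} {d} {d′} {ℓ} {q} {t} u<z z<p z′<p w<p J J′ hq hqd hqd′ ht h off with u <? z′
  -- If z′ ≤ u, one sign of the wrap exceeds the range of `m` and the other gives m q < u, while the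
  -- hop of length d from the same q gives m q > u. So the two kinds of hop have the same direction.
  ... | no u≮z′ with J′ q hq hqd′
  ...   | inj₁ e = (refute (u ∷ (m (q + d′)) ∷ p ∷ z′ ∷ (m q) ∷ []) (# 0 ⊕ # 1 ⊕ # 2 ≼ # 3 ⊕ # 4 ∷ # 4 ≺ # 2 ∷ # 3 ≼ # 0
    ∷ []) refl (≤-reflexive e , m<p hq , ≮⇒≥ u≮z′ , tt))
  ...   | inj₂ e = (refute (u ∷ (m (q + d′)) ∷ z′ ∷ (m q) ∷ p ∷ z ∷ (m (q + d)) ∷ []) (# 2 ⊕ # 3 ⊕ # 4 ≼ # 0 ⊕ # 1 ∷ # 1
    ≺ # 4 ∷ # 0 ⊕ # 4 ⊕ # 6 ≼ # 3 ⊕ # 5 ∷ # 5 ≺ # 4 ∷ []) refl (≤-reflexive (sym e) , m<p hqd′ , ≤-reflexive (sym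
    (jump-down u<z J hq hqd)) , z<p , tt))
  no-path-↓ {u} {z} {z′} {w} {d} {d′} {ℓ} {q} {t} u<z z<p z′<p w<p J J′ hq hqd hqd′ ht h off | yes u<z′ = contra off
    where
    t₁ = t + d′
    first : m t + z′ ≡ u + p + m t₁
    first = jump-down u<z′ J′ ht (subst High (+-identityʳ t₁) (h z≤n))
    next : t₁ + suc ℓ * d ≡ t₁ + ℓ * d + d
    next = (identity (t₁ ∷ d ∷ ℓ ∷ []) (# 0 ⊕ (# 1 ⊕ # 2 ⊗ # 1)) (# 0 ⊕ # 2 ⊗ # 1 ⊕ # 1) refl)
    last : m (t₁ + ℓ * d) + z ≡ u + p + m (t₁ + ℓ * d + d)
    last = jump-down u<z J (h (n≤1+n ℓ)) (subst High next (h ≤-refl))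
    below : m (t₁ + ℓ * d) ≤ m t₁
    below = jumps-descend u<z z<p J ℓ (λ j≤ℓ → h (m≤n⇒m≤1+n j≤ℓ))
    contra : ¬ Off p (u + m t) (w + m (t₁ + ℓ * d))
    -- As w < p, this wrap would put the end of the path above its start.
    contra (inj₁ e) = (refute (u ∷ (m t) ∷ p ∷ w ∷ (m (t₁ + ℓ * d)) ∷ (m t₁) ∷ z′ ∷ []) (# 0 ⊕ # 1 ⊕ # 2 ≼ # 3 ⊕ # 4 ∷ #
      4 ≼ # 5 ∷ # 0 ⊕ # 2 ⊕ # 5 ≼ # 1 ⊕ # 6 ∷ # 6 ≺ # 2 ∷ # 3 ≺ # 2 ∷ []) refl (≤-reflexive e , below , ≤-reflexive (sym
      first) , z′<p , w<p , tt))
    -- As m t < p, this wrap puts the end of the path below u. But one more hop starts there and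
    -- needs `m` to exceed u; hence `suc ℓ` in the hypothesis.
    contra (inj₂ e) = (refute (u ∷ (m t) ∷ w ∷ (m (t₁ + ℓ * d)) ∷ p ∷ z ∷ (m (t₁ + ℓ * d + d)) ∷ []) (# 2 ⊕ # 3 ⊕ # 4 ≼
      # 0 ⊕ # 1 ∷ # 1 ≺ # 4 ∷ # 0 ⊕ # 4 ⊕ # 6 ≼ # 3 ⊕ # 5 ∷ # 5 ≺ # 4 ∷ []) refl (≤-reflexive (sym e) , m<p ht ,
      ≤-reflexive (sym last) , z<p , tt))

  unit-jumps : ∀ {u z f t} → u < z → f + z ≡ u + p → Jump p High m u z 1 →
    ∀ n → (∀ {j} → j ≤ n → High (t + j)) → m t ≡ n * f + m (t + n)
  unit-jumps {t = t} u<z ef J zero    h = cong m (sym (+-identityʳ t))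
  unit-jumps {u} {z} {f} {t} u<z ef J (suc n) h =
    (equate ((m t) ∷ n ∷ f ∷ (m (t + n)) ∷ z ∷ u ∷ p ∷ (m (t + n + 1)) ∷ (m (t + suc n)) ∷ []) 1 (# 0) (# 2 ⊕ # 1 ⊗ # 2
      ⊕ # 8) (# 0 ≼ # 1 ⊗ # 2 ⊕ # 3 ∷ # 3 ⊕ # 4 ≼ # 5 ⊕ # 6 ⊕ # 7 ∷ # 7 ≼ # 8 ∷ # 5 ⊕ # 6 ≼ # 2 ⊕ # 4 ∷ []) refl
      (unit-jumps u<z ef J n (λ j≤n → h (m≤n⇒m≤1+n j≤n)) , jump-down u<z J (h (n≤1+n n)) (subst High next (h ≤-refl)) ,
      sym (cong m next) , sym ef , tt))
    where next : t + suc n ≡ t + n + 1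
          next = (identity (t ∷ n ∷ []) (# 0 ⊕ (‵ 1 ⊕ # 1)) (# 0 ⊕ # 1 ⊕ ‵ 1) refl)

  -- There is no room for a spare hop here. The k hops lower `m` by k * f in all, where f = u + p -
  -- z, and p = 1 + 3k settles each f: a value above 3 exceeds the range of `m`, a value below 3 is
  -- too small for the wrap, and 3 is excluded by hypothesis.
  no-unit-path-↓ : ∀ {u z w k t} → u < z → z < p → w < p → p ≡ 1 + 3 * k → 0 < k → Jump p High m u z 1 →
    (∀ {j} → j ≤ k → High (t + j)) → m t ≢ 3 + m (t + 1) → ¬ Off p (u + m t) (w + m (t + k))
  no-unit-path-↓ {u} {z} {w} {k} {t} u<z z<p w<p p≡ 0<k J h no3 (inj₁ e) =
    (refute (u ∷ (m t) ∷ p ∷ w ∷ (m (t + k)) ∷ k ∷ (u + p ∸ z) ∷ []) (# 0 ⊕ # 1 ⊕ # 2 ≼ # 3 ⊕ # 4 ∷ # 3 ≺ # 2 ∷ # 5 ⊗ #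
      6 ⊕ # 4 ≼ # 1 ∷ []) refl (≤-reflexive e , w<p , ≤-reflexive (sym (unit-jumps {f = u + p ∸ z} u<z (m∸n+n≡m (≤-trans
      (<⇒≤ z<p) (m≤n+m p u))) J k h)) , tt))
  no-unit-path-↓ {u} {z} {w} {k} {t} u<z z<p w<p p≡ 0<k J h no3 (inj₂ e) = by-size (u + p ∸ z) (m∸n+n≡m (≤-trans (<⇒≤ z<p) (m≤n+m p u)))
    where
    ht : High t
    ht = subst High (+-identityʳ t) (h z≤n)
    by-size : ∀ f → f + z ≡ u + p → ⊥
    by-size f ef with f ≤? 2 | f ≟ 3
    -- From z < p follows u < f, and the wrap reads u + k * f = w + p; so p ≤ f - 1 + k * f.
    ... | yes f≤2 | _ = (refute (f ∷ k ∷ z ∷ u ∷ p ∷ (m t) ∷ w ∷ (m (t + k)) ∷ []) ((‵ 1 ⊕ # 1 , # 0 , ‵ 2) ∷ # 3 ⊕ # 4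
      ≼ # 0 ⊕ # 2 ∷ # 2 ≺ # 4 ∷ ‵ 0 ≺ # 1 ∷ ‵ 3 ⊗ # 1 ≺ # 4 ∷ # 6 ⊕ # 7 ⊕ # 4 ≼ # 3 ⊕ # 5 ∷ # 5 ≼ # 1 ⊗ # 0 ⊕ # 7 ∷ [])
      refl (f≤2 , ≤-reflexive (sym ef) , z<p , 0<k , ≤-reflexive (sym p≡) , ≤-reflexive (sym e) , ≤-reflexive
      (unit-jumps u<z ef J k h) , tt))
    ... | no _ | yes refl = no3 (trans (unit-jumps u<z ef J 1 (λ j≤1 → h (≤-trans j≤1 0<k))) refl)
    ... | no f≰2 | no f≢3 = (refute (f ∷ k ∷ (m t) ∷ p ∷ (m (t + k)) ∷ []) ((# 1 , ‵ 1 ⊕ ‵ 3 , # 0) ∷ # 2 ≺ # 3 ∷ # 3 ≼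
      ‵ 1 ⊕ ‵ 3 ⊗ # 1 ∷ ‵ 0 ≺ # 1 ∷ # 1 ⊗ # 0 ⊕ # 4 ≼ # 2 ∷ []) refl (≤∧≢⇒< (≰⇒> f≰2) (λ e → f≢3 (sym e)) , m<p ht ,
      ≤-reflexive p≡ , 0<k , ≤-reflexive (sym (unit-jumps u<z ef J k h)) , tt))

-- The order reversing map i ↦ p - 1 - i of the window. It reduces jumps with z < u to jumps with u
-- < z.
reflect : ℕ → ℕ → ℕ
reflect p i = p ∸ suc i

reflect-+ : ∀ {p i} → i < p → reflect p i + suc i ≡ p
reflect-+ i<p = m∸n+n≡m i<p

reflect-< : ∀ {p i} → i < p → reflect p i < p
reflect-< {p} {i} i<p = (entail ((reflect p i) ∷ i ∷ p ∷ []) (‵ 1) (‵ 1 ⊕ # 0) (# 2) (# 0 ⊕ (‵ 1 ⊕ # 1) ≼ # 2 ∷ []) refl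
  (≤-reflexive (reflect-+ i<p) , tt))

reflect-off : ∀ {p a b c d} → a < p → b < p → c < p → d < p → Off p (a + b) (c + d) →
  Off p (reflect p a + reflect p b) (reflect p c + reflect p d)
reflect-off {p} {a} {b} {c} {d} a< b< c< d< (inj₁ e) = inj₂
  (equate (a ∷ b ∷ p ∷ c ∷ d ∷ (reflect p a) ∷ (reflect p b) ∷ (reflect p c) ∷ (reflect p d) ∷ []) 1 (# 5 ⊕ # 6) (# 7 ⊕
    # 8 ⊕ # 2) (# 3 ⊕ # 4 ≼ # 0 ⊕ # 1 ⊕ # 2 ∷ # 5 ⊕ (‵ 1 ⊕ # 0) ≼ # 2 ∷ # 6 ⊕ (‵ 1 ⊕ # 1) ≼ # 2 ∷ # 2 ≼ # 7 ⊕ (‵ 1 ⊕ #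
    3) ∷ # 2 ≼ # 8 ⊕ (‵ 1 ⊕ # 4) ∷ []) refl (sym e , reflect-+ a< , reflect-+ b< , sym (reflect-+ c<) , sym (reflect-+
    d<) , tt))
reflect-off {p} {a} {b} {c} {d} a< b< c< d< (inj₂ e) = inj₁
  (equate (a ∷ b ∷ c ∷ d ∷ p ∷ (reflect p a) ∷ (reflect p b) ∷ (reflect p c) ∷ (reflect p d) ∷ []) 1 (# 5 ⊕ # 6 ⊕ # 4)
    (# 7 ⊕ # 8) (# 2 ⊕ # 3 ⊕ # 4 ≼ # 0 ⊕ # 1 ∷ # 5 ⊕ (‵ 1 ⊕ # 0) ≼ # 4 ∷ # 6 ⊕ (‵ 1 ⊕ # 1) ≼ # 4 ∷ # 4 ≼ # 7 ⊕ (‵ 1 ⊕ #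
    2) ∷ # 4 ≼ # 8 ⊕ (‵ 1 ⊕ # 3) ∷ []) refl (sym e , reflect-+ a< , reflect-+ b< , sym (reflect-+ c<) , sym (reflect-+
    d<) , tt))

module _ {p : ℕ} {High : ℕ → Set} {m : ℕ → ℕ} (m<p : ∀ {a} → High a → m a < p) where

  jump-≢ : ∀ {u z d q} → Jump p High m u z d → High q → High (q + d) → u ≢ z
  jump-≢ {u} {d = d} {q} J hq ht refl with J q hq ht
  ... | inj₁ e = (refute (u ∷ (m (q + d)) ∷ p ∷ (m q) ∷ []) (# 0 ⊕ # 1 ⊕ # 2 ≼ # 0 ⊕ # 3 ∷ # 3 ≺ # 2 ∷ []) refl
    (≤-reflexive e , m<p hq , tt))
  ... | inj₂ e = (refute (u ∷ (m (q + d)) ∷ (m q) ∷ p ∷ []) (# 0 ⊕ # 2 ⊕ # 3 ≼ # 0 ⊕ # 1 ∷ # 1 ≺ # 3 ∷ []) refl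
    (≤-reflexive (sym e) , m<p ht , tt))

  reflect-jump : ∀ {u z d} → u < p → z < p → Jump p High m u z d → Jump p High (λ a → reflect p (m a)) (reflect p u) (reflect p z) d
  reflect-jump u<p z<p J q hq ht = reflect-off u<p (m<p ht) z<p (m<p hq) (J q hq ht)

  reflect-anti : ∀ {u z} → u < p → z < p → z < u → reflect p u < reflect p z
  reflect-anti {u} {z} u<p z<p z<u = (entail (z ∷ u ∷ (reflect p u) ∷ p ∷ (reflect p z) ∷ []) (‵ 1) (‵ 1 ⊕ # 2) (# 4) (#
    0 ≺ # 1 ∷ # 2 ⊕ (‵ 1 ⊕ # 1) ≼ # 3 ∷ # 3 ≼ # 4 ⊕ (‵ 1 ⊕ # 0) ∷ []) refl (z<u , ≤-reflexive (reflect-+ u<p) ,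
    ≤-reflexive (sym (reflect-+ z<p)) , tt))

  no-path : ∀ {u z z′ w d d′ ℓ q t} → u < p → z < p → z′ < p → w < p →
    Jump p High m u z d → Jump p High m u z′ d′ →
    High q → High (q + d) → High (q + d′) →
    High t → (∀ {j} → j ≤ suc ℓ → High (t + d′ + j * d)) →
    ¬ Off p (u + m t) (w + m (t + d′ + ℓ * d))
  no-path {u} {z} {ℓ = ℓ} u<p z<p z′<p w<p J J′ hq hqd hqd′ ht h off with <-cmp u z
  ... | tri< u<z _ _ = no-path-↓ m<p {ℓ = ℓ} u<z z<p z′<p w<p J J′ hq hqd hqd′ ht h off
  ... | tri≈ _ u≡z _ = jump-≢ J hq hqd u≡z
  ... | tri> _ _ z<u = no-path-↓ {m = λ a → reflect p (m a)} (λ ha → reflect-< (m<p ha)) {ℓ = ℓ}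
    (reflect-anti u<p z<p z<u) (reflect-< z<p) (reflect-< z′<p) (reflect-< w<p)
    (reflect-jump u<p z<p J) (reflect-jump u<p z′<p J′) hq hqd hqd′ ht h
    (reflect-off u<p (m<p ht) w<p (m<p (h (n≤1+n ℓ))) off)

  no-unit-path : ∀ {u z w k t} → u < p → z < p → w < p → p ≡ 1 + 3 * k → 0 < k → Jump p High m u z 1 →
    (∀ {j} → j ≤ k → High (t + j)) → m t ≢ 3 + m (t + 1) → m (t + 1) ≢ 3 + m t → ¬ Off p (u + m t) (w + m (t + k))
  no-unit-path {u} {z} {k = k} {t} u<p z<p w<p p≡ 0<k J h no3 no3′ off with <-cmp u z
  ... | tri< u<z _ _ = no-unit-path-↓ m<p {k = k} u<z z<p w<p p≡ 0<k J h no3 off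
  ... | tri≈ _ u≡z _ = jump-≢ J ht (h 0<k) u≡z
    where ht = subst High (+-identityʳ t) (h z≤n)
  ... | tri> _ _ z<u = no-unit-path-↓ {m = λ a → reflect p (m a)} (λ ha → reflect-< (m<p ha)) {k = k}
    (reflect-anti u<p z<p z<u) (reflect-< z<p) (reflect-< w<p) p≡ 0<k (reflect-jump u<p z<p J) h
    (λ e → no3′ (equate ((reflect p (m t)) ∷ (reflect p (m (t + 1))) ∷ (m t) ∷ p ∷ (m (t + 1)) ∷ []) 1 (# 4) (‵ 3 ⊕ # 2)
      (# 0 ≼ ‵ 3 ⊕ # 1 ∷ # 3 ≼ # 0 ⊕ (‵ 1 ⊕ # 2) ∷ # 1 ⊕ (‵ 1 ⊕ # 4) ≼ # 3 ∷ []) refl (e , sym (reflect-+ (m<p ht)) ,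
      reflect-+ (m<p (h 0<k)) , tt)))
    (reflect-off u<p (m<p ht) w<p (m<p (h ≤-refl)) off)
    where ht = subst High (+-identityʳ t) (h z≤n)

-- Impossibility of a large excess in a window

-- A window of p consecutive M, indexed by the coordinate a of M: m a is the position in the window, def a the amount
-- by which the summand at a misses its upper bound. Low means N = 0; Wrap and High mean b ≥ B and c ≥ C together with
-- N = 1 and N = 2.
record Configuration (p α β : ℕ) (def : ℕ → ℕ) : Set₁ where
  field
    Low Wrap High : ℕ → Set
    m       : ℕ → ℕ
    m<p     : ∀ {a} → a < p → m a < p
    m-near  : ∀ {a b c d} → a < p → b < p → c < p → d < p →
              a + b ≡ c + d ⊎ a + p + b ≡ c + d → Near p (m a + m b) (m c + m d)
    High<p  : ∀ {a} → High a → a < p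
    A-zone  : ∀ {a} → a < α → def a ≡ 0 → Low a ⊎ Wrap a
    B-zone  : ∀ {a} → α + β ≤ a → a < p → def a ≡ 0 → High a
    spread  : ∀ {a b} → High a → High b → a < b + (α + β)
    spread′ : ∀ {a b} → Wrap a → High b → a + p < b + (α + β)
    ascend  : ∀ {x v q t} → x < p → Low x → High q → High t → β ≤ v → v < α + β → x + t ≡ v + q →
              m x + m t ≡ m v + m q → def v ≡ 0 → High v
    descend : ∀ {x a b c d} → x < p → Low x → High a → High b → High c → High d → x + p + b ≡ c + d →
              m x + m b ≡ m c + m d → x + p < a + 2 * β
    rigid   : ∀ {a} → α ≡ β → p ≡ 1 + 3 * α → suc a < p → (m a ≢ 3 + m (a + 1)) × (m (a + 1) ≢ 3 + m a)

module _ {p α β D : ℕ} {def : ℕ → ℕ} (C : Configuration p α β def)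
  (0<α : 0 < α) (α≤β : α ≤ β) (S≤D : sum def p ≤ D) (p-large : 1 + 3 * (β + D) ≤ p) where
  open Configuration C

  private
    High-m : ∀ {a} → High a → m a < p
    High-m h = m<p (High<p h)

    α<p : α < p
    α<p = (entail (β ∷ D ∷ p ∷ α ∷ []) (‵ 1) (‵ 1 ⊕ # 3) (# 2) (‵ 3 ⊗ (# 0 ⊕ # 1) ≺ # 2 ∷ # 3 ≼ # 0 ∷ []) refl (p-large
      , α≤β , tt))

    below : ∀ {v} → v < α + β → v < p
    below {v} v<o = (entail (v ∷ α ∷ β ∷ D ∷ p ∷ []) (‵ 2) (‵ 1 ⊕ # 0) (# 4) ((‵ 3 , ‵ 1 ⊕ # 0 , # 1 ⊕ # 2) ∷ (‵ 3 , # 1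
      , # 2) ∷ (‵ 2 , ‵ 1 ⊕ ‵ 3 ⊗ (# 2 ⊕ # 3) , # 4) ∷ []) refl (v<o , α≤β , p-large , tt))

    -- A `High` residue close to α + β is the reference point: `spread`, `spread′` and `descend`
    -- bound other residues in terms of it.
    lowest : ∃ λ r₀ → r₀ ≤ α + β + D × High r₀
    lowest with find-zero¹ def {α + β} {suc D} S≤D ≤-refl
      (entail (β ∷ D ∷ p ∷ α ∷ []) (‵ 1) (# 3 ⊕ # 0 ⊕ (‵ 1 ⊕ # 1)) (# 2) (‵ 3 ⊗ (# 0 ⊕ # 1) ≺ # 2 ∷ # 3 ≼ # 0 ∷ ‵ 1 ≼ #
        0 ∷ []) refl (p-large , α≤β , ≤-trans 0<α α≤β , tt))
    ... | c , c<1+D , z = α + β + c , +-monoʳ-≤ (α + β) (s≤s⁻¹ c<1+D) , B-zone (m≤m+n (α + β) c)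
      (entail (c ∷ D ∷ β ∷ p ∷ α ∷ []) (‵ 1) (‵ 1 ⊕ (# 4 ⊕ # 2 ⊕ # 0)) (# 3) (# 0 ≺ ‵ 1 ⊕ # 1 ∷ ‵ 3 ⊗ (# 2 ⊕ # 1) ≺ # 3
        ∷ # 4 ≼ # 2 ∷ []) refl (c<1+D , p-large , α≤β , tt)) z

    highest : ∀ {top} → top + suc D ≡ p → ∃ λ i → i < suc D × def (top + i) ≡ 0 × High (top + i)
    highest {top} top-+ with find-zero¹ def {top} {suc D} S≤D ≤-refl (≤-reflexive top-+)
    ... | i , i<1+D , z = i , i<1+D , z , B-zone
      (entail (top ∷ D ∷ p ∷ β ∷ α ∷ i ∷ []) (‵ 3) (# 4 ⊕ # 3) (# 0 ⊕ # 5) ((‵ 2 , # 2 , # 0 ⊕ (‵ 1 ⊕ # 1)) ∷ (‵ 2 , ‵ 1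
        ⊕ ‵ 3 ⊗ (# 3 ⊕ # 1) , # 2) ∷ (‵ 3 , # 4 , # 3) ∷ []) refl (≤-reflexive (sym top-+) , p-large , α≤β , tt))
      (entail (top ∷ D ∷ p ∷ i ∷ []) (‵ 1) (‵ 1 ⊕ (# 0 ⊕ # 3)) (# 2) (# 0 ⊕ (‵ 1 ⊕ # 1) ≼ # 2 ∷ # 3 ≺ ‵ 1 ⊕ # 1 ∷ [])
        refl (≤-reflexive top-+ , i<1+D , tt)) z

    -- The `High` residues found by pigeonhole at the two ends are at least p - 1 - α - β - 2D
    -- apart, which `spread` permits only if α is not much smaller than β.
    β+D<2α : β + D < α + α
    β+D<2α = case lowest of λ { (r₀ , r₀≤ , high₀) → case highest top-+ of λ { (i , _ , _ , h) →
      (entail ((p ∸ suc D) ∷ i ∷ r₀ ∷ α ∷ β ∷ D ∷ p ∷ []) (‵ 1) (‵ 1 ⊕ (# 4 ⊕ # 5)) (# 3 ⊕ # 3) (# 0 ⊕ # 1 ≺ # 2 ⊕ (# 3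
        ⊕ # 4) ∷ # 2 ≼ # 3 ⊕ # 4 ⊕ # 5 ∷ # 6 ≼ # 0 ⊕ (‵ 1 ⊕ # 5) ∷ ‵ 3 ⊗ (# 4 ⊕ # 5) ≺ # 6 ∷ []) refl (spread h high₀ ,
        r₀≤ , ≤-reflexive (sym top-+) , p-large , tt)) } }
      where top-+ = m∸n+n≡m {p} {suc D} (entail (β ∷ D ∷ p ∷ []) (‵ 1) (‵ 1 ⊕ # 1) (# 2) (‵ 3 ⊗ (# 0 ⊕ # 1) ≺ # 2 ∷ [])
              refl (p-large , tt))

    -- n hops of length d, where n = ℓ + 2 = ⌈(k + 1) / d⌉, overshoot k + 1 by s
    hops : ∀ {k d} → 0 < d → d ≤ k → ∃₂ λ ℓ s → (2 + ℓ) * d ≡ suc k + s × s < d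
    hops {k} {suc c} _ d≤k with k / suc c | m≡m%n+[m/n]*n k (suc c) | m%n<n k (suc c)
    ... | zero  | eq | lt = ⊥-elim (refute (k ∷ (k % suc c) ∷ c ∷ []) (# 0 ≼ # 1 ⊕ ‵ 0 ∷ # 1 ≺ ‵ 1 ⊕ # 2 ∷ # 2 ≺ # 0 ∷
      []) refl (≤-reflexive eq , lt , d≤k , tt))
    ... | suc ℓ | eq | lt = ℓ , c ∸ k % suc c
      , (equate (k ∷ (k % suc c) ∷ c ∷ ℓ ∷ (c ∸ k % suc c) ∷ []) 1 (‵ 1 ⊕ # 2 ⊕ (‵ 1 ⊕ # 2 ⊕ # 3 ⊗ (‵ 1 ⊕ # 2))) (‵ 1 ⊕
        # 0 ⊕ # 4) (# 1 ⊕ (‵ 1 ⊕ # 2 ⊕ # 3 ⊗ (‵ 1 ⊕ # 2)) ≼ # 0 ∷ # 2 ≼ # 4 ⊕ # 1 ∷ []) refl (sym eq , sym (m∸n+n≡m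
        (s≤s⁻¹ lt)) , tt))
      , s≤s (m∸n≤m c (k % suc c))

    -- By the two equations base + d = β. So x = base + z and v = β + z differ by d, and for z ≤ D
    -- they stay in the ranges [base, α) and [β, α + β).
    module Frame {d base r₀ : ℕ} (α+d : d + α ≡ suc (β + D)) (base-+ : base + suc D ≡ α)
      (r₀≤ : r₀ ≤ α + β + D) (high₀ : High r₀) where

      D<d : D < d
      D<d = (entail (d ∷ α ∷ β ∷ D ∷ []) (‵ 1) (‵ 1 ⊕ # 3) (# 0) (# 2 ⊕ # 3 ≺ # 0 ⊕ # 1 ∷ # 1 ≼ # 2 ∷ []) refl
        (≤-reflexive (sym α+d) , α≤β , tt))

      low : ∀ {x} → base ≤ x → x < α → def x ≡ 0 → Low x
      low {x} b≤x x<α z with A-zone x<α z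
      ... | inj₁ l = l
      -- A `Wrap` residue this close to α would, by `spread′`, place r₀ above α + β + D.
      ... | inj₂ w = ⊥-elim (refute (x ∷ p ∷ r₀ ∷ α ∷ β ∷ D ∷ base ∷ []) (# 0 ⊕ # 1 ≺ # 2 ⊕ (# 3 ⊕ # 4) ∷ # 2 ≼ # 3 ⊕ #
        4 ⊕ # 5 ∷ # 6 ≼ # 0 ∷ # 3 ≼ # 6 ⊕ (‵ 1 ⊕ # 5) ∷ ‵ 3 ⊗ (# 4 ⊕ # 5) ≺ # 1 ∷ # 3 ≼ # 4 ∷ []) refl (spread′ w high₀
        , r₀≤ , b≤x , ≤-reflexive (sym base-+) , p-large , α≤β , tt))

      -- By `ascend`, equality of the two sums of positions for a single q would make v `High`. So
      -- the sums are off by p for every admissible q.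
      jump : ∀ {x v δ} → base ≤ x → x < α → def x ≡ 0 → β ≤ v → v < α + β → def v ≡ 0 → ¬ High v → x + δ ≡ v →
             Jump p High m (m x) (m v) δ
      jump {x} {v} {δ} b≤x x<α zx β≤v v<o zv ¬hv x+δ q hq ht
        with m-near {x} {q + δ} {v} {q} (<-trans x<α α<p) (High<p ht) (below v<o) (High<p hq) (inj₁ same)
        where
        same : x + (q + δ) ≡ v + q
        same = (equate (x ∷ δ ∷ v ∷ q ∷ []) 1 (# 0 ⊕ (# 3 ⊕ # 1)) (# 2 ⊕ # 3) (# 0 ⊕ # 1 ≼ # 2 ∷ []) refl (x+δ , tt))
      ... | inj₁ e = ⊥-elim (¬hv (ascend (<-trans x<α α<p) (low b≤x x<α zx) hq ht β≤v v<o
                       (equate (x ∷ δ ∷ v ∷ q ∷ []) 1 (# 0 ⊕ (# 3 ⊕ # 1)) (# 2 ⊕ # 3) (# 0 ⊕ # 1 ≼ # 2 ∷ []) refl (x+δ ,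
                         tt)) e zv))
      ... | inj₂ off = off

      -- The same dichotomy for a relation between residues that wraps around p. Equality is
      -- excluded because r₀ is too low for the inequality of `descend`.
      arrive : ∀ {x r s t} → base ≤ x → x < α → def x ≡ 0 → High r → High s → High t → x + p + s ≡ r + t →
               Off p (m x + m s) (m r + m t)
      arrive {x} {r} {s} {t} b≤x x<α zx hr hs ht e
        with m-near {x} {s} {r} {t} (<-trans x<α α<p) (High<p hs) (High<p hr) (High<p ht) (inj₂ e)
      ... | inj₂ off = off
      ... | inj₁ eq = ⊥-elim (refute (x ∷ p ∷ r₀ ∷ β ∷ α ∷ D ∷ base ∷ []) (# 0 ⊕ # 1 ≺ # 2 ⊕ ‵ 2 ⊗ # 3 ∷ # 2 ≼ # 4 ⊕ # 3
        ⊕ # 5 ∷ # 6 ≼ # 0 ∷ # 4 ≼ # 6 ⊕ (‵ 1 ⊕ # 5) ∷ ‵ 3 ⊗ (# 3 ⊕ # 5) ≺ # 1 ∷ []) refl (descend (<-trans x<α α<p) (low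
        b≤x x<α zx) high₀ hs hr ht e eq , r₀≤ , b≤x , ≤-reflexive (sym base-+) , p-large , tt))

      -- the hops have length d except possibly the first one, of length d + ι
      path-impossible : ∀ {ι ℓ x v w q t r} → base ≤ x → x < α → def x ≡ 0 →
        β ≤ v → v < α + β → def v ≡ 0 → ¬ High v → x + d ≡ v →
        β ≤ w → w < α + β → def w ≡ 0 → ¬ High w → x + (d + ι) ≡ w →
        High q → High (q + d) → High (q + (d + ι)) →
        High t → (∀ {j} → j ≤ suc ℓ → High (t + (d + ι) + j * d)) →
        High r → x + p ≡ r + (d + ι) + ℓ * d → ⊥
      path-impossible {ι} {ℓ} {x} {v} {w} {q} {t} {r} b≤x x<α zx βv vo zv ¬v xv βw wo zw ¬w xw hq hqd hqd′ ht h hr e =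
        no-path High-m {ℓ = ℓ} (m<p (<-trans x<α α<p)) (m<p (below vo)) (m<p (below wo)) (High-m hr)
          (jump b≤x x<α zx βv vo zv ¬v xv) (jump b≤x x<α zx βw wo zw ¬w xw) hq hqd hqd′ ht h
          (arrive b≤x x<α zx hr ht (h (n≤1+n ℓ)) (equate (x ∷ p ∷ r ∷ d ∷ ι ∷ ℓ ∷ t ∷ []) 1 (# 0 ⊕ # 1 ⊕ # 6) (# 2 ⊕ (#
            6 ⊕ (# 3 ⊕ # 4) ⊕ # 5 ⊗ # 3)) (# 0 ⊕ # 1 ≼ # 2 ⊕ (# 3 ⊕ # 4) ⊕ # 5 ⊗ # 3 ∷ []) refl (e , tt)))

      -- r = low-top + z is where the path closes: base + p - low-top = α + s, and the choice of ℓ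
      -- and s makes this (ℓ + 1)d.
      module Probe {ℓ s z low-top : ℕ} (nd : (2 + ℓ) * d ≡ suc (β + D) + s) (s<d : s < d)
        (low-top-+ : low-top + (suc D + s) ≡ p)
        (z≤D : z ≤ D) (zx : def (base + z) ≡ 0) (zv : def (β + z) ≡ 0) (zr : def (low-top + z) ≡ 0) where

        x<α : base + z < α
        x<α = (entail (base ∷ D ∷ α ∷ z ∷ []) (‵ 1) (‵ 1 ⊕ (# 0 ⊕ # 3)) (# 2) (# 0 ⊕ (‵ 1 ⊕ # 1) ≼ # 2 ∷ # 3 ≼ # 1 ∷ [])
          refl (≤-reflexive base-+ , z≤D , tt))
        v<o : β + z < α + β
        v<o = (entail (z ∷ D ∷ base ∷ α ∷ β ∷ []) (‵ 1) (‵ 1 ⊕ (# 4 ⊕ # 0)) (# 3 ⊕ # 4) (# 0 ≼ # 1 ∷ # 2 ⊕ (‵ 1 ⊕ # 1) ≼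
          # 3 ∷ []) refl (z≤D , ≤-reflexive base-+ , tt))
        xv : base + z + d ≡ β + z
        xv = (equate (base ∷ D ∷ α ∷ d ∷ β ∷ z ∷ []) 1 (# 0 ⊕ # 5 ⊕ # 3) (# 4 ⊕ # 5) (# 0 ⊕ (‵ 1 ⊕ # 1) ≼ # 2 ∷ # 3 ⊕ #
          2 ≼ ‵ 1 ⊕ (# 4 ⊕ # 1) ∷ []) refl (base-+ , α+d , tt))
        hr : High (low-top + z)
        hr = B-zone
          (entail (low-top ∷ D ∷ s ∷ p ∷ d ∷ α ∷ β ∷ z ∷ []) (‵ 3) (# 5 ⊕ # 6) (# 0 ⊕ # 7) ((‵ 2 , # 3 , # 0 ⊕ (‵ 1 ⊕ #
            1 ⊕ # 2)) ∷ (‵ 3 , ‵ 1 ⊕ # 2 , # 4) ∷ (‵ 3 , # 4 ⊕ # 5 , ‵ 1 ⊕ (# 6 ⊕ # 1)) ∷ (‵ 2 , ‵ 1 ⊕ ‵ 3 ⊗ (# 6 ⊕ # 1)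
            , # 3) ∷ []) refl (≤-reflexive (sym low-top-+) , s<d , ≤-reflexive α+d , p-large , tt))
          (entail (low-top ∷ D ∷ s ∷ p ∷ z ∷ []) (‵ 1) (‵ 1 ⊕ (# 0 ⊕ # 4)) (# 3) (# 0 ⊕ (‵ 1 ⊕ # 1 ⊕ # 2) ≼ # 3 ∷ # 4 ≼
            # 1 ∷ []) refl (≤-reflexive low-top-+ , z≤D , tt)) zr
        ¬hv : ¬ High (β + z)
        ¬hv hv = (refute (low-top ∷ z ∷ β ∷ α ∷ D ∷ s ∷ p ∷ d ∷ []) (# 0 ⊕ # 1 ≺ # 2 ⊕ # 1 ⊕ (# 3 ⊕ # 2) ∷ # 6 ≼ # 0 ⊕
          (‵ 1 ⊕ # 4 ⊕ # 5) ∷ # 5 ≺ # 7 ∷ # 7 ⊕ # 3 ≼ ‵ 1 ⊕ (# 2 ⊕ # 4) ∷ ‵ 3 ⊗ (# 2 ⊕ # 4) ≺ # 6 ∷ []) refl (spread hr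
          hv , ≤-reflexive (sym low-top-+) , s<d , ≤-reflexive α+d , p-large , tt))

        x+p : base + z + p ≡ low-top + z + (d + 0) + ℓ * d
        x+p = (equate (base ∷ D ∷ α ∷ low-top ∷ s ∷ p ∷ d ∷ β ∷ ℓ ∷ z ∷ []) 1 (# 0 ⊕ # 9 ⊕ # 5) (# 3 ⊕ # 9 ⊕ (# 6 ⊕ ‵ 0)
          ⊕ # 8 ⊗ # 6) (# 0 ⊕ (‵ 1 ⊕ # 1) ≼ # 2 ∷ # 5 ≼ # 3 ⊕ (‵ 1 ⊕ # 1 ⊕ # 4) ∷ # 6 ⊕ # 2 ≼ ‵ 1 ⊕ (# 7 ⊕ # 1) ∷ ‵ 1 ⊕
          (# 7 ⊕ # 1) ⊕ # 4 ≼ # 6 ⊕ (# 6 ⊕ # 8 ⊗ # 6) ∷ []) refl (base-+ , sym low-top-+ , α+d , sym nd , tt))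

        -- A complete class is a progression of ℓ + 3 `High` residues with step d. It carries the
        -- whole path including the spare hop, with both hop lengths equal to d.
        class-incomplete : ∀ {c} → α + β + (2 + ℓ) * d + c < p → ¬ (∀ {j} → j ≤ 2 + ℓ → def (α + β + j * d + c) ≡ 0)
        class-incomplete {c} fits zeros = path-impossible {0} {ℓ} {q = t} {t = t}
          (m≤m+n base z) x<α zx (m≤m+n β z) v<o zv ¬hv xv (m≤m+n β z) v<o zv ¬hv (trans (cong (base + z +_) (+-identityʳ d)) xv)
          (hit z≤n) hit-d (subst High (cong (t +_) (sym (+-identityʳ d))) hit-d) (hit z≤n) hit′ hr x+p
          where
          t : ℕ
          t = α + β + 0 + c
          hit : ∀ {j} → j ≤ 2 + ℓ → High (α + β + j * d + c)
          hit {j} j≤n = B-zone (entail (α ∷ β ∷ j ∷ d ∷ c ∷ []) (‵ 1) (# 0 ⊕ # 1) (# 0 ⊕ # 1 ⊕ # 2 ⊗ # 3 ⊕ # 4) ([])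
            refl (tt))
            (entail (α ∷ β ∷ d ∷ ℓ ∷ c ∷ p ∷ j ∷ []) (‵ 1) (‵ 1 ⊕ (# 0 ⊕ # 1 ⊕ # 6 ⊗ # 2 ⊕ # 4)) (# 5) (# 0 ⊕ # 1 ⊕ (# 2
              ⊕ (# 2 ⊕ # 3 ⊗ # 2)) ⊕ # 4 ≺ # 5 ∷ (# 2 , # 6 , ‵ 2 ⊕ # 3) ∷ []) refl (fits , j≤n , tt)) (zeros j≤n)
          hit-d : High (t + d)
          hit-d = subst High (identity (α ∷ β ∷ d ∷ c ∷ []) (# 0 ⊕ # 1 ⊕ (# 2 ⊕ ‵ 0) ⊕ # 3) (# 0 ⊕ # 1 ⊕ ‵ 0 ⊕ # 3 ⊕ #
            2) refl) (hit (s≤s z≤n))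
          hit′ : ∀ {j} → j ≤ suc ℓ → High (t + (d + 0) + j * d)
          hit′ {j} j≤ = subst High (identity (α ∷ β ∷ d ∷ j ∷ c ∷ []) (# 0 ⊕ # 1 ⊕ (# 2 ⊕ # 3 ⊗ # 2) ⊕ # 4) (# 0 ⊕ # 1 ⊕
            ‵ 0 ⊕ # 4 ⊕ (# 2 ⊕ ‵ 0) ⊕ # 3 ⊗ # 2) refl) (hit (s≤s j≤))

        roomy : ¬ (α + β + (2 + ℓ) * d + suc D ≤ p)
        roomy fits with find-spaced def (α + β) (_* d) (suc D)
          (λ j → (entail (D ∷ d ∷ j ∷ []) (‵ 1) (# 2 ⊗ # 1 ⊕ (‵ 1 ⊕ # 0)) (# 1 ⊕ # 2 ⊗ # 1) (# 0 ≺ # 1 ∷ []) refl (D<d ,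
            tt))) (2 + ℓ) S≤D fits
        ... | inj₂ too-many = (refute ((sum def (α + β + 0)) ∷ D ∷ []) (# 0 ⊕ (‵ 1 ⊕ # 1) ≼ # 1 ∷ []) refl (too-many ,
          tt))
        ... | inj₁ (c , c<1+D , zeros) = class-incomplete
          (entail (c ∷ D ∷ α ∷ β ∷ d ∷ ℓ ∷ p ∷ []) (‵ 1) (‵ 1 ⊕ (# 2 ⊕ # 3 ⊕ (# 4 ⊕ (# 4 ⊕ # 5 ⊗ # 4)) ⊕ # 0)) (# 6) (#
            0 ≺ ‵ 1 ⊕ # 1 ∷ # 2 ⊕ # 3 ⊕ (# 4 ⊕ (# 4 ⊕ # 5 ⊗ # 4)) ⊕ (‵ 1 ⊕ # 1) ≼ # 6 ∷ []) refl (c<1+D , fits , tt)) zeros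

        module Tight (d+ℓd : d + ℓ * d ≡ β + D) (p≡ : p ≡ 1 + 3 * (β + D)) where

          -- Only D translates are sure to fit now. Each is incomplete by `class-incomplete`, so
          -- together they use up all D defects at or above α + β.
          left-perfect : sum def (α + β) ≡ 0
          left-perfect with find-spaced def (α + β) (_* d) D (λ j → (entail (D ∷ d ∷ j ∷ []) (‵ 1) (# 2 ⊗ # 1 ⊕ # 0) (#
            1 ⊕ # 2 ⊗ # 1) (# 0 ≺ # 1 ∷ []) refl (D<d , tt))) (2 + ℓ) S≤D
            (entail (d ∷ ℓ ∷ β ∷ D ∷ α ∷ p ∷ []) (‵ 1) (# 4 ⊕ # 2 ⊕ (# 0 ⊕ (# 0 ⊕ # 1 ⊗ # 0)) ⊕ # 3) (# 5) (# 0 ⊕ # 1 ⊗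
              # 0 ≼ # 2 ⊕ # 3 ∷ # 0 ⊕ # 4 ≼ ‵ 1 ⊕ (# 2 ⊕ # 3) ∷ ‵ 3 ⊗ (# 2 ⊕ # 3) ≺ # 5 ∷ []) refl (≤-reflexive d+ℓd ,
              ≤-reflexive α+d , ≤-reflexive (sym p≡) , tt))
          ... | inj₁ (c , c<D , zeros) = ⊥-elim (class-incomplete
                  (entail (c ∷ D ∷ d ∷ ℓ ∷ β ∷ α ∷ p ∷ []) (‵ 1) (‵ 1 ⊕ (# 5 ⊕ # 4 ⊕ (# 2 ⊕ (# 2 ⊕ # 3 ⊗ # 2)) ⊕ # 0))
                    (# 6) (# 0 ≺ # 1 ∷ # 2 ⊕ # 3 ⊗ # 2 ≼ # 4 ⊕ # 1 ∷ # 2 ⊕ # 5 ≼ ‵ 1 ⊕ (# 4 ⊕ # 1) ∷ ‵ 3 ⊗ (# 4 ⊕ # 1) ≺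
                    # 6 ∷ []) refl (c<D , ≤-reflexive d+ℓd , ≤-reflexive α+d , ≤-reflexive (sym p≡) , tt)) zeros)
          ... | inj₂ le = (≤-antisym (entail ((sum def (α + β + 0)) ∷ D ∷ (sum def (α + β)) ∷ []) (‵ 1) (# 2) (‵ 0) (# 0
            ⊕ # 1 ≼ # 1 ∷ # 2 ≼ # 0 ∷ []) refl (le , ≤-reflexive (sym (cong (sum def) (+-identityʳ (α + β)))) , tt))
            (entail ((sum def (α + β + 0)) ∷ D ∷ (sum def (α + β)) ∷ []) (‵ 1) (‵ 0) (# 2) ([]) refl (tt)))

          -- d = 1 forces D = 0, hence α = β and p = 1 + 3α, and no residue misses the bound. The
          -- residues from 2α to p - 1 are then all `High` and form the unit path, and `rigid`
          -- excludes the difference 3.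
          unit-step : d ≢ 1
          unit-step d≡1 = no-unit-path High-m {k = β + D} {t = α + β} (m<p (<-trans x<α α<p)) (m<p (below v<o)) (High-m hr) p≡ 0<k
            (subst (Jump p High m (m (base + z)) (m (β + z))) d≡1 (jump (m≤m+n base z) x<α zx (m≤m+n β z) v<o zv ¬hv xv)) hits
            (proj₁ three) (proj₂ three)
            (arrive (m≤m+n base z) x<α zx hr (subst High (+-identityʳ (α + β)) (hits z≤n)) (hits ≤-refl) sum-eq)
            where
            D≡0 : D ≡ 0
            D≡0 = (≤-antisym (entail (d ∷ D ∷ []) (‵ 1) (# 1) (‵ 0) (# 0 ≼ ‵ 1 ∷ # 1 ≺ # 0 ∷ []) refl (≤-reflexive d≡1 ,
              D<d , tt)) (entail (d ∷ D ∷ []) (‵ 1) (‵ 0) (# 1) ([]) refl (tt)))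
            α≡k : α ≡ β + D
            α≡k = (equate (d ∷ α ∷ β ∷ D ∷ []) 1 (# 1) (# 2 ⊕ # 3) (‵ 1 ≼ # 0 ∷ # 0 ⊕ # 1 ≼ ‵ 1 ⊕ (# 2 ⊕ # 3) ∷ []) refl
              (sym d≡1 , α+d , tt))
            0<k : 0 < β + D
            0<k = (entail (α ∷ β ∷ D ∷ []) (‵ 1) (‵ 1 ⊕ ‵ 0) (# 1 ⊕ # 2) (# 0 ≼ # 1 ⊕ # 2 ∷ ‵ 0 ≺ # 0 ∷ []) refl
              (≤-reflexive α≡k , 0<α , tt))
            hits : ∀ {j} → j ≤ β + D → High (α + β + j)
            hits {j} j≤k = B-zone (m≤m+n (α + β) j) o+j<p (sum≡0⇒ def p (≤-antisym (entail ((sum def p) ∷ D ∷ []) (‵ 1)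
              (# 0) (‵ 0) (# 0 ≼ # 1 ∷ # 1 ≼ ‵ 0 ∷ []) refl (S≤D , ≤-reflexive D≡0 , tt)) (entail ((sum def p) ∷ D ∷ [])
              (‵ 1) (‵ 0) (# 0) ([]) refl (tt))) o+j<p)
              where o+j<p : α + β + j < p
                    o+j<p = (entail (j ∷ β ∷ D ∷ α ∷ p ∷ []) (‵ 1) (‵ 1 ⊕ (# 3 ⊕ # 1 ⊕ # 0)) (# 4) (# 0 ≼ # 1 ⊕ # 2 ∷ #
                      3 ≼ # 1 ⊕ # 2 ∷ ‵ 3 ⊗ (# 1 ⊕ # 2) ≺ # 4 ∷ []) refl (j≤k , ≤-reflexive α≡k , ≤-reflexive (sym p≡) ,
                      tt))
            three : (m (α + β) ≢ 3 + m (α + β + 1)) × (m (α + β + 1) ≢ 3 + m (α + β))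
            three = rigid {α + β} (trans α≡k (trans (cong (β +_) D≡0) (+-identityʳ β)))
              (trans p≡ (cong (λ κ → 1 + 3 * κ) (sym α≡k)))
              (entail (α ∷ β ∷ D ∷ p ∷ []) (‵ 1) (‵ 1 ⊕ (‵ 1 ⊕ (# 0 ⊕ # 1))) (# 3) (# 0 ≼ # 1 ⊕ # 2 ∷ ‵ 3 ⊗ (# 1 ⊕ # 2)
                ≺ # 3 ∷ ‵ 0 ≺ # 1 ⊕ # 2 ∷ []) refl (≤-reflexive α≡k , ≤-reflexive (sym p≡) , 0<k , tt))
            sum-eq : base + z + p + (α + β) ≡ low-top + z + (α + β + (β + D))
            sum-eq = (equate (base ∷ z ∷ p ∷ low-top ∷ d ∷ ℓ ∷ β ∷ D ∷ α ∷ []) 1 (# 0 ⊕ # 1 ⊕ # 2 ⊕ (# 8 ⊕ # 6)) (# 3 ⊕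
              # 1 ⊕ (# 8 ⊕ # 6 ⊕ (# 6 ⊕ # 7))) (# 0 ⊕ # 1 ⊕ # 2 ≼ # 3 ⊕ # 1 ⊕ (# 4 ⊕ ‵ 0) ⊕ # 5 ⊗ # 4 ∷ # 4 ⊕ # 5 ⊗ # 4
              ≼ # 6 ⊕ # 7 ∷ []) refl (x+p , d+ℓd , tt))

      -- With a first hop of length d + 1 the last offset drops from β + D + d to β + D + 1, and for
      -- d ≥ 2 all D + 1 translates fit again. The path now closes at top + i, since base + p - top
      -- = α = (d + 1) + ℓd.
      module Mixed {ℓ top : ℕ} (top-+ : top + suc D ≡ p) (p≡ : p ≡ 1 + 3 * (β + D))
        (dℓ : d + (d + ℓ * d) ≡ β + D) (d≥2 : 2 ≤ d) (left-perfect : sum def (α + β) ≡ 0) where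

        offset : ℕ → ℕ
        offset zero    = 0
        offset (suc j) = 1 + suc j * d

        gap : ∀ j → offset j + suc D ≤ offset (suc j)
        gap zero    = (entail (D ∷ d ∷ []) (‵ 1) (‵ 1 ⊕ # 0) (‵ 1 ⊕ (# 1 ⊕ ‵ 0)) (# 0 ≺ # 1 ∷ []) refl (D<d , tt))
        gap (suc j) = (entail (D ∷ d ∷ j ∷ []) (‵ 1) (‵ 1 ⊕ (# 1 ⊕ # 2 ⊗ # 1) ⊕ (‵ 1 ⊕ # 0)) (‵ 1 ⊕ (# 1 ⊕ (# 1 ⊕ # 2 ⊗
          # 1))) (# 0 ≺ # 1 ∷ []) refl (D<d , tt))

        path : ∃ λ c → c < suc D × ∀ {j} → j ≤ 2 + ℓ → def (α + β + offset j + c) ≡ 0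
        path with find-spaced def (α + β) offset (suc D) gap (2 + ℓ) S≤D
          (entail (d ∷ ℓ ∷ β ∷ D ∷ α ∷ p ∷ []) (‵ 1) (# 4 ⊕ # 2 ⊕ (‵ 1 ⊕ (# 0 ⊕ (# 0 ⊕ # 1 ⊗ # 0))) ⊕ (‵ 1 ⊕ # 3)) (# 5)
            (# 0 ⊕ (# 0 ⊕ # 1 ⊗ # 0) ≼ # 2 ⊕ # 3 ∷ ‵ 2 ≼ # 0 ∷ # 0 ⊕ # 4 ≼ ‵ 1 ⊕ (# 2 ⊕ # 3) ∷ ‵ 3 ⊗ (# 2 ⊕ # 3) ≺ # 5 ∷
            []) refl (≤-reflexive dℓ , d≥2 , ≤-reflexive α+d , ≤-reflexive (sym p≡) , tt))
        ... | inj₁ found    = found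
        ... | inj₂ too-many = ⊥-elim (refute ((sum def (α + β + 0)) ∷ D ∷ []) (# 0 ⊕ (‵ 1 ⊕ # 1) ≼ # 1 ∷ []) refl
          (too-many , tt))

        -- A common start for both hop lengths, from which their directions can be compared. The
        -- three translates may overlap, so a defect can count three times; hence 3D + 1 candidates.
        fork : ∃ λ q → High q × High (q + d) × High (q + (d + 1))
        fork = case find-zero (λ i → def (a + i) + def (a + d + i) + def (a + (d + 1) + i)) n total ≤-refl
               of λ { (i , i<n , e) → found i i<n e }
          where
          a n : ℕ
          a = α + β
          n = suc (3 * D)
          fits : a + (d + 1) + n ≤ p
          fits = (entail (d ∷ ℓ ∷ β ∷ D ∷ α ∷ p ∷ []) (‵ 1) (# 4 ⊕ # 2 ⊕ (# 0 ⊕ ‵ 1) ⊕ (‵ 1 ⊕ ‵ 3 ⊗ # 3)) (# 5) (# 0 ⊕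
            (# 0 ⊕ # 1 ⊗ # 0) ≼ # 2 ⊕ # 3 ∷ (‵ 2 , ‵ 1 ⊕ # 3 , # 0) ∷ # 0 ⊕ # 4 ≼ ‵ 1 ⊕ (# 2 ⊕ # 3) ∷ ‵ 3 ⊗ (# 2 ⊕ # 3)
            ≺ # 5 ∷ []) refl (≤-reflexive dℓ , D<d , ≤-reflexive α+d , ≤-reflexive (sym p≡) , tt))
          one : ∀ b → b + n ≤ p → interval def b n ≤ D
          one b le = ≤-trans (m≤n+m _ (sum def b)) (≤-trans (interval-after def b n le) S≤D)
          total : sum (λ i → def (a + i) + def (a + d + i) + def (a + (d + 1) + i)) n ≤ 3 * D
          total = subst (_≤ 3 * D)
            (sym (trans (sum-+ (λ i → def (a + i) + def (a + d + i)) (λ i → def (a + (d + 1) + i)) n)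
                        (cong (_+ interval def (a + (d + 1)) n) (sum-+ (λ i → def (a + i)) (λ i → def (a + d + i)) n))))
            (entail ((interval def a n) ∷ D ∷ (interval def (a + d) n) ∷ (interval def (a + (d + 1)) n) ∷ []) (‵ 1) (# 0
              ⊕ # 2 ⊕ # 3) (‵ 3 ⊗ # 1) (# 0 ≼ # 1 ∷ # 2 ≼ # 1 ∷ # 3 ≼ # 1 ∷ []) refl (one a (entail (α ∷ β ∷ d ∷ n ∷ p ∷
              []) (‵ 1) (# 0 ⊕ # 1 ⊕ # 3) (# 4) (# 0 ⊕ # 1 ⊕ (# 2 ⊕ ‵ 1) ⊕ # 3 ≼ # 4 ∷ []) refl (fits , tt)) , one (a +
              d) (entail (α ∷ β ∷ d ∷ n ∷ p ∷ []) (‵ 1) (# 0 ⊕ # 1 ⊕ # 2 ⊕ # 3) (# 4) (# 0 ⊕ # 1 ⊕ (# 2 ⊕ ‵ 1) ⊕ # 3 ≼ #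
              4 ∷ []) refl (fits , tt)) , one (a + (d + 1)) fits , tt))
          found : ∀ i → i < n → def (a + i) + def (a + d + i) + def (a + (d + 1) + i) ≡ 0 →
                  ∃ λ q → High q × High (q + d) × High (q + (d + 1))
          found i i<n e = a + i
            , B-zone (m≤m+n a i) (entail (α ∷ β ∷ i ∷ p ∷ []) (‵ 1) (‵ 1 ⊕ (# 0 ⊕ # 1 ⊕ # 2)) (# 3) (# 0 ⊕ # 1 ⊕ # 2 ⊕ ‵
              0 ≺ # 3 ∷ []) refl (in-range 0 z≤n , tt)) (m+n≡0⇒m≡0 _ (m+n≡0⇒m≡0 _ e))
            , subst High (identity (α ∷ β ∷ d ∷ i ∷ []) (# 0 ⊕ # 1 ⊕ # 2 ⊕ # 3) (# 0 ⊕ # 1 ⊕ # 3 ⊕ # 2) refl)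
                (B-zone (entail (α ∷ β ∷ d ∷ i ∷ []) (‵ 1) (# 0 ⊕ # 1) (# 0 ⊕ # 1 ⊕ # 2 ⊕ # 3) ([]) refl (tt)) (entail
                  (α ∷ β ∷ i ∷ d ∷ p ∷ []) (‵ 1) (‵ 1 ⊕ (# 0 ⊕ # 1 ⊕ # 3 ⊕ # 2)) (# 4) (# 0 ⊕ # 1 ⊕ # 2 ⊕ # 3 ≺ # 4 ∷
                  []) refl (in-range d (m≤m+n d 1) , tt))
                  (m+n≡0⇒n≡0 (def (a + i)) (m+n≡0⇒m≡0 _ e)))
            , subst High (identity (α ∷ β ∷ d ∷ i ∷ []) (# 0 ⊕ # 1 ⊕ (# 2 ⊕ ‵ 1) ⊕ # 3) (# 0 ⊕ # 1 ⊕ # 3 ⊕ (# 2 ⊕ ‵ 1))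
              refl)
                (B-zone (entail (α ∷ β ∷ d ∷ i ∷ []) (‵ 1) (# 0 ⊕ # 1) (# 0 ⊕ # 1 ⊕ (# 2 ⊕ ‵ 1) ⊕ # 3) ([]) refl (tt)) (entail
                  (α ∷ β ∷ i ∷ d ∷ p ∷ []) (‵ 1) (‵ 1 ⊕ (# 0 ⊕ # 1 ⊕ (# 3 ⊕ ‵ 1) ⊕ # 2)) (# 4) (# 0 ⊕ # 1 ⊕ # 2 ⊕ (# 3 ⊕
                  ‵ 1) ≺ # 4 ∷ []) refl (in-range (d + 1) ≤-refl , tt))
                  (m+n≡0⇒n≡0 (def (a + i) + def (a + d + i)) e))
            where
            in-range : ∀ δ → δ ≤ d + 1 → α + β + i + δ < p
            in-range δ δ≤ = (entail (δ ∷ d ∷ i ∷ D ∷ ℓ ∷ β ∷ α ∷ p ∷ []) (‵ 1) (‵ 1 ⊕ (# 6 ⊕ # 5 ⊕ # 2 ⊕ # 0)) (# 7) (#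
              0 ≼ # 1 ⊕ ‵ 1 ∷ # 2 ≺ ‵ 1 ⊕ ‵ 3 ⊗ # 3 ∷ # 1 ⊕ (# 1 ⊕ # 4 ⊗ # 1) ≼ # 5 ⊕ # 3 ∷ (‵ 2 , ‵ 1 ⊕ # 3 , # 1) ∷ #
              1 ⊕ # 6 ≼ ‵ 1 ⊕ (# 5 ⊕ # 3) ∷ ‵ 3 ⊗ (# 5 ⊕ # 3) ≺ # 7 ∷ []) refl (δ≤ , i<n , ≤-reflexive dℓ , D<d ,
              ≤-reflexive α+d , ≤-reflexive (sym p≡) , tt))

        α≡ : α ≡ d + 1 + ℓ * d
        α≡ = (equate (d ∷ ℓ ∷ β ∷ D ∷ α ∷ []) 1 (# 4) (# 0 ⊕ ‵ 1 ⊕ # 1 ⊗ # 0) (# 2 ⊕ # 3 ≼ # 0 ⊕ (# 0 ⊕ # 1 ⊗ # 0) ∷ # 0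
          ⊕ # 4 ≼ ‵ 1 ⊕ (# 2 ⊕ # 3) ∷ []) refl (sym dℓ , α+d , tt))

        impossible : ⊥
        impossible = case highest top-+ of λ { (i , i<1+D , _ , hr) → case path of λ { (c , c<1+D , zeros) →
          case fork of λ { (q , hq , hqd , hqd′) → along i i<1+D hr c c<1+D zeros q hq hqd hqd′ } } }
          where
          along : ∀ i → i < suc D → High (top + i) → ∀ c → c < suc D → (∀ {j} → j ≤ 2 + ℓ → def (α + β + offset j + c) ≡ 0) →
                  ∀ q → High q → High (q + d) → High (q + (d + 1)) → ⊥
          -- Nothing below α + β misses the bound, so x = base + i, v = β + i and w = v + 1 are all
          -- available, and i is dictated by the closing residue alone.
          along i i<1+D hr c c<1+D zeros q hq hqd hqd′ = path-impossible {1} {ℓ} {q = q} {t = α + β + 0 + c}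
            (m≤m+n base i) x<α (perfect x<o) (m≤m+n β i) v<o (perfect v<o)
            (λ hv → (refute (top ∷ i ∷ β ∷ α ∷ D ∷ p ∷ []) (# 0 ⊕ # 1 ≺ # 2 ⊕ # 1 ⊕ (# 3 ⊕ # 2) ∷ # 5 ≼ # 0 ⊕ (‵ 1 ⊕ #
              4) ∷ ‵ 3 ⊗ (# 2 ⊕ # 4) ≺ # 5 ∷ # 3 ≼ # 2 ∷ []) refl (spread hr hv , ≤-reflexive (sym top-+) , ≤-reflexive
              (sym p≡) , α≤β , tt)))
            (equate (base ∷ D ∷ α ∷ d ∷ β ∷ i ∷ []) 1 (# 0 ⊕ # 5 ⊕ # 3) (# 4 ⊕ # 5) (# 0 ⊕ (‵ 1 ⊕ # 1) ≼ # 2 ∷ # 3 ⊕ # 2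
              ≼ ‵ 1 ⊕ (# 4 ⊕ # 1) ∷ []) refl (base-+ , α+d , tt))
            (≤-trans (m≤m+n β i) (m≤m+n (β + i) 1)) w<o (perfect w<o)
            (λ hw → (refute (top ∷ i ∷ β ∷ α ∷ D ∷ p ∷ d ∷ []) (# 0 ⊕ # 1 ≺ # 2 ⊕ # 1 ⊕ ‵ 1 ⊕ (# 3 ⊕ # 2) ∷ # 5 ≼ # 0 ⊕
              (‵ 1 ⊕ # 4) ∷ ‵ 3 ⊗ (# 2 ⊕ # 4) ≺ # 5 ∷ ‵ 2 ≼ # 6 ∷ # 6 ⊕ # 3 ≼ ‵ 1 ⊕ (# 2 ⊕ # 4) ∷ []) refl (spread hr hw
              , ≤-reflexive (sym top-+) , ≤-reflexive (sym p≡) , d≥2 , ≤-reflexive α+d , tt)))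
            (equate (base ∷ D ∷ α ∷ d ∷ β ∷ i ∷ []) 1 (# 0 ⊕ # 5 ⊕ (# 3 ⊕ ‵ 1)) (# 4 ⊕ # 5 ⊕ ‵ 1) (# 0 ⊕ (‵ 1 ⊕ # 1) ≼ #
              2 ∷ # 3 ⊕ # 2 ≼ ‵ 1 ⊕ (# 4 ⊕ # 1) ∷ []) refl (base-+ , α+d , tt))
            hq hqd hqd′ (hit z≤n) hit′ hr
            (equate (base ∷ D ∷ α ∷ d ∷ ℓ ∷ top ∷ p ∷ i ∷ []) 1 (# 0 ⊕ # 7 ⊕ # 6) (# 5 ⊕ # 7 ⊕ (# 3 ⊕ ‵ 1) ⊕ # 4 ⊗ # 3)
              (# 0 ⊕ (‵ 1 ⊕ # 1) ≼ # 2 ∷ # 2 ≼ # 3 ⊕ ‵ 1 ⊕ # 4 ⊗ # 3 ∷ # 6 ≼ # 5 ⊕ (‵ 1 ⊕ # 1) ∷ []) refl (base-+ , α≡ ,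
              sym top-+ , tt))
            where
            perfect : ∀ {a} → a < α + β → def a ≡ 0
            perfect = sum≡0⇒ def (α + β) left-perfect
            x<α : base + i < α
            x<α = (entail (base ∷ D ∷ α ∷ i ∷ []) (‵ 1) (‵ 1 ⊕ (# 0 ⊕ # 3)) (# 2) (# 0 ⊕ (‵ 1 ⊕ # 1) ≼ # 2 ∷ # 3 ≺ ‵ 1 ⊕
              # 1 ∷ []) refl (≤-reflexive base-+ , i<1+D , tt))
            x<o : base + i < α + β
            x<o = (entail (base ∷ i ∷ α ∷ β ∷ []) (‵ 1) (‵ 1 ⊕ (# 0 ⊕ # 1)) (# 2 ⊕ # 3) (# 0 ⊕ # 1 ≺ # 2 ∷ []) refl (x<α
              , tt))
            w<o : β + i + 1 < α + β
            w<o = (entail (i ∷ D ∷ α ∷ d ∷ ℓ ∷ β ∷ []) (‵ 1) (‵ 1 ⊕ (# 5 ⊕ # 0 ⊕ ‵ 1)) (# 2 ⊕ # 5) (# 0 ≺ ‵ 1 ⊕ # 1 ∷ #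
              3 ⊕ ‵ 1 ⊕ # 4 ⊗ # 3 ≼ # 2 ∷ # 1 ≺ # 3 ∷ []) refl (i<1+D , ≤-reflexive (sym α≡) , D<d , tt))
            v<o : β + i < α + β
            v<o = (entail (β ∷ i ∷ α ∷ []) (‵ 1) (‵ 1 ⊕ (# 0 ⊕ # 1)) (# 2 ⊕ # 0) (# 0 ⊕ # 1 ⊕ ‵ 1 ≺ # 2 ⊕ # 0 ∷ []) refl
              (w<o , tt))
            offset≤ : ∀ {j} → j ≤ 2 + ℓ → offset j ≤ offset (2 + ℓ)
            offset≤ {zero}  _  = z≤n
            offset≤ {suc j} j≤ = s≤s (*-monoˡ-≤ d j≤)
            hit : ∀ {j} → j ≤ 2 + ℓ → High (α + β + offset j + c)
            hit {j} j≤n = B-zone (≤-trans (m≤m+n (α + β) (offset j)) (m≤m+n _ c))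
              (entail ((offset j) ∷ d ∷ ℓ ∷ c ∷ D ∷ β ∷ α ∷ p ∷ []) (‵ 1) (‵ 1 ⊕ (# 6 ⊕ # 5 ⊕ # 0 ⊕ # 3)) (# 7) (# 0 ≼ ‵
                1 ⊕ (# 1 ⊕ (# 1 ⊕ # 2 ⊗ # 1)) ∷ # 3 ≺ ‵ 1 ⊕ # 4 ∷ # 1 ⊕ (# 1 ⊕ # 2 ⊗ # 1) ≼ # 5 ⊕ # 4 ∷ ‵ 2 ≼ # 1 ∷ # 1
                ⊕ # 6 ≼ ‵ 1 ⊕ (# 5 ⊕ # 4) ∷ ‵ 3 ⊗ (# 5 ⊕ # 4) ≺ # 7 ∷ []) refl (offset≤ j≤n , c<1+D , ≤-reflexive dℓ ,
                d≥2 , ≤-reflexive α+d , ≤-reflexive (sym p≡) , tt)) (zeros j≤n)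
            hit′ : ∀ {j} → j ≤ suc ℓ → High (α + β + 0 + c + (d + 1) + j * d)
            hit′ {j} j≤ = subst High (identity (α ∷ β ∷ d ∷ j ∷ c ∷ []) (# 0 ⊕ # 1 ⊕ (‵ 1 ⊕ (# 2 ⊕ # 3 ⊗ # 2)) ⊕ # 4) (#
              0 ⊕ # 1 ⊕ ‵ 0 ⊕ # 4 ⊕ (# 2 ⊕ ‵ 1) ⊕ # 3 ⊗ # 2) refl) (hit (s≤s j≤))

      tight-impossible : ∀ {ℓ} → d + ℓ * d ≡ β + D → p ≡ 1 + 3 * (β + D) → sum def (α + β) ≡ 0 → d ≢ 1 → ⊥
      -- Here d = β + D, so α = 1, and β + D < 2α leaves only d = 1.
      tight-impossible {zero} dℓ p≡ lp d≢1 = d≢1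
        (≤-antisym (entail (d ∷ β ∷ D ∷ α ∷ []) (‵ 1) (# 0) (‵ 1) (# 1 ⊕ # 2 ≼ # 0 ⊕ ‵ 0 ∷ (‵ 2 , # 0 ⊕ # 3 , ‵ 1 ⊕ (# 1
          ⊕ # 2)) ∷ # 1 ⊕ # 2 ≺ # 3 ⊕ # 3 ∷ []) refl (≤-reflexive (sym dℓ) , ≤-reflexive α+d , β+D<2α , tt)) (entail (d
          ∷ β ∷ D ∷ α ∷ []) (‵ 1) (‵ 1) (# 0) (# 2 ≺ # 0 ∷ []) refl (D<d , tt)))
      tight-impossible {suc ℓ} dℓ p≡ lp d≢1 = Mixed.impossible {ℓ} (m∸n+n≡m (entail (β ∷ D ∷ p ∷ []) (‵ 1) (‵ 1 ⊕ # 1)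
        (# 2) (‵ 3 ⊗ (# 0 ⊕ # 1) ≺ # 2 ∷ []) refl (p-large , tt)))
        p≡ dℓ (≤∧≢⇒< (≤-trans (s≤s z≤n) D<d) (λ e → d≢1 (sym e))) lp

      no-excess-with : ∀ {ℓ s} → (2 + ℓ) * d ≡ suc (β + D) + s → s < d → ⊥
      no-excess-with {ℓ} {s} nd s<d = case find-zero³ def {base} {β} {p ∸ (suc D + s)} {suc D} S≤D ≤-refl
        (entail (base ∷ D ∷ α ∷ β ∷ []) (‵ 1) (# 0 ⊕ (‵ 1 ⊕ # 1)) (# 3) (# 0 ⊕ (‵ 1 ⊕ # 1) ≼ # 2 ∷ # 2 ≼ # 3 ∷ []) refl
          (≤-reflexive base-+ , α≤β , tt))
        (entail ((p ∸ (suc D + s)) ∷ D ∷ s ∷ p ∷ d ∷ α ∷ β ∷ []) (‵ 1) (# 6 ⊕ (‵ 1 ⊕ # 1)) (# 0) (# 3 ≼ # 0 ⊕ (‵ 1 ⊕ # 1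
          ⊕ # 2) ∷ # 2 ≺ # 4 ∷ # 4 ⊕ # 5 ≼ ‵ 1 ⊕ (# 6 ⊕ # 1) ∷ ‵ 3 ⊗ (# 6 ⊕ # 1) ≺ # 3 ∷ ‵ 0 ≺ # 5 ∷ []) refl
          (≤-reflexive (sym low-top-+) , s<d , ≤-reflexive α+d , p-large , 0<α , tt))
        (entail ((p ∸ (suc D + s)) ∷ D ∷ s ∷ p ∷ []) (‵ 1) (# 0 ⊕ (‵ 1 ⊕ # 1)) (# 3) (# 0 ⊕ (‵ 1 ⊕ # 1 ⊕ # 2) ≼ # 3 ∷
          []) refl (≤-reflexive low-top-+ , tt))
        of λ { (z , z<1+D , zx , zv , zr) → conclude (s≤s⁻¹ z<1+D) zx zv zr }
        where
        low-top-+ : p ∸ (suc D + s) + (suc D + s) ≡ p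
        low-top-+ = m∸n+n≡m (entail (s ∷ d ∷ α ∷ β ∷ D ∷ p ∷ []) (‵ 1) (‵ 1 ⊕ # 4 ⊕ # 0) (# 5) (# 0 ≺ # 1 ∷ # 1 ⊕ # 2 ≼
          ‵ 1 ⊕ (# 3 ⊕ # 4) ∷ ‵ 3 ⊗ (# 3 ⊕ # 4) ≺ # 5 ∷ ‵ 0 ≺ # 2 ∷ []) refl (s<d , ≤-reflexive α+d , p-large , 0<α ,
          tt))
        conclude : ∀ {z} → z ≤ D → def (base + z) ≡ 0 → def (β + z) ≡ 0 → def (p ∸ (suc D + s) + z) ≡ 0 → ⊥
        conclude z≤D zx zv zr with α + β + (2 + ℓ) * d + suc D ≤? p
        ... | yes fits = Probe.roomy {ℓ} nd s<d low-top-+ z≤D zx zv zr fits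
        -- The translates end at α + β + (2 + ℓ)d + D + 1 = 3(β + D) + 3 + s - d. As s < d and p >
        -- 3(β + D), this exceeds p only if s = d - 1 and p = 1 + 3(β + D).
        ... | no tight = tight-impossible {ℓ} d+ℓd p≡ (T.left-perfect) (T.unit-step)
          where
          1+s≡d : suc s ≡ d
          1+s≡d = ≤-antisym s<d (entail (p ∷ α ∷ β ∷ d ∷ ℓ ∷ D ∷ s ∷ []) (‵ 1) (# 3) (‵ 1 ⊕ # 6) (# 0 ≺ # 1 ⊕ # 2 ⊕ (# 3
            ⊕ (# 3 ⊕ # 4 ⊗ # 3)) ⊕ (‵ 1 ⊕ # 5) ∷ # 3 ⊕ (# 3 ⊕ # 4 ⊗ # 3) ≼ ‵ 1 ⊕ (# 2 ⊕ # 5) ⊕ # 6 ∷ ‵ 3 ⊗ (# 2 ⊕ # 5) ≺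
            # 0 ∷ # 3 ⊕ # 1 ≼ ‵ 1 ⊕ (# 2 ⊕ # 5) ∷ []) refl (≰⇒> tight , ≤-reflexive nd , p-large , ≤-reflexive α+d ,
            tt))
          p≡ : p ≡ 1 + 3 * (β + D)
          p≡ = ≤-antisym (entail (p ∷ α ∷ β ∷ d ∷ ℓ ∷ D ∷ s ∷ []) (‵ 1) (# 0) (‵ 1 ⊕ ‵ 3 ⊗ (# 2 ⊕ # 5)) (# 0 ≺ # 1 ⊕ # 2
            ⊕ (# 3 ⊕ (# 3 ⊕ # 4 ⊗ # 3)) ⊕ (‵ 1 ⊕ # 5) ∷ # 3 ⊕ (# 3 ⊕ # 4 ⊗ # 3) ≼ ‵ 1 ⊕ (# 2 ⊕ # 5) ⊕ # 6 ∷ # 6 ≺ # 3 ∷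
            # 3 ⊕ # 1 ≼ ‵ 1 ⊕ (# 2 ⊕ # 5) ∷ []) refl (≰⇒> tight , ≤-reflexive nd , s<d , ≤-reflexive α+d , tt)) p-large
          d+ℓd : d + ℓ * d ≡ β + D
          d+ℓd = (equate (d ∷ ℓ ∷ β ∷ D ∷ s ∷ []) 1 (# 0 ⊕ # 1 ⊗ # 0) (# 2 ⊕ # 3) (# 0 ⊕ (# 0 ⊕ # 1 ⊗ # 0) ≼ ‵ 1 ⊕ (# 2
            ⊕ # 3) ⊕ # 4 ∷ # 4 ≺ # 0 ∷ []) refl (nd , 1+s≡d , tt))
          module T = Probe.Tight {ℓ} nd s<d low-top-+ z≤D zx zv zr d+ℓd p≡

  no-excess : ⊥
  no-excess = case lowest of λ { (r₀ , r₀≤ , high₀) → case hops {β + D} {suc (β + D) ∸ α} 0<d d≤k of λ { (ℓ , s , nd , s<d) →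
    Frame.no-excess-with α+d base-+ r₀≤ high₀ {ℓ} {s} nd s<d } }
    where
    α+d : suc (β + D) ∸ α + α ≡ suc (β + D)
    α+d = m∸n+n≡m (entail (α ∷ β ∷ D ∷ []) (‵ 1) (# 0) (‵ 1 ⊕ (# 1 ⊕ # 2)) (# 0 ≼ # 1 ∷ []) refl (α≤β , tt))
    0<d : 0 < suc (β + D) ∸ α
    0<d = (entail ((suc (β + D) ∸ α) ∷ α ∷ β ∷ D ∷ []) (‵ 1) (‵ 1 ⊕ ‵ 0) (# 0) (# 2 ⊕ # 3 ≺ # 0 ⊕ # 1 ∷ # 1 ≼ # 2 ∷ [])
      refl (≤-reflexive (sym α+d) , α≤β , tt))
    d≤k : suc (β + D) ∸ α ≤ β + D
    d≤k = (entail ((suc (β + D) ∸ α) ∷ α ∷ β ∷ D ∷ []) (‵ 1) (# 0) (# 2 ⊕ # 3) (# 0 ⊕ # 1 ≼ ‵ 1 ⊕ (# 2 ⊕ # 3) ∷ ‵ 0 ≺ #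
      1 ∷ []) refl (≤-reflexive α+d , 0<α , tt))
    base-+ : α ∸ suc D + suc D ≡ α
    base-+ = m∸n+n≡m (entail (β ∷ D ∷ α ∷ []) (‵ 1) (‵ 1 ⊕ # 1) (# 2) (# 0 ⊕ # 1 ≺ # 2 ⊕ # 2 ∷ # 2 ≼ # 0 ∷ []) refl
      (β+D<2α , α≤β , tt))

-- Residues and coordinates

multiple<2n : ∀ {n e} → n ∣ e → e < n + n → e ≡ 0 ⊎ e ≡ n
multiple<2n (divides 0 eq) _ = inj₁ eq
multiple<2n {n} (divides 1 eq) _ = inj₂ (trans eq (+-identityʳ n))
multiple<2n {n} {e} (divides (suc (suc k)) eq) lt =
  ⊥-elim (refute (e ∷ n ∷ k ∷ []) (# 1 ⊕ (# 1 ⊕ # 2 ⊗ # 1) ≼ # 0 ∷ # 0 ≺ # 1 ⊕ # 1 ∷ []) refl (≤-reflexive (sym eq) , lt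
    , tt))

module _ {n w : ℕ} (n⊥w : Coprime n w) where

  private
    cancel-≤ : ∀ {x y s t} → x ≤ y → y < n + n → x * w + n * s ≡ y * w + n * t → y ≡ x ⊎ y ≡ x + n
    cancel-≤ {x} {y} {s} {t} x≤y y<2n eq with y ∸ x | m+[n∸m]≡n x≤y
    ... | e | refl with multiple<2n {n} {e} n∣e (≤-<-trans (m≤n+m e x) y<2n)
      where
      ns : n * s ≡ n * t + w * e
      ns = (equate (x ∷ w ∷ n ∷ s ∷ e ∷ t ∷ []) 1 (# 2 ⊗ # 3) (# 2 ⊗ # 5 ⊕ # 1 ⊗ # 4) (# 0 ⊗ # 1 ⊕ # 2 ⊗ # 3 ≼ (# 0 ⊕ #
        4) ⊗ # 1 ⊕ # 2 ⊗ # 5 ∷ []) refl (eq , tt))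
      n∣e : n ∣ e
      n∣e = coprime-divisor n⊥w (∣m+n∣m⇒∣n (subst (n ∣_) ns (m∣m*n s)) (m∣m*n t))
    ...   | inj₁ refl = inj₁ (+-identityʳ x)
    ...   | inj₂ refl = inj₂ refl

  -- The range is 2n so that sums of two reduced coordinates are covered; the congruence leaves
  -- equality or one wrap.
  cancel-near : ∀ {x y} s t → x < n + n → y < n + n → x * w + n * s ≡ y * w + n * t → Near n x y
  cancel-near {x} {y} s t x< y< eq with ≤-total x y
  ... | inj₁ x≤y with cancel-≤ {s = s} {t} x≤y y< eq
  ...   | inj₁ e = inj₁ (sym e)
  ...   | inj₂ e = inj₂ (inj₁ (sym e))
  cancel-near {x} {y} s t x< y< eq | inj₂ y≤x with cancel-≤ {s = t} {s} y≤x x< (sym eq)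
  ...   | inj₁ e = inj₁ e
  ...   | inj₂ e = inj₂ (inj₂ e)

  cancel-≡ : ∀ {x y} s t → x < n → y < n → x * w + n * s ≡ y * w + n * t → x ≡ y
  cancel-≡ {x} {y} s t x<n y<n eq
    with cancel-near s t (<-≤-trans x<n (m≤m+n n n)) (<-≤-trans y<n (m≤m+n n n)) eq
  ... | inj₁ e        = e
  ... | inj₂ (inj₁ e) = ⊥-elim (refute (x ∷ n ∷ y ∷ []) (# 0 ⊕ # 1 ≼ # 2 ∷ # 2 ≺ # 1 ∷ []) refl (≤-reflexive e , y<n ,
    tt))
  ... | inj₂ (inj₂ e) = ⊥-elim (refute (x ∷ y ∷ n ∷ []) (# 1 ⊕ # 2 ≼ # 0 ∷ # 0 ≺ # 2 ∷ []) refl (≤-reflexive (sym e) ,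
    x<n , tt))

inverse : ∀ {p q} → 1 < p → Coprime q p → ∃₂ λ x k → x * q ≡ 1 + k * p
inverse {p} {q} 1<p q⊥p with coprime-Bézout q⊥p
... | Bézout.+- x y e = x , y , sym e
inverse {suc zero} (s≤s ()) _ | Bézout.-+ _ (suc _) _
-- In this form of Bézout x * q ≡ -1, and the factor p - 1 ≡ -1 repairs the sign without
-- subtraction.
inverse {suc (suc p)} {q} _ q⊥p | Bézout.-+ x (suc y) e = x * (1 + p) , p + y * (1 + p) ,
  (equate (x ∷ q ∷ p ∷ y ∷ []) 1 (# 0 ⊗ (‵ 1 ⊕ # 2) ⊗ # 1) (‵ 1 ⊕ (# 2 ⊕ # 3 ⊗ (‵ 1 ⊕ # 2)) ⊗ (‵ 2 ⊕ # 2)) ((‵ 1 ⊕ # 2 ,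
    ‵ 1 ⊕ # 0 ⊗ # 1 , ‵ 2 ⊕ # 2 ⊕ # 3 ⊗ (‵ 2 ⊕ # 2)) ∷ []) refl (e , tt))
inverse {suc (suc _)} (s≤s (s≤s _)) _ | Bézout.-+ _ zero ()

close : ∀ {p u v} s t → u ≤ v → v < u + p → u + p * s ≡ v + p * t → u ≡ v
close {p} {u} {v} s t u≤v v<u+p e with v ∸ u | m+[n∸m]≡n u≤v
... | d | refl = [ (λ { refl → sym (+-identityʳ u) }) , (λ { refl → ⊥-elim (<-irrefl refl v<u+p) }) ]′
    (multiple<2n {p} {d} p∣d (<-≤-trans (+-cancelˡ-< u d p v<u+p) (m≤m+n p p)))
  where
  p∣d : p ∣ d
  p∣d = ∣m+n∣m⇒∣n (subst (p ∣_) (equate (u ∷ p ∷ s ∷ d ∷ t ∷ []) 1 (# 1 ⊗ # 2) (# 1 ⊗ # 4 ⊕ # 3) (# 0 ⊕ # 1 ⊗ # 2 ≼ # 0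
    ⊕ # 3 ⊕ # 1 ⊗ # 4 ∷ []) refl (e , tt)) (m∣m*n s)) (m∣m*n t)

-- Every M below hi is written a·qr + b·pr + c·pq + pqr ≡ M + pqr·N with a, b, c reduced; N ≤ 2 from lo on.
record System (p q r lo hi : ℕ) : Set where
  field
    a b c N  : ℕ → ℕ
    a<p      : ∀ M → a M < p
    b<q      : ∀ M → b M < q
    c<r      : ∀ M → c M < r
    rep      : ∀ {M} → M < hi → a M * (q * r) + b M * (p * r) + c M * (p * q) + p * q * r ≡ M + p * q * r * N M
    N≤2      : ∀ {M} → lo ≤ M → M < hi → N M ≤ 2
    p⊥qr     : Coprime p (q * r)
    q⊥pr     : Coprime q (p * r)
    r⊥pq     : Coprime r (p * q)
    1<p      : 1 < p
    1<q      : 1 < q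
    1<r      : 1 < r

-- The left side of `rep` inside certificates; the arguments are indices into the environment, not
-- values.
repᵉ : (a b c p q r : ℕ) → Exp
repᵉ a b c p q r = # a ⊗ (# q ⊗ # r) ⊕ # b ⊗ (# p ⊗ # r) ⊕ # c ⊗ (# p ⊗ # q) ⊕ # p ⊗ # q ⊗ # r

swap : ∀ {p q r lo hi} → System p q r lo hi → System p r q lo hi
swap {p} {q} {r} S = record
  { a = a ; b = c ; c = b ; N = N ; a<p = a<p ; b<q = c<r ; c<r = b<q
  ; rep = λ {M} M< → (equate ((a M) ∷ q ∷ r ∷ (b M) ∷ p ∷ (c M) ∷ M ∷ (N M) ∷ []) 1 (repᵉ 0 5 3 4 2 1) (# 6 ⊕ # 4 ⊗ # 2
    ⊗ # 1 ⊗ # 7) (repᵉ 0 3 5 4 1 2 ≼ # 6 ⊕ # 4 ⊗ # 1 ⊗ # 2 ⊗ # 7 ∷ []) refl (rep M< , tt))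
  ; N≤2 = N≤2 ; p⊥qr = subst (Coprime p) (*-comm q r) p⊥qr ; q⊥pr = r⊥pq ; r⊥pq = q⊥pr
  ; 1<p = 1<p ; 1<q = 1<r ; 1<r = 1<q }
  where open System S

-- Subtraction with borrow, and the coordinates of a shifted M

data Borrow (x y n : ℕ) : ℕ → ℕ → Set where
  borrow : ∀ {x′} → x < y → x′ + y ≡ x + n → Borrow x y n x′ 1
  none   : ∀ {x′} → y ≤ x → x′ + y ≡ x → Borrow x y n x′ 0

subtract : ∀ {x y n} → x < n → y ≤ n → ∃₂ λ x′ s → x′ < n × Borrow x y n x′ s
subtract {x} {y} {n} x<n y≤n with x <? y
... | yes x<y = x + n ∸ y , 1 , (entail ((x + n ∸ y) ∷ y ∷ x ∷ n ∷ []) (‵ 1) (‵ 1 ⊕ # 0) (# 3) (# 0 ⊕ # 1 ≼ # 2 ⊕ # 3 ∷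
  # 2 ≺ # 1 ∷ []) refl (≤-reflexive e , x<y , tt)) , borrow x<y e
  where e = m∸n+n≡m {x + n} {y} (≤-trans y≤n (m≤n+m n x))
... | no x≮y = x ∸ y , 0 , ≤-<-trans (m∸n≤m x y) x<n , none (≮⇒≥ x≮y) (m∸n+n≡m (≮⇒≥ x≮y))

borrow-≡ : ∀ {x y n x′ s} → Borrow x y n x′ s → x′ + y ≡ x + s * n
borrow-≡ {n = n} (borrow _ e) = trans e (cong (_ +_) (sym (+-identityʳ n)))
borrow-≡         (none _ e)   = trans e (sym (+-identityʳ _))

-- (α, B) solves α q + B p ≡ ±1, the sign being given by (e⁺, e⁻) ∈ {(1, 0), (0, 1)}.
record Unit (p q α B e⁺ e⁻ : ℕ) : Set where
  field
    α≤p   : α ≤ p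
    B≤q   : B ≤ q
    e⁺≤1  : e⁺ ≤ 1
    e⁻≤1  : e⁻ ≤ 1
    ±1    : e⁺ + e⁻ ≡ 1
    α-B   : α * q + B * p + e⁻ ≡ p * q + e⁺

module _ {p q r lo hi} (S : System p q r lo hi) {α B e⁺ e⁻} (U : Unit p q α B e⁺ e⁻) where
  open System S
  open Unit U

  record Shift (M M′ : ℕ) : Set where
    constructor shifted-by
    field
      {s t} : ℕ
      s-a   : Borrow (a M) α p (a M′) s
      t-b   : Borrow (b M) B q (b M′) t
      c≡    : c M′ ≡ c M
      N≡    : 1 + N M′ ≡ N M + s + t

  -- `α-B` times r reads α·qr + B·pr = pqr ± r. So lowering a by α and b by B moves M by r and takes
  -- away one pqr, while each borrow gives one back. Reduced coordinates are unique, so the result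
  -- has the coordinates of M′.
  shifted : ∀ {M M′} → M < hi → M′ < hi → M′ + e⁺ * r ≡ M + e⁻ * r → Shift M M′
  shifted {M} {M′} M< M′< eq
    with subtract (a<p M) α≤p | subtract (b<q M) B≤q
  ... | a″ , s , a″<p , sa | b″ , t , b″<q , tb
    = case a≡ of λ { refl → case b≡ of λ { refl → shifted-by sa tb c≡ N≡ } }
    where
    a≡ : a″ ≡ a M′
    a≡ = cancel-≡ p⊥qr (b M * r + c M * q + q * r + q * r * N M′)
                       (b M′ * r + c M′ * q + q * r * N M + s * q * r + B * r) a″<p (a<p M′)
      (equate ((a M) ∷ q ∷ r ∷ (b M) ∷ p ∷ (c M) ∷ M ∷ (N M) ∷ (a M′) ∷ (b M′) ∷ (c M′) ∷ M′ ∷ (N M′) ∷ α ∷ B ∷ e⁻ ∷ e⁺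
        ∷ a″ ∷ s ∷ []) 1 (# 17 ⊗ (# 1 ⊗ # 2) ⊕ # 4 ⊗ (# 3 ⊗ # 2 ⊕ # 5 ⊗ # 1 ⊕ # 1 ⊗ # 2 ⊕ # 1 ⊗ # 2 ⊗ # 12)) (# 8 ⊗ (# 1
        ⊗ # 2) ⊕ # 4 ⊗ (# 9 ⊗ # 2 ⊕ # 10 ⊗ # 1 ⊕ # 1 ⊗ # 2 ⊗ # 7 ⊕ # 18 ⊗ # 1 ⊗ # 2 ⊕ # 14 ⊗ # 2)) (repᵉ 0 3 5 4 1 2 ≼ #
        6 ⊕ # 4 ⊗ # 1 ⊗ # 2 ⊗ # 7 ∷ # 11 ⊕ # 4 ⊗ # 1 ⊗ # 2 ⊗ # 12 ≼ repᵉ 8 9 10 4 1 2 ∷ (# 2 , # 4 ⊗ # 1 ⊕ # 16 , # 13 ⊗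
        # 1 ⊕ # 14 ⊗ # 4 ⊕ # 15) ∷ (# 1 ⊗ # 2 , # 17 ⊕ # 13 , # 0 ⊕ # 18 ⊗ # 4) ∷ # 6 ⊕ # 15 ⊗ # 2 ≼ # 11 ⊕ # 16 ⊗ # 2 ∷
        []) refl (rep M< , sym (rep M′<) , sym α-B , borrow-≡ sa , sym eq , tt))
    b≡ : b″ ≡ b M′
    b≡ = cancel-≡ q⊥pr (a M * r + c M * p + p * r + p * r * N M′)
                       (a M′ * r + c M′ * p + p * r * N M + t * p * r + α * r) b″<q (b<q M′)
      (equate ((a M) ∷ q ∷ r ∷ (b M) ∷ p ∷ (c M) ∷ M ∷ (N M) ∷ (a M′) ∷ (b M′) ∷ (c M′) ∷ M′ ∷ (N M′) ∷ α ∷ B ∷ e⁻ ∷ e⁺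
        ∷ b″ ∷ t ∷ []) 1 (# 17 ⊗ (# 4 ⊗ # 2) ⊕ # 1 ⊗ (# 0 ⊗ # 2 ⊕ # 5 ⊗ # 4 ⊕ # 4 ⊗ # 2 ⊕ # 4 ⊗ # 2 ⊗ # 12)) (# 9 ⊗ (# 4
        ⊗ # 2) ⊕ # 1 ⊗ (# 8 ⊗ # 2 ⊕ # 10 ⊗ # 4 ⊕ # 4 ⊗ # 2 ⊗ # 7 ⊕ # 18 ⊗ # 4 ⊗ # 2 ⊕ # 13 ⊗ # 2)) (repᵉ 0 3 5 4 1 2 ≼ #
        6 ⊕ # 4 ⊗ # 1 ⊗ # 2 ⊗ # 7 ∷ # 11 ⊕ # 4 ⊗ # 1 ⊗ # 2 ⊗ # 12 ≼ repᵉ 8 9 10 4 1 2 ∷ (# 2 , # 4 ⊗ # 1 ⊕ # 16 , # 13 ⊗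
        # 1 ⊕ # 14 ⊗ # 4 ⊕ # 15) ∷ (# 4 ⊗ # 2 , # 17 ⊕ # 14 , # 3 ⊕ # 18 ⊗ # 1) ∷ # 6 ⊕ # 15 ⊗ # 2 ≼ # 11 ⊕ # 16 ⊗ # 2 ∷
        []) refl (rep M< , sym (rep M′<) , sym α-B , borrow-≡ tb , sym eq , tt))
    c≡ : c M′ ≡ c M
    c≡ = cancel-≡ r⊥pq (a M′ * q + b M′ * p + p * q * N M + e⁺) (a M * q + b M * p + p * q * N M′ + e⁻) (c<r M′) (c<r M)
      (equate ((a M) ∷ q ∷ r ∷ (b M) ∷ p ∷ (c M) ∷ M ∷ (N M) ∷ (a M′) ∷ (b M′) ∷ (c M′) ∷ M′ ∷ (N M′) ∷ e⁺ ∷ e⁻ ∷ []) 1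
        (# 10 ⊗ (# 4 ⊗ # 1) ⊕ # 2 ⊗ (# 8 ⊗ # 1 ⊕ # 9 ⊗ # 4 ⊕ # 4 ⊗ # 1 ⊗ # 7 ⊕ # 13)) (# 5 ⊗ (# 4 ⊗ # 1) ⊕ # 2 ⊗ (# 0 ⊗
        # 1 ⊕ # 3 ⊗ # 4 ⊕ # 4 ⊗ # 1 ⊗ # 12 ⊕ # 14)) (# 6 ⊕ # 4 ⊗ # 1 ⊗ # 2 ⊗ # 7 ≼ repᵉ 0 3 5 4 1 2 ∷ repᵉ 8 9 10 4 1 2
        ≼ # 11 ⊕ # 4 ⊗ # 1 ⊗ # 2 ⊗ # 12 ∷ # 11 ⊕ # 13 ⊗ # 2 ≼ # 6 ⊕ # 14 ⊗ # 2 ∷ []) refl (sym (rep M<) , rep M′< , eq ,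
        tt))
    N≡ : 1 + N M′ ≡ N M + s + t
    N≡ = *-cancelˡ-≡ _ _ (p * q * r) {{>-nonZero (entail (p ∷ q ∷ r ∷ []) (‵ 1) (‵ 1 ⊕ ‵ 0) (# 0 ⊗ # 1 ⊗ # 2) ((# 1 ⊗ #
      2 , ‵ 1 ⊕ ‵ 1 , # 0) ∷ (‵ 2 ⊗ # 2 , ‵ 1 ⊕ ‵ 1 , # 1) ∷ (‵ 4 , ‵ 1 ⊕ ‵ 1 , # 2) ∷ []) refl (1<p , 1<q , 1<r , tt))}}
      (equate ((a M) ∷ q ∷ r ∷ (b M) ∷ p ∷ (c M) ∷ M ∷ (N M) ∷ (a M′) ∷ (b M′) ∷ (c M′) ∷ M′ ∷ (N M′) ∷ α ∷ B ∷ e⁻ ∷ e⁺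
        ∷ s ∷ t ∷ []) 1 (# 4 ⊗ # 1 ⊗ # 2 ⊗ (‵ 1 ⊕ # 12)) (# 4 ⊗ # 1 ⊗ # 2 ⊗ (# 7 ⊕ # 17 ⊕ # 18)) (repᵉ 0 3 5 4 1 2 ≼ # 6
        ⊕ # 4 ⊗ # 1 ⊗ # 2 ⊗ # 7 ∷ # 11 ⊕ # 4 ⊗ # 1 ⊗ # 2 ⊗ # 12 ≼ repᵉ 8 9 10 4 1 2 ∷ (# 2 , # 4 ⊗ # 1 ⊕ # 16 , # 13 ⊗ #
        1 ⊕ # 14 ⊗ # 4 ⊕ # 15) ∷ (# 1 ⊗ # 2 , # 8 ⊕ # 13 , # 0 ⊕ # 17 ⊗ # 4) ∷ (# 4 ⊗ # 2 , # 9 ⊕ # 14 , # 3 ⊕ # 18 ⊗ #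
        1) ∷ (# 4 ⊗ # 1 , # 10 , # 5) ∷ # 6 ⊕ # 15 ⊗ # 2 ≼ # 11 ⊕ # 16 ⊗ # 2 ∷ []) refl (rep M< , sym (rep M′<) , sym
        α-B , trans (cong (_+ α) (sym a≡)) (borrow-≡ sa) , trans (cong (_+ B) (sym b≡)) (borrow-≡ tb) , c≡ , sym eq ,
        tt))

-- Reindexing of finite sums

sum-cong-< : ∀ {f g} n → (∀ {i} → i < n → f i ≡ g i) → sum f n ≡ sum g n
sum-cong-< zero    e = refl
sum-cong-< (suc n) e = cong₂ _+_ (sum-cong-< n (λ i<n → e (m<n⇒m<1+n i<n))) (e ≤-refl)

sum-const : ∀ {f} c n → (∀ {i} → i < n → f i ≡ c) → sum f n ≡ n * c
sum-const c zero    e = refl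
sum-const c (suc n) e = trans (cong₂ _+_ (sum-const c n (λ i<n → e (m<n⇒m<1+n i<n))) (e ≤-refl)) (+-comm (n * c) c)

δ : ℕ → ℕ → ℕ
δ zero    zero    = 1
δ zero    (suc j) = 0
δ (suc i) zero    = 0
δ (suc i) (suc j) = δ i j

δ-refl : ∀ i → δ i i ≡ 1
δ-refl zero    = refl
δ-refl (suc i) = δ-refl i

δ-≢ : ∀ {i j} → i ≢ j → δ i j ≡ 0
δ-≢ {zero}  {zero}  i≢j = ⊥-elim (i≢j refl)
δ-≢ {zero}  {suc j} i≢j = refl
δ-≢ {suc i} {zero}  i≢j = refl
δ-≢ {suc i} {suc j} i≢j = δ-≢ (λ i≡j → i≢j (cong suc i≡j))

sum-δ : ∀ (f : ℕ → ℕ) {n j} → j < n → sum (λ i → δ j i * f i) n ≡ f j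
sum-δ f {suc n} {j} j<1+n with j ≟ n
... | yes refl = cong₂ _+_ (trans (sum-const 0 n (λ i<n → cong (_* f _) (δ-≢ (>⇒≢ i<n)))) (*-zeroʳ n))
                                  (trans (cong (_* f n) (δ-refl n)) (*-identityˡ (f n)))
... | no j≢n = trans (cong₂ _+_ (sum-δ f (≤∧≢⇒< (s≤s⁻¹ j<1+n) j≢n)) (cong (_* f n) (δ-≢ j≢n))) (+-identityʳ (f j))

-- Each f (π i) is expanded over the permutation matrix `δ (π i) j`, the two sums are exchanged, and
-- the inverse ρ collapses each column.
sum-permute : ∀ (f π ρ : ℕ → ℕ) n → (∀ {i} → i < n → π i < n) → (∀ {i} → i < n → ρ i < n) →
  (∀ {i} → i < n → ρ (π i) ≡ i) → (∀ {i} → i < n → π (ρ i) ≡ i) → sum (λ i → f (π i)) n ≡ sum f n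
sum-permute f π ρ n π< ρ< ρπ πρ =
  trans (sum-cong-< n (λ i<n → sym (sum-δ f (π< i<n))))
  (trans (sum-swap (λ i j → δ (π i) j * f j) n n)
  (sum-cong-< n (λ {j} j<n → trans (sum-cong-< n (λ {i} i<n → cong (_* f j) (flip i<n j<n))) (sum-δ (λ _ → f j) (ρ< j<n)))))
  where
  flip : ∀ {i j} → i < n → j < n → δ (π i) j ≡ δ (ρ j) i
  flip {i} {j} i<n j<n with π i ≟ j
  ... | yes refl = trans (δ-refl (π i)) (sym (trans (cong (λ x → δ x i) (ρπ i<n)) (δ-refl i)))
  ... | no πi≢j  = trans (δ-≢ πi≢j) (sym (δ-≢ λ ρj≡i → πi≢j (trans (cong π (sym ρj≡i)) (πρ j<n))))

-- The summand in the zones of a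

data Bit : ℕ → Set where
  O : Bit 0
  I : Bit 1

χ : ℕ → ℕ
χ zero    = 1
χ (suc _) = 0

-- The bound is attained, and then G is known, or it is missed by exactly one. So the sum of the
-- defects counts residues.
data Graded (bound : ℕ) (G : Set) (pos neg : ℕ) : Set where
  good : pos ≡ bound + neg → G → Graded bound G pos neg
  bad  : 1 + pos ≡ bound + neg → Graded bound G pos neg

-- N, N₁, N₂, N₁₂ belong to M and to its shifts by r, by q and by both; t = [b < B], u = [c < C], and the lemmas
-- cover a < α, α ≤ a < β, β ≤ a < α + β and α + β ≤ a in turn.
module _ {N₁ N₂ N₁₂ t u : ℕ} where

  grade-A : ∀ {N} → Bit t → Bit u → N ≤ 2 → 1 + N₁ ≡ N + 1 + t → 1 + N₂ ≡ N + 1 + u → 1 + N₁₂ ≡ N₁ + 0 + u →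
    Graded 1 (N ≡ 0 ⊎ (N ≡ 1 × t ≡ 0 × u ≡ 0)) (χ N + χ N₁₂) (χ N₁ + χ N₂)
  grade-A {0} O O _ refl refl ()
  grade-A {0} O I _ refl refl refl = good refl (inj₁ refl)
  grade-A {0} I O _ refl refl refl = good refl (inj₁ refl)
  grade-A {0} I I _ refl refl refl = good refl (inj₁ refl)
  grade-A {1} O O _ refl refl refl = good refl (inj₂ (refl , refl , refl))
  grade-A {1} O I _ refl refl refl = bad refl
  grade-A {1} I O _ refl refl refl = bad refl
  grade-A {1} I I _ refl refl refl = bad refl
  grade-A {2} O O _ refl refl refl = bad refl
  grade-A {2} O I _ refl refl refl = bad refl
  grade-A {2} I O _ refl refl refl = bad refl
  grade-A {2} I I _ refl refl refl = bad refl
  grade-A {suc (suc (suc _))} _ _ (s≤s (s≤s ()))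

  grade-AN : ∀ {N} → Bit t → Bit u → N ≤ 2 → 1 + N₁ ≡ N + 0 + t → 1 + N₂ ≡ N + 1 + u → 1 + N₁₂ ≡ N₁ + 1 + u →
    Graded 0 ⊤ (χ N + χ N₁₂) (χ N₁ + χ N₂)
  grade-AN {0} O _ _ () _ _
  grade-AN {0} I O _ refl refl refl = good refl tt
  grade-AN {0} I I _ refl refl refl = good refl tt
  grade-AN {1} O O _ refl refl refl = good refl tt
  grade-AN {1} O I _ refl refl refl = bad refl
  grade-AN {1} I O _ refl refl refl = good refl tt
  grade-AN {1} I I _ refl refl refl = good refl tt
  grade-AN {2} O O _ refl refl refl = good refl tt
  grade-AN {2} O I _ refl refl refl = good refl tt
  grade-AN {2} I O _ refl refl refl = good refl tt
  grade-AN {2} I I _ refl refl refl = good refl tt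
  grade-AN {suc (suc (suc _))} _ _ (s≤s (s≤s ()))

  grade-N : ∀ {N} → Bit t → Bit u → N ≤ 2 → 1 + N₁ ≡ N + 0 + t → 1 + N₂ ≡ N + 0 + u → 1 + N₁₂ ≡ N₁ + 1 + u →
    Graded 0 (N ≡ 2 ⊎ (N ≡ 1 × t ≡ 1 × u ≡ 1)) (χ N + χ N₁₂) (χ N₁ + χ N₂)
  grade-N {0} O _ _ () _ _
  grade-N {0} I O _ _ () _
  grade-N {0} I I _ refl refl refl = bad refl
  grade-N {1} O O _ refl refl refl = bad refl
  grade-N {1} O I _ refl refl refl = bad refl
  grade-N {1} I O _ refl refl refl = bad refl
  grade-N {1} I I _ refl refl refl = good refl (inj₂ (refl , refl , refl))
  grade-N {2} O O _ refl refl refl = good refl (inj₁ refl)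
  grade-N {2} O I _ refl refl refl = good refl (inj₁ refl)
  grade-N {2} I O _ refl refl refl = good refl (inj₁ refl)
  grade-N {2} I I _ refl refl refl = good refl (inj₁ refl)
  grade-N {suc (suc (suc _))} _ _ (s≤s (s≤s ()))

  grade-B : ∀ {N} → Bit t → Bit u → N ≤ 2 → 1 + N₁ ≡ N + 0 + t → 1 + N₂ ≡ N + 0 + u → 1 + N₁₂ ≡ N₁ + 0 + u →
    Graded 1 (N ≡ 2 × t ≡ 0 × u ≡ 0) (χ N + χ N₁₂) (χ N₁ + χ N₂)
  grade-B {0} O _ _ () _ _
  grade-B {0} I O _ _ () _
  grade-B {0} I I _ refl refl refl = bad refl
  grade-B {1} O O _ refl refl ()
  grade-B {1} O I _ refl refl refl = bad refl
  grade-B {1} I O _ refl refl refl = bad refl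
  grade-B {1} I I _ refl refl refl = bad refl
  grade-B {2} O O _ refl refl refl = good refl (refl , refl , refl)
  grade-B {2} O I _ refl refl refl = bad refl
  grade-B {2} I O _ refl refl refl = bad refl
  grade-B {2} I I _ refl refl refl = bad refl
  grade-B {suc (suc (suc _))} _ _ (s≤s (s≤s ()))

bit : ∀ {x y n x′ s} → Borrow x y n x′ s → Bit s
bit (borrow _ _) = I
bit (none _ _)   = O

borrow-unique : ∀ {x y n x′ x″ s s′} → Borrow x y n x′ s → Borrow x y n x″ s′ → s ≡ s′
borrow-unique (borrow _ _) (borrow _ _) = refl
borrow-unique (borrow h _) (none h′ _)  = ⊥-elim (<⇒≱ h h′)
borrow-unique (none h _)   (borrow h′ _) = ⊥-elim (<⇒≱ h′ h)
borrow-unique (none _ _)   (none _ _)   = refl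

borrow-0 : ∀ {x y n x′ s} → Borrow x y n x′ s → s ≡ 0 → y ≤ x
borrow-0 (none h _) _ = h

borrow-1 : ∀ {x y n x′ s} → Borrow x y n x′ s → s ≡ 1 → x < y
borrow-1 (borrow h _) _ = h

borrow-< : ∀ {x y n x′ s} → Borrow x y n x′ s → x < y → s ≡ 1 × x′ + y ≡ x + n
borrow-< (borrow _ e) _ = refl , e
borrow-< (none h _) lt  = ⊥-elim (<⇒≱ lt h)

borrow-≥ : ∀ {x y n x′ s} → Borrow x y n x′ s → y ≤ x → s ≡ 0 × x′ + y ≡ x
borrow-≥ (none _ e) _    = refl , e
borrow-≥ (borrow h _) le = ⊥-elim (<⇒≱ h le)

-- Carries, and congruences modulo p

data Carry (n s t : ℕ) : ℕ → ℕ → Set where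
  even : s ≡ t     → Carry n s t 0 0
  up   : s + n ≡ t → Carry n s t 1 0
  down : s ≡ t + n → Carry n s t 0 1

carry : ∀ {n s t} → Near n s t → ∃₂ (Carry n s t)
carry (inj₁ e)        = 0 , 0 , even e
carry (inj₂ (inj₁ e)) = 1 , 0 , up e
carry (inj₂ (inj₂ e)) = 0 , 1 , down e

carry-≡ : ∀ {n s t i i′} → Carry n s t i i′ → s + i * n ≡ t + i′ * n
carry-≡ (even e)             = cong (_+ 0) e
carry-≡ {n} {s} {t} (up e)   = (equate (s ∷ n ∷ t ∷ []) 1 (# 0 ⊕ (# 1 ⊕ ‵ 0)) (# 2 ⊕ ‵ 0) (# 0 ⊕ # 1 ≼ # 2 ∷ []) refl (e
  , tt))
carry-≡ {n} {s} {t} (down e) = (equate (s ∷ t ∷ n ∷ []) 1 (# 0 ⊕ ‵ 0) (# 1 ⊕ (# 2 ⊕ ‵ 0)) (# 0 ≼ # 1 ⊕ # 2 ∷ []) refl (e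
  , tt))

module _ {q r s t s′ t′ : ℕ} where

  -- Each coordinate transports at most one carry, so a balance of two forces both.
  carry-both : ∀ {i i′ j j′} → Carry q s t i i′ → Carry r s′ t′ j j′ → 2 + i + j ≡ 4 + i′ + j′ → s + q ≡ t × s′ + r ≡ t′
  carry-both (up e)   (up e′)   _ = e , e′
  carry-both (up _)   (even _)  ()
  carry-both (up _)   (down _)  ()
  carry-both (even _) (up _)    ()
  carry-both (even _) (even _)  ()
  carry-both (even _) (down _)  ()
  carry-both (down _) (up _)    ()
  carry-both (down _) (even _)  ()
  carry-both (down _) (down _)  ()

  carry-one : ∀ {i i′ j j′} → Carry q s t i i′ → Carry r s′ t′ j j′ → 3 + i + j ≡ 4 + i′ + j′ →
    (s + q ≡ t × s′ ≡ t′) ⊎ (s ≡ t × s′ + r ≡ t′)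
  carry-one (up e)   (even e′) _ = inj₁ (e , e′)
  carry-one (even e) (up e′)   _ = inj₂ (e , e′)
  carry-one (up _)   (up _)    ()
  carry-one (up _)   (down _)  ()
  carry-one (even _) (even _)  ()
  carry-one (even _) (down _)  ()
  carry-one (down _) (up _)    ()
  carry-one (down _) (even _)  ()
  carry-one (down _) (down _)  ()

infix 4 _≋_mod_
-- A multiple on each side, since over ℕ either number may be the larger.
record _≋_mod_ (x y n : ℕ) : Set where
  constructor congruent
  field
    s t : ℕ
    eq  : x + n * s ≡ y + n * t

module _ {n : ℕ} where

  ≡⇒≋ : ∀ {x y} → x ≡ y → x ≋ y mod n
  ≡⇒≋ e = congruent 0 0 (cong (_+ n * 0) e)

  ≋-refl : ∀ {x} → x ≋ x mod n
  ≋-refl = ≡⇒≋ refl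

  ≋-sym : ∀ {x y} → x ≋ y mod n → y ≋ x mod n
  ≋-sym (congruent s t e) = congruent t s (sym e)

  ≋-trans : ∀ {x y z} → x ≋ y mod n → y ≋ z mod n → x ≋ z mod n
  ≋-trans {x} {y} {z} (congruent s t e) (congruent s′ t′ e′) = congruent (s + s′) (t + t′)
    (equate (x ∷ n ∷ s ∷ y ∷ t ∷ s′ ∷ z ∷ t′ ∷ []) 1 (# 0 ⊕ # 1 ⊗ (# 2 ⊕ # 5)) (# 6 ⊕ # 1 ⊗ (# 4 ⊕ # 7)) (# 0 ⊕ # 1 ⊗ #
      2 ≼ # 3 ⊕ # 1 ⊗ # 4 ∷ # 3 ⊕ # 1 ⊗ # 5 ≼ # 6 ⊕ # 1 ⊗ # 7 ∷ []) refl (e , e′ , tt))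

  ≋-* : ∀ {x y x′ y′} → x ≋ y mod n → x′ ≋ y′ mod n → x * x′ ≋ y * y′ mod n
  ≋-* {x} {y} {x′} {y′} (congruent s t e) (congruent s′ t′ e′) =
    congruent (x * s′ + x′ * s + n * s * s′) (y * t′ + y′ * t + n * t * t′)
    (equate (x ∷ n ∷ s ∷ x′ ∷ s′ ∷ y ∷ t ∷ y′ ∷ t′ ∷ []) 1 (# 0 ⊗ # 3 ⊕ # 1 ⊗ (# 0 ⊗ # 4 ⊕ # 3 ⊗ # 2 ⊕ # 1 ⊗ # 2 ⊗ # 4))
      (# 5 ⊗ # 7 ⊕ # 1 ⊗ (# 5 ⊗ # 8 ⊕ # 7 ⊗ # 6 ⊕ # 1 ⊗ # 6 ⊗ # 8)) ((# 0 ⊕ # 1 ⊗ # 2) ⊗ (# 3 ⊕ # 1 ⊗ # 4) ≼ (# 5 ⊕ # 1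
      ⊗ # 6) ⊗ (# 7 ⊕ # 1 ⊗ # 8) ∷ []) refl (cong₂ _*_ e e′ , tt))

  ≋-square⁻ : ∀ {x y} → x + y ≋ 0 mod n → x * x ≋ y * y mod n
  ≋-square⁻ {x} {y} (congruent s t e) = congruent (s * x + t * y) (t * x + s * y)
    (equate (x ∷ y ∷ n ∷ s ∷ t ∷ []) 1 (# 0 ⊗ # 0 ⊕ # 2 ⊗ (# 3 ⊗ # 0 ⊕ # 4 ⊗ # 1)) (# 1 ⊗ # 1 ⊕ # 2 ⊗ (# 4 ⊗ # 0 ⊕ # 3 ⊗
      # 1)) ((# 0 , # 0 ⊕ # 1 ⊕ # 2 ⊗ # 3 , ‵ 0 ⊕ # 2 ⊗ # 4) ∷ (# 1 , ‵ 0 ⊕ # 2 ⊗ # 4 , # 0 ⊕ # 1 ⊕ # 2 ⊗ # 3) ∷ [])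
      refl (e , sym e , tt))

  ≋-⇒∣ : ∀ {x y} → x + y ≋ x mod n → n ∣ y
  ≋-⇒∣ {x} {y} (congruent s t e) = ∣m+n∣m⇒∣n (subst (n ∣_) nt (m∣m*n t)) (m∣m*n s)
    where nt : n * t ≡ n * s + y
          nt = (equate (x ∷ y ∷ n ∷ s ∷ t ∷ []) 1 (# 2 ⊗ # 4) (# 2 ⊗ # 3 ⊕ # 1) (# 0 ⊕ # 2 ⊗ # 4 ≼ # 0 ⊕ # 1 ⊕ # 2 ⊗ # 3
            ∷ []) refl (sym e , tt))

-- Squaring removes the unknown sign of αq ≡ ±1.
unit-square : ∀ {p q α B e⁺ e⁻} → Unit p q α B e⁺ e⁻ → α * q * (α * q) ≋ 1 mod p
unit-square {p} {q} {α} {B} {e⁺} {e⁻} U = go e⁺ e⁻ (Unit.±1 U) (Unit.α-B U)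
  where
  go : ∀ e⁺ e⁻ → e⁺ + e⁻ ≡ 1 → α * q + B * p + e⁻ ≡ p * q + e⁺ → α * q * (α * q) ≋ 1 mod p
  go 1 0 _ e = ≋-* one one
    where one : α * q ≋ 1 mod p
          one = congruent B q (equate (α ∷ q ∷ B ∷ p ∷ []) 1 (# 0 ⊗ # 1 ⊕ # 3 ⊗ # 2) (‵ 1 ⊕ # 3 ⊗ # 1) (# 0 ⊗ # 1 ⊕ # 2
            ⊗ # 3 ⊕ ‵ 0 ≼ # 3 ⊗ # 1 ⊕ ‵ 1 ∷ []) refl (e , tt))
  go 0 1 _ e = ≋-square⁻ (congruent B q (equate (α ∷ q ∷ B ∷ p ∷ []) 1 (# 0 ⊗ # 1 ⊕ ‵ 1 ⊕ # 3 ⊗ # 2) (‵ 0 ⊕ # 3 ⊗ # 1)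
    (# 0 ⊗ # 1 ⊕ # 2 ⊗ # 3 ⊕ ‵ 1 ≼ # 3 ⊗ # 1 ⊕ ‵ 0 ∷ []) refl (e , tt)))

prime∤8 : ∀ {p} → Prime p → 2 < p → ¬ p ∣ 8
prime∤8 pp 2<p p∣8 = <⇒≱ 2<p (case euclidsLemma 2 4 pp p∣8 of λ where
  (inj₁ d) → ∣⇒≤ d
  (inj₂ d) → case euclidsLemma 2 2 pp d of λ where
    (inj₁ d) → ∣⇒≤ d
    (inj₂ d) → ∣⇒≤ d)

-- (αq)² ≡ (αr)² ≡ 1 and (qr)² ≡ 9 give 9α⁴ ≡ 1, while 3α ≡ -1 gives 9α² ≡ 1; hence 9 ≡ 1.
no-rigid : ∀ {p q r α} → Prime p → 0 < α → p ≡ 1 + 3 * α → α * q * (α * q) ≋ 1 mod p → α * r * (α * r) ≋ 1 mod p →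
  q * r * (q * r) ≋ 9 mod p → ⊥
no-rigid {p} {q} {r} {α} pp 0<α p≡ Q R QR =
  prime∤8 pp (entail (α ∷ p ∷ []) (‵ 1) (‵ 1 ⊕ ‵ 2) (# 1) ((‵ 3 , ‵ 1 ⊕ ‵ 0 , # 0) ∷ ‵ 3 ⊗ # 0 ≺ # 1 ∷ []) refl (0<α ,
    ≤-reflexive (sym p≡) , tt)) (≋-⇒∣ 9≋1)
  where
  9α² : 9 * (α * α) ≋ 1 mod p
  9α² = congruent 1 (3 * α) (equate (p ∷ α ∷ []) 1 (‵ 9 ⊗ (# 1 ⊗ # 1) ⊕ # 0 ⊗ ‵ 1) (‵ 1 ⊕ # 0 ⊗ (‵ 3 ⊗ # 1)) ((‵ 1 ⊕ ‵ 3
    ⊗ # 1 , ‵ 1 ⊕ ‵ 3 ⊗ # 1 , # 0) ∷ (‵ 2 , # 0 , ‵ 1 ⊕ ‵ 3 ⊗ # 1) ∷ []) refl (sym p≡ , p≡ , tt))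
  9α⁴ : 9 * (α * α * (α * α)) ≋ 1 mod p
  9α⁴ = ≋-trans (≋-* (≋-sym QR) ≋-refl)
       (≋-trans (≡⇒≋ (identity (q ∷ r ∷ α ∷ []) (# 0 ⊗ # 1 ⊗ (# 0 ⊗ # 1) ⊗ (# 2 ⊗ # 2 ⊗ (# 2 ⊗ # 2))) (# 2 ⊗ # 0 ⊗ (# 2
         ⊗ # 0) ⊗ (# 2 ⊗ # 1 ⊗ (# 2 ⊗ # 1))) refl)) (≋-* Q R))
  α² : α * α ≋ 1 mod p
  α² = ≋-trans (≋-trans (≡⇒≋ (sym (*-identityˡ (α * α)))) (≋-* (≋-sym 9α²) ≋-refl))
      (≋-trans (≡⇒≋ (*-assoc 9 (α * α) (α * α))) 9α⁴)
  9≋1 : 1 + 8 ≋ 1 mod p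
  9≋1 = ≋-trans (≋-* (≋-refl {x = 9}) (≋-sym α²)) 9α²

-- A window enumerated by the coordinate a

record Windows (p q r lo hi e⁺ e⁻ f⁺ f⁻ : ℕ) : Set where
  field
    W W₁ W₂ W₁₂ : ℕ
    lo≤W   : lo ≤ W
    W-hi   : W + p ≤ hi
    W₁-hi  : W₁ + p ≤ hi
    W₂-hi  : W₂ + p ≤ hi
    W₁₂-hi : W₁₂ + p ≤ hi
    W₁-r   : W₁ + e⁺ * r ≡ W + e⁻ * r
    W₂-q   : W₂ + f⁺ * q ≡ W + f⁻ * q
    W₁₂-q  : W₁₂ + f⁺ * q ≡ W₁ + f⁻ * q

record Enumeration {p q r lo hi} (S : System p q r lo hi) (W : ℕ) : Set where
  open System S
  field
    W-hi : W + p ≤ hi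
    m    : ℕ → ℕ
    m<   : ∀ {x} → m x < p
    a-m  : ∀ {x} → x < p → a (W + m x) ≡ x
    m-a  : ∀ {i} → i < p → m (a (W + i)) ≡ i

module _ {p q r lo hi : ℕ} (S : System p q r lo hi) {W : ℕ} (W-hi : W + p ≤ hi) where
  open System S

  private
    instance
      p≢0 : NonZero p
      p≢0 = >-nonZero (<⇒≤ 1<p)

    within : ∀ {i} → i < p → W + i < hi
    within i<p = <-≤-trans (+-monoʳ-< W i<p) W-hi

    m quot : ℕ → ℕ
    -- Modulo p every M is congruent to a M · qr, so a (W + i) = x means i ≡ (x - a W)·qr; p is
    -- added to keep the difference natural.
    m x    = ((x + (p ∸ a W)) * (q * r)) % p
    quot x = ((x + (p ∸ a W)) * (q * r)) / p

    m< : ∀ {x} → m x < p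
    m< = m%n<n _ p

    W<hi : W < hi
    W<hi = subst (_< hi) (+-identityʳ W) (within (<⇒≤ 1<p))

    a-m : ∀ {x} → x < p → a (W + m x) ≡ x
    a-m {x} x<p = sym (cancel-≡ p⊥qr
        (q * r + (b W * r + c W * q + q * r) + q * r * N (W + m x))
        (b (W + m x) * r + c (W + m x) * q + q * r + quot x + q * r * N W) x<p (a<p _)
      (equate ((a (W + m x)) ∷ q ∷ r ∷ (b (W + m x)) ∷ p ∷ (c (W + m x)) ∷ W ∷ (m x) ∷ (N (W + m x)) ∷ (a W) ∷ (b W) ∷
        (c W) ∷ (N W) ∷ x ∷ (p ∸ a W) ∷ (quot x) ∷ []) 1 (# 13 ⊗ (# 1 ⊗ # 2) ⊕ # 4 ⊗ (# 1 ⊗ # 2 ⊕ (# 10 ⊗ # 2 ⊕ # 11 ⊗ #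
        1 ⊕ # 1 ⊗ # 2) ⊕ # 1 ⊗ # 2 ⊗ # 8)) (# 0 ⊗ (# 1 ⊗ # 2) ⊕ # 4 ⊗ (# 3 ⊗ # 2 ⊕ # 5 ⊗ # 1 ⊕ # 1 ⊗ # 2 ⊕ # 15 ⊕ # 1 ⊗
        # 2 ⊗ # 12)) (# 6 ⊕ # 7 ⊕ # 4 ⊗ # 1 ⊗ # 2 ⊗ # 8 ≼ repᵉ 0 3 5 4 1 2 ∷ repᵉ 9 10 11 4 1 2 ≼ # 6 ⊕ # 4 ⊗ # 1 ⊗ # 2
        ⊗ # 12 ∷ (# 13 ⊕ # 14) ⊗ (# 1 ⊗ # 2) ≼ # 7 ⊕ # 15 ⊗ # 4 ∷ (# 1 ⊗ # 2 , # 4 , # 14 ⊕ # 9) ∷ []) refl (sym (rep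
        (within (m< {x}))) , rep (W<hi) , m≡m%n+[m/n]*n ((x + (p ∸ a W)) * (q * r)) p , sym (m∸n+n≡m (<⇒≤ (a<p W))) ,
        tt)))

    p⊥1 : Coprime p 1
    p⊥1 = Coprimality.sym (1-coprimeTo p)

    m-a : ∀ {i} → i < p → m (a (W + i)) ≡ i
    m-a {i} i<p = sym (cancel-≡ p⊥1
        (q * r * N (W + i) + b (W + j) * r + c (W + j) * q + q * r)
        (q * r * N (W + j) + b (W + i) * r + c (W + i) * q + q * r) i<p (m< {a (W + i)})
      (equate ((a (W + i)) ∷ q ∷ r ∷ (b (W + i)) ∷ p ∷ (c (W + i)) ∷ W ∷ i ∷ (N (W + i)) ∷ (a (W + j)) ∷ (b (W + j)) ∷
        (c (W + j)) ∷ j ∷ (N (W + j)) ∷ []) 1 (# 7 ⊗ ‵ 1 ⊕ # 4 ⊗ (# 1 ⊗ # 2 ⊗ # 8 ⊕ # 10 ⊗ # 2 ⊕ # 11 ⊗ # 1 ⊕ # 1 ⊗ #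
        2)) (# 12 ⊗ ‵ 1 ⊕ # 4 ⊗ (# 1 ⊗ # 2 ⊗ # 13 ⊕ # 3 ⊗ # 2 ⊕ # 5 ⊗ # 1 ⊕ # 1 ⊗ # 2)) (# 6 ⊕ # 7 ⊕ # 4 ⊗ # 1 ⊗ # 2 ⊗ #
        8 ≼ repᵉ 0 3 5 4 1 2 ∷ repᵉ 9 10 11 4 1 2 ≼ # 6 ⊕ # 12 ⊕ # 4 ⊗ # 1 ⊗ # 2 ⊗ # 13 ∷ (# 1 ⊗ # 2 , # 0 , # 9) ∷ [])
        refl (sym (rep (within i<p)) , rep (within (m< {a (W + i)})) , sym (a-m (a<p (W + i))) , tt)))
      where j = m (a (W + i))

  enumeration : Enumeration S W
  enumeration = record { W-hi = W-hi ; m = m ; m< = λ {x} → m< {x} ; a-m = a-m ; m-a = m-a }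

module Enumerated {p q r lo hi : ℕ} (S : System p q r lo hi) {W : ℕ} (E : Enumeration S W) where
  open System S
  open Enumeration E

  Nₓ bₓ cₓ : ℕ → ℕ
  Nₓ x = N (W + m x)
  bₓ x = b (W + m x)
  cₓ x = c (W + m x)

  sum-m : ∀ f → sum (λ x → f (m x)) p ≡ sum f p
  sum-m f = sum-permute f m (λ i → a (W + i)) p (λ _ → m<) (λ _ → a<p _) a-m m-a

  rep-m : ∀ {x} → x < p → x * (q * r) + bₓ x * (p * r) + cₓ x * (p * q) + p * q * r ≡ W + m x + p * q * r * Nₓ x
  rep-m {x} x<p = subst (λ y → y * (q * r) + bₓ x * (p * r) + cₓ x * (p * q) + p * q * r ≡ W + m x + p * q * r * Nₓ x)
    (a-m x<p) (rep (<-≤-trans (+-monoʳ-< W m<) W-hi))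

  residue : ∀ {x} → x < p → ∃₂ λ s t → W + m x + p * s ≡ x * (q * r) + p * t
  residue {x} x<p = q * r * Nₓ x , bₓ x * r + cₓ x * q + q * r ,
    (equate (x ∷ q ∷ r ∷ (bₓ x) ∷ p ∷ (cₓ x) ∷ W ∷ (m x) ∷ (Nₓ x) ∷ []) 1 (# 6 ⊕ # 7 ⊕ # 4 ⊗ (# 1 ⊗ # 2 ⊗ # 8)) (# 0 ⊗
      (# 1 ⊗ # 2) ⊕ # 4 ⊗ (# 3 ⊗ # 2 ⊕ # 5 ⊗ # 1 ⊕ # 1 ⊗ # 2)) (# 6 ⊕ # 7 ⊕ # 4 ⊗ # 1 ⊗ # 2 ⊗ # 8 ≼ repᵉ 0 3 5 4 1 2 ∷
      []) refl (sym (rep-m x<p) , tt))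

  -- By `residue` the position is an affine function of x modulo p, so additive relations between
  -- residues pass to positions, all of which are below p.
  m-near : ∀ {x y z w} → x < p → y < p → z < p → w < p → x + y ≡ z + w ⊎ x + p + y ≡ z + w → Near p (m x + m y) (m z + m w)
  m-near {x} {y} {z} {w} x<p y<p z<p w<p e =
    go (residue x<p) (residue y<p) (residue z<p) (residue w<p)
      ([ (λ e → 0 , trans (cong (_+ y) (+-identityʳ x)) e) , (λ e → 1 , trans (cong (λ u → x + u + y) (*-identityˡ p)) e) ]′ e)
    where
    Residue : ℕ → Set
    Residue x = ∃₂ λ s t → W + m x + p * s ≡ x * (q * r) + p * t
    go : Residue x → Residue y → Residue z → Residue w → (∃ λ l → x + l * p + y ≡ z + w) → Near p (m x + m y) (m z + m w)
    go (s₁ , t₁ , E₁) (s₂ , t₂ , E₂) (s₃ , t₃ , E₃) (s₄ , t₄ , E₄) (l , off) =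
      cancel-near (Coprimality.sym (1-coprimeTo p)) (s₁ + s₂ + t₃ + t₄ + l * (q * r)) (s₃ + s₄ + t₁ + t₂) (+-mono-< m< m<) (+-mono-< m< m<)
      (equate (W ∷ (m x) ∷ p ∷ s₁ ∷ x ∷ q ∷ r ∷ t₁ ∷ (m y) ∷ s₂ ∷ y ∷ t₂ ∷ (m z) ∷ s₃ ∷ z ∷ t₃ ∷ (m w) ∷ s₄ ∷ w ∷ t₄ ∷ l
        ∷ []) 1 ((# 1 ⊕ # 8) ⊗ ‵ 1 ⊕ # 2 ⊗ (# 3 ⊕ # 9 ⊕ # 15 ⊕ # 19 ⊕ # 20 ⊗ (# 5 ⊗ # 6))) ((# 12 ⊕ # 16) ⊗ ‵ 1 ⊕ # 2 ⊗
        (# 13 ⊕ # 17 ⊕ # 7 ⊕ # 11)) (# 0 ⊕ # 1 ⊕ # 2 ⊗ # 3 ≼ # 4 ⊗ (# 5 ⊗ # 6) ⊕ # 2 ⊗ # 7 ∷ # 0 ⊕ # 8 ⊕ # 2 ⊗ # 9 ≼ #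
        10 ⊗ (# 5 ⊗ # 6) ⊕ # 2 ⊗ # 11 ∷ # 14 ⊗ (# 5 ⊗ # 6) ⊕ # 2 ⊗ # 15 ≼ # 0 ⊕ # 12 ⊕ # 2 ⊗ # 13 ∷ # 18 ⊗ (# 5 ⊗ # 6) ⊕
        # 2 ⊗ # 19 ≼ # 0 ⊕ # 16 ⊕ # 2 ⊗ # 17 ∷ (# 5 ⊗ # 6 , # 4 ⊕ # 20 ⊗ # 2 ⊕ # 10 , # 14 ⊕ # 18) ∷ []) refl (E₁ , E₂ ,
        sym E₃ , sym E₄ , off , tt))

  module _ {x y z w : ℕ} (x<p : x < p) (y<p : y < p) (z<p : z < p) (w<p : w < p) (eᵐ : m x + m y ≡ m z + m w) where

    -- When the representations at x and y are compared with those at z and w, the values of M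
    -- cancel, and modulo q only the b terms survive.
    b-near : Near q (bₓ x + bₓ y) (bₓ z + bₓ w)
    b-near = cancel-near q⊥pr ((x + y) * r + (cₓ x + cₓ y) * p + p * r * (Nₓ z + Nₓ w))
                              ((z + w) * r + (cₓ z + cₓ w) * p + p * r * (Nₓ x + Nₓ y))
      (+-mono-< (b<q _) (b<q _)) (+-mono-< (b<q _) (b<q _))
      (equate (x ∷ q ∷ r ∷ (bₓ x) ∷ p ∷ (cₓ x) ∷ W ∷ (m x) ∷ (Nₓ x) ∷ y ∷ (bₓ y) ∷ (cₓ y) ∷ (m y) ∷ (Nₓ y) ∷ z ∷ (bₓ z)
        ∷ (cₓ z) ∷ (m z) ∷ (Nₓ z) ∷ w ∷ (bₓ w) ∷ (cₓ w) ∷ (m w) ∷ (Nₓ w) ∷ []) 1 ((# 3 ⊕ # 10) ⊗ (# 4 ⊗ # 2) ⊕ # 1 ⊗ ((#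
        0 ⊕ # 9) ⊗ # 2 ⊕ (# 5 ⊕ # 11) ⊗ # 4 ⊕ # 4 ⊗ # 2 ⊗ (# 18 ⊕ # 23))) ((# 15 ⊕ # 20) ⊗ (# 4 ⊗ # 2) ⊕ # 1 ⊗ ((# 14 ⊕
        # 19) ⊗ # 2 ⊕ (# 16 ⊕ # 21) ⊗ # 4 ⊕ # 4 ⊗ # 2 ⊗ (# 8 ⊕ # 13))) (repᵉ 0 3 5 4 1 2 ≼ # 6 ⊕ # 7 ⊕ # 4 ⊗ # 1 ⊗ # 2 ⊗
        # 8 ∷ repᵉ 9 10 11 4 1 2 ≼ # 6 ⊕ # 12 ⊕ # 4 ⊗ # 1 ⊗ # 2 ⊗ # 13 ∷ # 6 ⊕ # 17 ⊕ # 4 ⊗ # 1 ⊗ # 2 ⊗ # 18 ≼ repᵉ 14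
        15 16 4 1 2 ∷ # 6 ⊕ # 22 ⊕ # 4 ⊗ # 1 ⊗ # 2 ⊗ # 23 ≼ repᵉ 19 20 21 4 1 2 ∷ # 7 ⊕ # 12 ≼ # 17 ⊕ # 22 ∷ []) refl
        (rep-m x<p , rep-m y<p , sym (rep-m z<p) , sym (rep-m w<p) , eᵐ , tt))

    c-near : Near r (cₓ x + cₓ y) (cₓ z + cₓ w)
    c-near = cancel-near r⊥pq ((x + y) * q + (bₓ x + bₓ y) * p + p * q * (Nₓ z + Nₓ w))
                              ((z + w) * q + (bₓ z + bₓ w) * p + p * q * (Nₓ x + Nₓ y))
      (+-mono-< (c<r _) (c<r _)) (+-mono-< (c<r _) (c<r _))
      (equate (x ∷ q ∷ r ∷ (bₓ x) ∷ p ∷ (cₓ x) ∷ W ∷ (m x) ∷ (Nₓ x) ∷ y ∷ (bₓ y) ∷ (cₓ y) ∷ (m y) ∷ (Nₓ y) ∷ z ∷ (bₓ z)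
        ∷ (cₓ z) ∷ (m z) ∷ (Nₓ z) ∷ w ∷ (bₓ w) ∷ (cₓ w) ∷ (m w) ∷ (Nₓ w) ∷ []) 1 ((# 5 ⊕ # 11) ⊗ (# 4 ⊗ # 1) ⊕ # 2 ⊗ ((#
        0 ⊕ # 9) ⊗ # 1 ⊕ (# 3 ⊕ # 10) ⊗ # 4 ⊕ # 4 ⊗ # 1 ⊗ (# 18 ⊕ # 23))) ((# 16 ⊕ # 21) ⊗ (# 4 ⊗ # 1) ⊕ # 2 ⊗ ((# 14 ⊕
        # 19) ⊗ # 1 ⊕ (# 15 ⊕ # 20) ⊗ # 4 ⊕ # 4 ⊗ # 1 ⊗ (# 8 ⊕ # 13))) (repᵉ 0 3 5 4 1 2 ≼ # 6 ⊕ # 7 ⊕ # 4 ⊗ # 1 ⊗ # 2 ⊗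
        # 8 ∷ repᵉ 9 10 11 4 1 2 ≼ # 6 ⊕ # 12 ⊕ # 4 ⊗ # 1 ⊗ # 2 ⊗ # 13 ∷ # 6 ⊕ # 17 ⊕ # 4 ⊗ # 1 ⊗ # 2 ⊗ # 18 ≼ repᵉ 14
        15 16 4 1 2 ∷ # 6 ⊕ # 22 ⊕ # 4 ⊗ # 1 ⊗ # 2 ⊗ # 23 ≼ repᵉ 19 20 21 4 1 2 ∷ # 7 ⊕ # 12 ≼ # 17 ⊕ # 22 ∷ []) refl
        (rep-m x<p , rep-m y<p , sym (rep-m z<p) , sym (rep-m w<p) , eᵐ , tt))

    -- A comparison of multiples of pqr: l is the wrap in a, i and j are the carries in b and c, and
    -- what they transport must be balanced by `N`.
    exchange : ∀ l → x + l * p + y ≡ z + w →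
      ∃₂ λ i i′ → ∃₂ λ j j′ → Carry q (bₓ x + bₓ y) (bₓ z + bₓ w) i i′ × Carry r (cₓ x + cₓ y) (cₓ z + cₓ w) j j′ ×
        Nₓ x + Nₓ y + l + i + j ≡ Nₓ z + Nₓ w + i′ + j′
    exchange l e = go (carry b-near) (carry c-near)
      where
      go : ∃₂ (Carry q (bₓ x + bₓ y) (bₓ z + bₓ w)) → ∃₂ (Carry r (cₓ x + cₓ y) (cₓ z + cₓ w)) → _
      go (i , i′ , C₁) (j , j′ , C₂) = i , i′ , j , j′ , C₁ , C₂ ,
        *-cancelˡ-≡ _ _ (p * q * r) {{>-nonZero (entail (p ∷ q ∷ r ∷ []) (‵ 1) (‵ 1 ⊕ ‵ 0) (# 0 ⊗ # 1 ⊗ # 2) ((# 1 ⊗ # 2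
          , ‵ 1 ⊕ ‵ 1 , # 0) ∷ (‵ 2 ⊗ # 2 , ‵ 1 ⊕ ‵ 1 , # 1) ∷ (‵ 4 , ‵ 1 ⊕ ‵ 1 , # 2) ∷ []) refl (1<p , 1<q , 1<r ,
          tt))}}
        (equate (x ∷ q ∷ r ∷ (bₓ x) ∷ p ∷ (cₓ x) ∷ W ∷ (m x) ∷ (Nₓ x) ∷ y ∷ (bₓ y) ∷ (cₓ y) ∷ (m y) ∷ (Nₓ y) ∷ z ∷ (bₓ
          z) ∷ (cₓ z) ∷ (m z) ∷ (Nₓ z) ∷ w ∷ (bₓ w) ∷ (cₓ w) ∷ (m w) ∷ (Nₓ w) ∷ l ∷ i ∷ i′ ∷ j ∷ j′ ∷ []) 1 (# 4 ⊗ # 1 ⊗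
          # 2 ⊗ (# 8 ⊕ # 13 ⊕ # 24 ⊕ # 25 ⊕ # 27)) (# 4 ⊗ # 1 ⊗ # 2 ⊗ (# 18 ⊕ # 23 ⊕ # 26 ⊕ # 28)) (# 6 ⊕ # 7 ⊕ # 4 ⊗ #
          1 ⊗ # 2 ⊗ # 8 ≼ repᵉ 0 3 5 4 1 2 ∷ # 6 ⊕ # 12 ⊕ # 4 ⊗ # 1 ⊗ # 2 ⊗ # 13 ≼ repᵉ 9 10 11 4 1 2 ∷ repᵉ 14 15 16 4
          1 2 ≼ # 6 ⊕ # 17 ⊕ # 4 ⊗ # 1 ⊗ # 2 ⊗ # 18 ∷ repᵉ 19 20 21 4 1 2 ≼ # 6 ⊕ # 22 ⊕ # 4 ⊗ # 1 ⊗ # 2 ⊗ # 23 ∷ # 17 ⊕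
          # 22 ≼ # 7 ⊕ # 12 ∷ (# 1 ⊗ # 2 , # 0 ⊕ # 24 ⊗ # 4 ⊕ # 9 , # 14 ⊕ # 19) ∷ (# 4 ⊗ # 2 , # 3 ⊕ # 10 ⊕ # 25 ⊗ # 1
          , # 15 ⊕ # 20 ⊕ # 26 ⊗ # 1) ∷ (# 4 ⊗ # 1 , # 5 ⊕ # 11 ⊕ # 27 ⊗ # 2 , # 16 ⊕ # 21 ⊕ # 28 ⊗ # 2) ∷ []) refl (sym
          (rep-m x<p) , sym (rep-m y<p) , rep-m z<p , rep-m w<p , sym eᵐ , e , carry-≡ C₁ , carry-≡ C₂ , tt))

-- From coordinates to a configuration

unit-≥ : ∀ {p q α B e⁺ e⁻} → Unit p q α B e⁺ e⁻ → p * q ≤ α * q + B * p + 1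
unit-≥ {p} {q} {α} {B} {e⁺} {e⁻} U = (entail (α ∷ q ∷ B ∷ p ∷ e⁻ ∷ e⁺ ∷ []) (‵ 1) (# 3 ⊗ # 1) (# 0 ⊗ # 1 ⊕ # 2 ⊗ # 3 ⊕ ‵
  1) (# 3 ⊗ # 1 ⊕ # 5 ≼ # 0 ⊗ # 1 ⊕ # 2 ⊗ # 3 ⊕ # 4 ∷ # 4 ≼ ‵ 1 ∷ []) refl (≤-reflexive (sym (Unit.α-B U)) , Unit.e⁻≤1 U
  , tt))

module _ {p q r lo hi α β B C e⁺ e⁻ f⁺ f⁻ : ℕ} (S : System p q r lo hi)
  (U : Unit p q α B e⁺ e⁻) (V : Unit p r β C f⁺ f⁻) (Ws : Windows p q r lo hi e⁺ e⁻ f⁺ f⁻)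
  (pp : Prime p) (p≤q : p ≤ q) (p≤r : p ≤ r) (0<α : 0 < α) (α≤β : α ≤ β) (2β≤p : β + β ≤ p) where

  open System S
  open Windows Ws

  pos neg : ℕ → ℕ
  pos i = χ (N (W + i)) + χ (N (W₁₂ + i))
  neg i = χ (N (W₁ + i)) + χ (N (W₂ + i))

  private
    E : Enumeration S W
    E = enumeration S W-hi

    open Enumeration E using (m; m<; a-m)
    open Enumerated S E

    Low Wrap High : ℕ → Set
    Low x  = Nₓ x ≡ 0
    Wrap x = x < p × Nₓ x ≡ 1 × B ≤ bₓ x × C ≤ cₓ x
    High x = x < p × Nₓ x ≡ 2 × B ≤ bₓ x × C ≤ cₓ x

    Outcome : ℕ → ℕ → Set → Set
    Outcome x bound G = Graded bound G (pos (m x)) (neg (m x))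

    shift-slide : ∀ {V V′ k l i} → V′ + k ≡ V + l → V′ + i + k ≡ V + i + l
    shift-slide {V} {V′} {k} {l} {i} e = (equate (V′ ∷ k ∷ V ∷ l ∷ i ∷ []) 1 (# 0 ⊕ # 4 ⊕ # 1) (# 2 ⊕ # 4 ⊕ # 3) (# 0 ⊕
      # 1 ≼ # 2 ⊕ # 3 ∷ []) refl (e , tt))

    module _ {x : ℕ} (x<p : x < p) where
      i = m x
      M<   = <-≤-trans (+-monoʳ-< W (m< {x})) W-hi
      M₁<  = <-≤-trans (+-monoʳ-< W₁ (m< {x})) W₁-hi
      M₂<  = <-≤-trans (+-monoʳ-< W₂ (m< {x})) W₂-hi
      M₁₂< = <-≤-trans (+-monoʳ-< W₁₂ (m< {x})) W₁₂-hi

      S₁ : Shift S U (W + i) (W₁ + i)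
      S₁ = shifted S U M< M₁< (shift-slide {W} {W₁} {e⁺ * r} {e⁻ * r} {i} W₁-r)
      S₂ : Shift (swap S) V (W + i) (W₂ + i)
      S₂ = shifted (swap S) V M< M₂< (shift-slide {W} {W₂} {f⁺ * q} {f⁻ * q} {i} W₂-q)
      S₁₂ : Shift (swap S) V (W₁ + i) (W₁₂ + i)
      S₁₂ = shifted (swap S) V M₁< M₁₂< (shift-slide {W₁} {W₁₂} {f⁺ * q} {f⁻ * q} {i} W₁₂-q)

      record Corners (s s′ s₁₂ t u : ℕ) : Set where
        field
          N≤   : Nₓ x ≤ 2
          s-x  : ∃ λ y → Borrow x α p y s × Borrow y β p (a (W₁₂ + i)) s₁₂
          s′-x : ∃ λ y → Borrow x β p y s′
          bt   : Bit t
          bu   : Bit u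
          b-t0 : t ≡ 0 → B ≤ bₓ x
          b-t1 : t ≡ 1 → bₓ x < B
          c-u0 : u ≡ 0 → C ≤ cₓ x
          c-u1 : u ≡ 1 → cₓ x < C
          N₁   : 1 + N (W₁ + i) ≡ Nₓ x + s + t
          N₂   : 1 + N (W₂ + i) ≡ Nₓ x + s′ + u
          N₁₂  : 1 + N (W₁₂ + i) ≡ N (W₁ + i) + s₁₂ + u

      corners : ∃₂ λ s s′ → ∃₂ λ s₁₂ t → ∃ λ u → Corners s s′ s₁₂ t u
      corners = s S₁ , s S₂ , s S₁₂ , t S₁ , t S₂ , record
        { N≤ = N≤2 (≤-trans lo≤W (m≤m+n W i)) M<
        ; s-x = a (W₁ + i) , subst (λ y → Borrow y α p (a (W₁ + i)) (s S₁)) (a-m x<p) (s-a S₁) , s-a S₁₂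
        ; s′-x = a (W₂ + i) , subst (λ y → Borrow y β p (a (W₂ + i)) (s S₂)) (a-m x<p) (s-a S₂)
        ; bt = bit (t-b S₁) ; bu = bit (t-b S₂)
        ; b-t0 = borrow-0 (t-b S₁) ; b-t1 = borrow-1 (t-b S₁)
        ; c-u0 = borrow-0 (t-b S₂) ; c-u1 = borrow-1 (t-b S₂)
        ; N₁ = N≡ S₁ ; N₂ = N≡ S₂
        -- The shift by r leaves c alone, so the shift by q borrows from c in the same way before
        -- and after it; one bit serves both.
        ; N₁₂ = trans (N≡ S₁₂) (cong (N (W₁ + i) + s S₁₂ +_)
            (borrow-unique (subst (λ y → Borrow y C r (c (W₁₂ + i)) (t S₁₂)) (c≡ S₁) (t-b S₁₂)) (t-b S₂))) }
        where open Shift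

      open Corners

      map-grade : ∀ {bound} {G G′ : Set} → (G → G′) → Outcome x bound G → Outcome x bound G′
      map-grade f (good e g) = good e (f g)
      map-grade f (bad e)    = bad e

      zone-A : x < α → Outcome x 1 (Low x ⊎ Wrap x)
      zone-A x<α = case corners of λ { (s , s′ , s₁₂ , t , u , K) →
        case s-x K of λ { (y , B₁ , B₁₂) → case borrow-< B₁ x<α of λ { (refl , e) →
        case borrow-< (proj₂ (s′-x K)) (<-≤-trans x<α α≤β) of λ { (refl , _) →
        -- After the borrow y = x + p - α, and α ≤ β with 2β ≤ p puts this at or above β.
        case borrow-≥ B₁₂ (entail (y ∷ α ∷ x ∷ p ∷ β ∷ []) (‵ 1) (# 4) (# 0) (# 2 ⊕ # 3 ≼ # 0 ⊕ # 1 ∷ # 4 ⊕ # 4 ≼ # 3 ∷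
          # 1 ≼ # 4 ∷ []) refl (≤-reflexive (sym e) , 2β≤p , α≤β , tt)) of λ { (refl , _) →
        map-grade (λ { (inj₁ l) → inj₁ l ; (inj₂ (N≡1 , t≡0 , u≡0)) → inj₂ (x<p , N≡1 , b-t0 K t≡0 , c-u0 K u≡0) })
          (grade-A (bt K) (bu K) (N≤ K) (N₁ K) (N₂ K) (N₁₂ K)) } } } } }

      zone-AN : α ≤ x → x < β → Outcome x 0 ⊤
      zone-AN α≤x x<β = case corners of λ { (s , s′ , s₁₂ , t , u , K) →
        case s-x K of λ { (y , B₁ , B₁₂) → case borrow-≥ B₁ α≤x of λ { (refl , e) →
        case borrow-< (proj₂ (s′-x K)) x<β of λ { (refl , _) →
        case borrow-< B₁₂ (entail (y ∷ α ∷ x ∷ β ∷ []) (‵ 1) (‵ 1 ⊕ # 0) (# 3) (# 0 ⊕ # 1 ≼ # 2 ∷ # 2 ≺ # 3 ∷ []) refl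
          (≤-reflexive e , x<β , tt)) of λ { (refl , _) →
        grade-AN (bt K) (bu K) (N≤ K) (N₁ K) (N₂ K) (N₁₂ K) } } } } }

      zone-N : β ≤ x → x < α + β → Outcome x 0 (Nₓ x ≡ 2 ⊎ (Nₓ x ≡ 1 × bₓ x < B × cₓ x < C))
      zone-N β≤x x<α+β = case corners of λ { (s , s′ , s₁₂ , t , u , K) →
        case s-x K of λ { (y , B₁ , B₁₂) → case borrow-≥ B₁ (≤-trans α≤β β≤x) of λ { (refl , e) →
        case borrow-≥ (proj₂ (s′-x K)) β≤x of λ { (refl , _) →
        case borrow-< B₁₂ (entail (y ∷ α ∷ x ∷ β ∷ []) (‵ 1) (‵ 1 ⊕ # 0) (# 3) (# 0 ⊕ # 1 ≼ # 2 ∷ # 2 ≺ # 1 ⊕ # 3 ∷ [])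
          refl (≤-reflexive e , x<α+β , tt)) of λ { (refl , _) →
        map-grade (λ { (inj₁ l) → inj₁ l ; (inj₂ (N≡1 , t≡1 , u≡1)) → inj₂ (N≡1 , b-t1 K t≡1 , c-u1 K u≡1) })
          (grade-N (bt K) (bu K) (N≤ K) (N₁ K) (N₂ K) (N₁₂ K)) } } } } }

      zone-B : α + β ≤ x → Outcome x 1 (High x)
      zone-B α+β≤x = case corners of λ { (s , s′ , s₁₂ , t , u , K) →
        case s-x K of λ { (y , B₁ , B₁₂) → case borrow-≥ B₁ (≤-trans (m≤m+n α β) α+β≤x) of λ { (refl , e) →
        case borrow-≥ (proj₂ (s′-x K)) (≤-trans (m≤n+m β α) α+β≤x) of λ { (refl , _) →
        case borrow-≥ B₁₂ (entail (y ∷ α ∷ x ∷ β ∷ []) (‵ 1) (# 3) (# 0) (# 2 ≼ # 0 ⊕ # 1 ∷ # 1 ⊕ # 3 ≼ # 2 ∷ []) refl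
          (≤-reflexive (sym e) , α+β≤x , tt)) of λ { (refl , _) →
        map-grade (λ { (N≡2 , t≡0 , u≡0) → x<p , N≡2 , b-t0 K t≡0 , c-u0 K u≡0 })
          (grade-B (bt K) (bu K) (N≤ K) (N₁ K) (N₂ K) (N₁₂ K)) } } } } }

    bound def : ℕ → ℕ
    bound x with x <? α | x <? α + β
    ... | yes _ | _     = 1
    ... | no _  | yes _ = 0
    ... | no _  | no _  = 1
    -- The subtraction does not truncate, by `outcome-≤`.
    def x = bound x + neg (m x) ∸ pos (m x)

    bound-A : ∀ {x} → x < α → bound x ≡ 1
    bound-A {x} x<α with x <? α
    ... | yes _  = refl
    ... | no x≮α = ⊥-elim (x≮α x<α)

    bound-N : ∀ {x} → α ≤ x → x < α + β → bound x ≡ 0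
    bound-N {x} α≤x x< with x <? α | x <? α + β
    ... | yes x<α | _      = ⊥-elim (<⇒≱ x<α α≤x)
    ... | no _    | yes _  = refl
    ... | no _    | no x≮  = ⊥-elim (x≮ x<)

    bound-B : ∀ {x} → α + β ≤ x → bound x ≡ 1
    bound-B {x} le with x <? α | x <? α + β
    ... | yes _ | _      = refl
    ... | no _  | yes x< = ⊥-elim (<⇒≱ x< le)
    ... | no _  | no _   = refl

    graded-≤ : ∀ {n G i j} → Graded n G i j → i ≤ n + j × n + j ≤ 1 + i
    graded-≤ (good e _) = ≤-reflexive e , ≤-trans (≤-reflexive (sym e)) (n≤1+n _)
    graded-≤ (bad e)     = ≤-trans (n≤1+n _) (≤-reflexive e) , ≤-reflexive (sym e)

    graded-0 : ∀ {n G i j} → Graded n G i j → n + j ∸ i ≡ 0 → G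
    graded-0 (good _ g) _ = g
    graded-0 {n} {G} {i} {j} (bad e) z = ⊥-elim (1+n≢0 (trans (sym (m+n∸n≡m 1 i)) (trans (cong (_∸ i) e) z)))

    def-0 : ∀ {x n G} → bound x ≡ n → Outcome x n G → def x ≡ 0 → G
    def-0 {x} refl g z = graded-0 g z

    outcome-≤ : ∀ {x} → x < p → pos (m x) ≤ bound x + neg (m x) × bound x + neg (m x) ≤ 1 + pos (m x)
    outcome-≤ {x} x<p with x <? α | x <? β | x <? α + β
    ... | yes x<α | _       | _      = graded-≤ (zone-A x<p x<α)
    ... | no x≮α  | yes x<β | yes _  = graded-≤ (zone-AN x<p (≮⇒≥ x≮α) x<β)
    ... | no x≮α  | yes x<β | no x≮  = ⊥-elim (x≮ (<-≤-trans x<β (m≤n+m β α)))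
    ... | no _    | no x≮β  | yes x< = graded-≤ (zone-N x<p (≮⇒≥ x≮β) x<)
    ... | no _    | no x≮β  | no x≮  = graded-≤ (zone-B x<p (≮⇒≥ x≮))

    sum-bound : sum bound p + β ≡ p
    sum-bound = (equate ((sum bound p) ∷ (sum bound (α + β + rest)) ∷ (sum bound (α + β)) ∷ (interval bound (α + β)
      rest) ∷ (sum bound α) ∷ (interval bound α β) ∷ α ∷ β ∷ rest ∷ p ∷ []) 1 (# 0 ⊕ # 7) (# 9) (# 0 ≼ # 1 ∷ # 1 ≼ # 2 ⊕
      # 3 ∷ # 2 ≼ # 4 ⊕ # 5 ∷ # 4 ≼ # 6 ⊗ ‵ 1 ∷ # 5 ≼ # 7 ⊗ ‵ 0 ∷ # 3 ≼ # 8 ⊗ ‵ 1 ∷ # 6 ⊕ # 7 ⊕ # 8 ≼ # 9 ∷ []) refl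
      (cong (sum bound) p≡ , sum-split bound (α + β) rest , sum-split bound α β , sum-const 1 α bound-A , sum-const 0 β
      (λ {i} i<β → bound-N (m≤m+n α i) (+-monoʳ-< α i<β)) , sum-const 1 rest (λ {i} _ → bound-B (m≤m+n (α + β) i)) , sym
      p≡ , tt))
      where
      rest = p ∸ (α + β)
      p≡ : p ≡ α + β + rest
      p≡ = sym (m+[n∸m]≡n (entail (β ∷ p ∷ α ∷ []) (‵ 1) (# 2 ⊕ # 0) (# 1) (# 0 ⊕ # 0 ≼ # 1 ∷ # 2 ≼ # 0 ∷ []) refl (2β≤p
        , α≤β , tt)))

    sum-def : sum def p ≤ p
    sum-def = subst (sum def p ≤_) (trans (sum-const {λ _ → 1} 1 p (λ _ → refl)) (*-identityʳ p))
      (sum-mono-≤ p λ {x} x<p → m≤n+o⇒m∸n≤o (bound x + neg (m x)) (pos (m x))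
        (subst (bound x + neg (m x) ≤_) (+-comm 1 (pos (m x))) (proj₂ (outcome-≤ x<p))))
      where
      sum-mono-≤ : ∀ {f g} n → (∀ {i} → i < n → f i ≤ g i) → sum f n ≤ sum g n
      sum-mono-≤ zero    le = z≤n
      sum-mono-≤ (suc n) le = +-mono-≤ (sum-mono-≤ n (λ i<n → le (m<n⇒m<1+n i<n))) (le ≤-refl)

    total : sum pos p + sum def p + β ≡ p + sum neg p
    total = (equate ((sum (λ x → pos (m x)) p) ∷ (sum pos p) ∷ (sum (λ x → neg (m x)) p) ∷ (sum neg p) ∷ (sum bound p) ∷
      β ∷ p ∷ (sum (λ x → pos (m x) + def x) p) ∷ (sum def p) ∷ (sum (λ x → bound x + neg (m x)) p) ∷ []) 1 (# 1 ⊕ # 8 ⊕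
      # 5) (# 6 ⊕ # 3) (# 1 ≼ # 0 ∷ # 2 ≼ # 3 ∷ # 4 ⊕ # 5 ≼ # 6 ∷ # 0 ⊕ # 8 ≼ # 7 ∷ # 9 ≼ # 4 ⊕ # 2 ∷ # 7 ≼ # 9 ∷ [])
      refl (sym (sum-m pos) , sum-m neg , sum-bound , sym (sum-+ (λ x → pos (m x)) def p) , sum-+ bound (λ x → neg (m
      x)) p , sum-cong-< p (λ x<p → m+[n∸m]≡n (proj₁ (outcome-≤ x<p))) , tt))

    -- Since N = 2 at both, (x - y)qr consists of the differences in b, in c and in position. The
    -- first two are less than (q - B)pr and (r - C)pq, which by `unit-≥` are at most αqr + r and
    -- βqr + q; the strictness of b < q and c < r absorbs r, q and the position.
    spread : ∀ {x y} → High x → High y → x < y + (α + β)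
    spread {x} {y} (x<p , Nx , Bx , Cx) (y<p , Ny , By , Cy) =
      (entail (x ∷ q ∷ r ∷ (bₓ x) ∷ p ∷ (cₓ x) ∷ W ∷ (m x) ∷ (Nₓ x) ∷ y ∷ (bₓ y) ∷ (cₓ y) ∷ (m y) ∷ (Nₓ y) ∷ B ∷ C ∷ α ∷
        β ∷ []) (‵ 2 ⊗ (# 1 ⊗ # 2)) (‵ 1 ⊕ # 0) (# 9 ⊕ (# 16 ⊕ # 17)) ((‵ 2 , repᵉ 0 3 5 4 1 2 , # 6 ⊕ # 7 ⊕ # 4 ⊗ # 1 ⊗
        # 2 ⊗ # 8) ∷ (‵ 2 , # 6 ⊕ # 12 ⊕ # 4 ⊗ # 1 ⊗ # 2 ⊗ # 13 , repᵉ 9 10 11 4 1 2) ∷ (‵ 2 ⊗ (# 4 ⊗ # 1 ⊗ # 2) , # 8 ,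
        ‵ 2) ∷ (‵ 2 ⊗ (# 4 ⊗ # 1 ⊗ # 2) , ‵ 2 , # 13) ∷ (‵ 2 ⊗ (# 4 ⊗ # 2) , # 14 , # 3) ∷ (‵ 2 ⊗ (# 4 ⊗ # 1) , # 15 , #
        5) ∷ (‵ 2 ⊗ (# 4 ⊗ # 2) , ‵ 1 ⊕ # 10 , # 1) ∷ (‵ 2 ⊗ (# 4 ⊗ # 1) , ‵ 1 ⊕ # 11 , # 2) ∷ (‵ 2 ⊗ # 2 , # 4 ⊗ # 1 ,
        # 16 ⊗ # 1 ⊕ # 14 ⊗ # 4 ⊕ ‵ 1) ∷ (‵ 2 ⊗ # 1 , # 4 ⊗ # 2 , # 17 ⊗ # 2 ⊕ # 15 ⊗ # 4 ⊕ ‵ 1) ∷ (‵ 2 , ‵ 1 ⊕ # 7 , #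
        4) ∷ (‵ 2 , # 4 , # 1) ∷ (# 2 , ‵ 1 ⊕ ‵ 1 , # 4) ∷ (‵ 2 ⊗ # 1 , ‵ 1 ⊕ ‵ 1 , # 4) ∷ []) refl (≤-reflexive (rep-m
        x<p) , ≤-reflexive (sym (rep-m y<p)) , ≤-reflexive Nx , ≤-reflexive (sym Ny) , Bx , Cx , b<q _ , c<r _ , unit-≥
        U , unit-≥ V , m< {x} , p≤q , 1<p , 1<p , tt))

    -- The argument of `spread`; N = 1 instead of 2 at x costs one pqr, which is p in the coordinate
    -- a.
    spread′ : ∀ {x y} → Wrap x → High y → x + p < y + (α + β)
    spread′ {x} {y} (x<p , Nx , Bx , Cx) (y<p , Ny , By , Cy) =
      (entail (x ∷ q ∷ r ∷ (bₓ x) ∷ p ∷ (cₓ x) ∷ W ∷ (m x) ∷ (Nₓ x) ∷ y ∷ (bₓ y) ∷ (cₓ y) ∷ (m y) ∷ (Nₓ y) ∷ B ∷ C ∷ α ∷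
        β ∷ []) (‵ 2 ⊗ (# 1 ⊗ # 2)) (‵ 1 ⊕ (# 0 ⊕ # 4)) (# 9 ⊕ (# 16 ⊕ # 17)) ((‵ 2 , repᵉ 0 3 5 4 1 2 , # 6 ⊕ # 7 ⊕ # 4
        ⊗ # 1 ⊗ # 2 ⊗ # 8) ∷ (‵ 2 , # 6 ⊕ # 12 ⊕ # 4 ⊗ # 1 ⊗ # 2 ⊗ # 13 , repᵉ 9 10 11 4 1 2) ∷ (‵ 2 ⊗ (# 4 ⊗ # 1 ⊗ # 2)
        , # 8 , ‵ 1) ∷ (‵ 2 ⊗ (# 4 ⊗ # 1 ⊗ # 2) , ‵ 2 , # 13) ∷ (‵ 2 ⊗ (# 4 ⊗ # 2) , # 14 , # 3) ∷ (‵ 2 ⊗ (# 4 ⊗ # 1) ,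
        # 15 , # 5) ∷ (‵ 2 ⊗ (# 4 ⊗ # 2) , ‵ 1 ⊕ # 10 , # 1) ∷ (‵ 2 ⊗ (# 4 ⊗ # 1) , ‵ 1 ⊕ # 11 , # 2) ∷ (‵ 2 ⊗ # 2 , # 4
        ⊗ # 1 , # 16 ⊗ # 1 ⊕ # 14 ⊗ # 4 ⊕ ‵ 1) ∷ (‵ 2 ⊗ # 1 , # 4 ⊗ # 2 , # 17 ⊗ # 2 ⊕ # 15 ⊗ # 4 ⊕ ‵ 1) ∷ (‵ 2 , ‵ 1 ⊕
        # 7 , # 4) ∷ (‵ 2 , # 4 , # 1) ∷ (# 2 , ‵ 1 ⊕ ‵ 1 , # 4) ∷ (‵ 2 ⊗ # 1 , ‵ 1 ⊕ ‵ 1 , # 4) ∷ []) refl (≤-reflexive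
        (rep-m x<p) , ≤-reflexive (sym (rep-m y<p)) , ≤-reflexive Nx , ≤-reflexive (sym Ny) , Bx , Cx , b<q _ , c<r _ ,
        unit-≥ U , unit-≥ V , m< {x} , p≤q , 1<p , 1<p , tt))

    -- In the balance of `exchange`, N = 2 at v forces carries in both b and c, and N = 1 forces
    -- one. A carry in b yields bₓ v > bₓ z ≥ B, and similarly in c. This gives `High` for N = 2 and
    -- contradicts b < B or c < C for N = 1.
    ascend : ∀ {x v y z} → x < p → Low x → High y → High z → β ≤ v → v < α + β → x + z ≡ v + y →
      m x + m z ≡ m v + m y → def v ≡ 0 → High v
    ascend {x} {v} {y} {z} x<p Nx (y<p , Ny , By , Cy) (z<p , Nz , Bz , Cz) β≤v v< e eᵐ d =
      case exchange x<p z<p v<p y<p eᵐ 0 (trans (cong (_+ z) (+-identityʳ x)) e) of λ { (i , i′ , j , j′ , C₁ , C₂ , bal) →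
      case def-0 (bound-N (≤-trans α≤β β≤v) v<) (zone-N v<p β≤v v<) d of λ
        { (inj₁ Nv) → case carry-both C₁ C₂
            (equate ((Nₓ x) ∷ (Nₓ z) ∷ i ∷ j ∷ (Nₓ v) ∷ (Nₓ y) ∷ i′ ∷ j′ ∷ []) 1 (‵ 2 ⊕ # 2 ⊕ # 3) (‵ 4 ⊕ # 6 ⊕ # 7) (#
              0 ⊕ # 1 ⊕ ‵ 0 ⊕ # 2 ⊕ # 3 ≼ # 4 ⊕ # 5 ⊕ # 6 ⊕ # 7 ∷ ‵ 0 ≼ # 0 ∷ ‵ 2 ≼ # 1 ∷ # 4 ≼ ‵ 2 ∷ # 5 ≼ ‵ 2 ∷ [])
              refl (bal , sym Nx , sym Nz , Nv , Ny , tt)) of λ { (eb , ec) → v<p , Nv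
          , (entail ((bₓ x) ∷ (bₓ z) ∷ q ∷ (bₓ v) ∷ (bₓ y) ∷ B ∷ []) (‵ 1) (# 5) (# 3) (# 0 ⊕ # 1 ⊕ # 2 ≼ # 3 ⊕ # 4 ∷ #
            4 ≺ # 2 ∷ # 5 ≼ # 1 ∷ []) refl (≤-reflexive eb , b<q _ , Bz , tt))
          , (entail ((cₓ x) ∷ (cₓ z) ∷ r ∷ (cₓ v) ∷ (cₓ y) ∷ C ∷ []) (‵ 1) (# 5) (# 3) (# 0 ⊕ # 1 ⊕ # 2 ≼ # 3 ⊕ # 4 ∷ #
            4 ≺ # 2 ∷ # 5 ≼ # 1 ∷ []) refl (≤-reflexive ec , c<r _ , Cz , tt)) }
        ; (inj₂ (Nv , b<B , c<C)) → ⊥-elim (case carry-one C₁ C₂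
            (equate ((Nₓ x) ∷ (Nₓ z) ∷ i ∷ j ∷ (Nₓ v) ∷ (Nₓ y) ∷ i′ ∷ j′ ∷ []) 1 (‵ 3 ⊕ # 2 ⊕ # 3) (‵ 4 ⊕ # 6 ⊕ # 7) (#
              0 ⊕ # 1 ⊕ ‵ 0 ⊕ # 2 ⊕ # 3 ≼ # 4 ⊕ # 5 ⊕ # 6 ⊕ # 7 ∷ ‵ 0 ≼ # 0 ∷ ‵ 2 ≼ # 1 ∷ # 4 ≼ ‵ 1 ∷ # 5 ≼ ‵ 2 ∷ [])
              refl (bal , sym Nx , sym Nz , Nv , Ny , tt)) of λ
          { (inj₁ (eb , _)) → (refute ((bₓ x) ∷ (bₓ z) ∷ q ∷ (bₓ v) ∷ (bₓ y) ∷ B ∷ []) (# 0 ⊕ # 1 ⊕ # 2 ≼ # 3 ⊕ # 4 ∷ #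
            4 ≺ # 2 ∷ # 5 ≼ # 1 ∷ # 3 ≺ # 5 ∷ []) refl (≤-reflexive eb , b<q _ , Bz , b<B , tt))
          ; (inj₂ (_ , ec)) → (refute ((cₓ x) ∷ (cₓ z) ∷ r ∷ (cₓ v) ∷ (cₓ y) ∷ C ∷ []) (# 0 ⊕ # 1 ⊕ # 2 ≼ # 3 ⊕ # 4 ∷ #
            4 ≺ # 2 ∷ # 5 ≼ # 1 ∷ # 3 ≺ # 5 ∷ []) refl (≤-reflexive ec , c<r _ , Cz , c<C , tt)) }) } }
      where
      v<p : v < p
      v<p = (entail (v ∷ α ∷ β ∷ p ∷ []) (‵ 1) (‵ 1 ⊕ # 0) (# 3) (# 0 ≺ # 1 ⊕ # 2 ∷ # 1 ≼ # 2 ∷ # 2 ⊕ # 2 ≼ # 3 ∷ [])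
        refl (v< , α≤β , 2β≤p , tt))

    -- The wrap in a now accounts for one unit of `N`, so just one of b and c carries. In the other
    -- coordinate the sums are equal, and the `High` residues z, s, t force the value at x above 2C
    -- - r or 2B - q. The estimate of `spread` with this extra information bounds x + p.
    descend : ∀ {x y z s t} → x < p → Low x → High y → High z → High s → High t → x + p + z ≡ s + t →
      m x + m z ≡ m s + m t → x + p < y + 2 * β
    descend {x} {y} {z} {s} {t} x<p Nx (y<p , Ny , By , Cy) (z<p , Nz , Bz , Cz) (s<p , Ns , Bs , Cs) (t<p , Nt , Bt , Ct) e eᵐ =
      case exchange x<p z<p s<p t<p eᵐ 1 (trans (cong (λ u → x + u + z) (*-identityˡ p)) e) of λ { (i , i′ , j , j′ , C₁ , C₂ , bal) →
      case carry-one C₁ C₂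
        (equate ((Nₓ x) ∷ (Nₓ z) ∷ i ∷ j ∷ (Nₓ s) ∷ (Nₓ t) ∷ i′ ∷ j′ ∷ []) 1 (‵ 3 ⊕ # 2 ⊕ # 3) (‵ 4 ⊕ # 6 ⊕ # 7) (# 0 ⊕
          # 1 ⊕ ‵ 1 ⊕ # 2 ⊕ # 3 ≼ # 4 ⊕ # 5 ⊕ # 6 ⊕ # 7 ∷ ‵ 0 ≼ # 0 ∷ ‵ 2 ≼ # 1 ∷ # 4 ≼ ‵ 2 ∷ # 5 ≼ ‵ 2 ∷ []) refl (bal
          , sym Nx , sym Nz , Ns , Nt , tt)) of λ
        { (inj₁ (_ , ec)) →
          (entail (x ∷ q ∷ r ∷ (bₓ x) ∷ p ∷ (cₓ x) ∷ W ∷ (m x) ∷ (Nₓ x) ∷ y ∷ (bₓ y) ∷ (cₓ y) ∷ (m y) ∷ (Nₓ y) ∷ (cₓ z)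
            ∷ (cₓ s) ∷ (cₓ t) ∷ C ∷ β ∷ []) (# 1 ⊗ # 2) (‵ 1 ⊕ (# 0 ⊕ # 4)) (# 9 ⊕ ‵ 2 ⊗ # 18) (repᵉ 0 3 5 4 1 2 ≼ # 6 ⊕
            # 7 ⊕ # 4 ⊗ # 1 ⊗ # 2 ⊗ # 8 ∷ # 6 ⊕ # 12 ⊕ # 4 ⊗ # 1 ⊗ # 2 ⊗ # 13 ≼ repᵉ 9 10 11 4 1 2 ∷ (# 4 ⊗ # 1 ⊗ # 2 ,
            # 8 , ‵ 0) ∷ (# 4 ⊗ # 1 ⊗ # 2 , ‵ 2 , # 13) ∷ (# 4 ⊗ # 1 , # 15 ⊕ # 16 , # 5 ⊕ # 14) ∷ (# 4 ⊗ # 1 , ‵ 1 ⊕ #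
            14 , # 2) ∷ (# 4 ⊗ # 1 , # 17 , # 15) ∷ (# 4 ⊗ # 1 , # 17 , # 16) ∷ (# 4 ⊗ # 2 , ‵ 1 ⊕ # 10 , # 1) ∷ (# 4 ⊗
            # 1 , ‵ 1 ⊕ # 11 , # 2) ∷ (‵ 2 ⊗ # 1 , # 4 ⊗ # 2 , # 18 ⊗ # 2 ⊕ # 17 ⊗ # 4 ⊕ ‵ 1) ∷ (‵ 2 , ‵ 1 ⊕ # 7 , # 4)
            ∷ (# 1 , ‵ 1 ⊕ ‵ 1 , # 4) ∷ (# 4 , ‵ 1 ⊕ ‵ 1 , # 2) ∷ []) refl (≤-reflexive (rep-m x<p) , ≤-reflexive (sym
            (rep-m y<p)) , ≤-reflexive Nx , ≤-reflexive (sym Ny) , ≤-reflexive (sym ec) , c<r _ , Cs , Ct , b<q _ , c<r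
            _ , unit-≥ V , m< {x} , 1<p , 1<r , tt))
        ; (inj₂ (eb , _)) →
          (entail (x ∷ q ∷ r ∷ (bₓ x) ∷ p ∷ (cₓ x) ∷ W ∷ (m x) ∷ (Nₓ x) ∷ y ∷ (bₓ y) ∷ (cₓ y) ∷ (m y) ∷ (Nₓ y) ∷ (bₓ z)
            ∷ (bₓ s) ∷ (bₓ t) ∷ B ∷ α ∷ β ∷ []) (# 1 ⊗ # 2) (‵ 1 ⊕ (# 0 ⊕ # 4)) (# 9 ⊕ ‵ 2 ⊗ # 19) (repᵉ 0 3 5 4 1 2 ≼ #
            6 ⊕ # 7 ⊕ # 4 ⊗ # 1 ⊗ # 2 ⊗ # 8 ∷ # 6 ⊕ # 12 ⊕ # 4 ⊗ # 1 ⊗ # 2 ⊗ # 13 ≼ repᵉ 9 10 11 4 1 2 ∷ (# 4 ⊗ # 1 ⊗ #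
            2 , # 8 , ‵ 0) ∷ (# 4 ⊗ # 1 ⊗ # 2 , ‵ 2 , # 13) ∷ (# 4 ⊗ # 2 , # 15 ⊕ # 16 , # 3 ⊕ # 14) ∷ (# 4 ⊗ # 2 , ‵ 1
            ⊕ # 14 , # 1) ∷ (# 4 ⊗ # 2 , # 17 , # 15) ∷ (# 4 ⊗ # 2 , # 17 , # 16) ∷ (# 4 ⊗ # 2 , ‵ 1 ⊕ # 10 , # 1) ∷ (#
            4 ⊗ # 1 , ‵ 1 ⊕ # 11 , # 2) ∷ (‵ 2 ⊗ # 2 , # 4 ⊗ # 1 , # 18 ⊗ # 1 ⊕ # 17 ⊗ # 4 ⊕ ‵ 1) ∷ (‵ 2 ⊗ (# 1 ⊗ # 2) ,
            # 18 , # 19) ∷ (‵ 2 , ‵ 1 ⊕ # 7 , # 4) ∷ (# 2 , ‵ 1 ⊕ ‵ 1 , # 4) ∷ (# 4 , ‵ 1 ⊕ ‵ 1 , # 1) ∷ []) refl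
            (≤-reflexive (rep-m x<p) , ≤-reflexive (sym (rep-m y<p)) , ≤-reflexive Nx , ≤-reflexive (sym Ny) ,
            ≤-reflexive (sym eb) , b<q _ , Bs , Bt , b<q _ , c<r _ , unit-≥ U , α≤β , m< {x} , 1<p , 1<q , tt)) } }

    -- Positions of consecutive residues differ by qr modulo p, so a difference of 3 means qr ≡ ±3
    -- and (qr)² ≡ 9.
    rigid : ∀ {x} → α ≡ β → p ≡ 1 + 3 * α → suc x < p → (m x ≢ 3 + m (x + 1)) × (m (x + 1) ≢ 3 + m x)
    rigid {x} α≡β p≡ 1+x<p = go (residue (<-trans (n<1+n x) 1+x<p)) (residue (subst (_< p) (+-comm 1 x) 1+x<p))
      where
      impossible : q * r * (q * r) ≋ 9 mod p → ⊥
      impossible = no-rigid pp 0<α p≡ (unit-square U) (subst (λ γ → γ * r * (γ * r) ≋ 1 mod p) (sym α≡β) (unit-square V))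
      go : (∃₂ λ s t → W + m x + p * s ≡ x * (q * r) + p * t) → (∃₂ λ s t → W + m (x + 1) + p * s ≡ (x + 1) * (q * r) + p * t) →
        (m x ≢ 3 + m (x + 1)) × (m (x + 1) ≢ 3 + m x)
      go (s , t , e) (s′ , t′ , e′) =
          (λ d → impossible (≋-square⁻ {y = 3} (congruent (t′ + s) (s′ + t)
            (equate (W ∷ (m x) ∷ p ∷ s ∷ x ∷ q ∷ r ∷ t ∷ (m (x + 1)) ∷ s′ ∷ t′ ∷ []) 1 (# 5 ⊗ # 6 ⊕ ‵ 3 ⊕ # 2 ⊗ (# 10 ⊕
              # 3)) (‵ 0 ⊕ # 2 ⊗ (# 9 ⊕ # 7)) (# 0 ⊕ # 1 ⊕ # 2 ⊗ # 3 ≼ # 4 ⊗ (# 5 ⊗ # 6) ⊕ # 2 ⊗ # 7 ∷ (# 4 ⊕ ‵ 1) ⊗ (#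
              5 ⊗ # 6) ⊕ # 2 ⊗ # 10 ≼ # 0 ⊕ # 8 ⊕ # 2 ⊗ # 9 ∷ ‵ 3 ⊕ # 8 ≼ # 1 ∷ []) refl (e , sym e′ , sym d , tt)))))
        , (λ d → let qr≋3 = congruent (t′ + s) (s′ + t)
                          (equate (W ∷ (m x) ∷ p ∷ s ∷ x ∷ q ∷ r ∷ t ∷ (m (x + 1)) ∷ s′ ∷ t′ ∷ []) 1 (# 5 ⊗ # 6 ⊕ # 2 ⊗
                            (# 10 ⊕ # 3)) (‵ 3 ⊕ # 2 ⊗ (# 9 ⊕ # 7)) (# 0 ⊕ # 1 ⊕ # 2 ⊗ # 3 ≼ # 4 ⊗ (# 5 ⊗ # 6) ⊕ # 2 ⊗ #
                            7 ∷ (# 4 ⊕ ‵ 1) ⊗ (# 5 ⊗ # 6) ⊕ # 2 ⊗ # 10 ≼ # 0 ⊕ # 8 ⊕ # 2 ⊗ # 9 ∷ # 8 ≼ ‵ 3 ⊕ # 1 ∷ [])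
                            refl (e , sym e′ , d , tt))
                 in impossible (≋-* qr≋3 qr≋3))

    configuration : Configuration p α β def
    configuration = record
      { Low = Low ; Wrap = Wrap ; High = High ; m = m ; m<p = λ {x} _ → m< {x} ; m-near = m-near ; High<p = proj₁
      ; A-zone = λ x<α → def-0 (bound-A x<α) (zone-A (<-≤-trans x<α (≤-trans α≤β (≤-trans (m≤m+n β β) 2β≤p))) x<α)
      ; B-zone = λ le x<p → def-0 (bound-B le) (zone-B x<p le)
      ; spread = spread ; spread′ = spread′ ; ascend = ascend ; descend = descend ; rigid = rigid }

  window-bound : 3 * sum pos p ≤ 3 * sum neg p + 2 * p × 3 * sum neg p ≤ 3 * sum pos p + 2 * p
  window-bound =
      ≮⇒≥ (λ excess → no-excess configuration 0<α α≤β ≤-refl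
        (entail ((sum pos p) ∷ (sum def p) ∷ β ∷ p ∷ (sum neg p) ∷ []) (‵ 1) (‵ 1 ⊕ ‵ 3 ⊗ (# 2 ⊕ # 1)) (# 3) ((‵ 3 , # 0
          ⊕ # 1 ⊕ # 2 , # 3 ⊕ # 4) ∷ ‵ 3 ⊗ # 4 ⊕ ‵ 2 ⊗ # 3 ≺ ‵ 3 ⊗ # 0 ∷ []) refl (≤-reflexive total , excess , tt)))
    -- This side has slack: as the defects number at most p, the difference is at least -β, and 2β ≤
    -- p.
    , (entail ((sum pos p) ∷ (sum def p) ∷ β ∷ p ∷ (sum neg p) ∷ []) (‵ 2) (‵ 3 ⊗ # 4) (‵ 3 ⊗ # 0 ⊕ ‵ 2 ⊗ # 3) ((‵ 6 , #
      3 ⊕ # 4 , # 0 ⊕ # 1 ⊕ # 2) ∷ (‵ 3 , # 2 ⊕ # 2 , # 3) ∷ (‵ 6 , # 1 , # 3) ∷ []) refl (≤-reflexive (sym total) ,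
      2β≤p , sum-def , tt))

-- Balanced inverses and the existence of coordinates

reduced-inverse : ∀ {p q} → 1 < p → Coprime q p → ∃₂ λ x y → x ≤ p × y ≤ q × x * q + y * p ≡ 1 + p * q
reduced-inverse {p} {q} 1<p q⊥p = case inverse 1<p q⊥p of λ { (X , k , e) → go X k e }
  where
  instance
    p≢0 : NonZero p
    p≢0 = >-nonZero (<⇒≤ 1<p)
  go : ∀ X k → X * q ≡ 1 + k * p → ∃₂ λ x y → x ≤ p × y ≤ q × x * q + y * p ≡ 1 + p * q
  go X k e = x , y , <⇒≤ x<p , y≤q , (equate (x ∷ q ∷ d ∷ p ∷ k ∷ y ∷ []) 1 (# 0 ⊗ # 1 ⊕ # 5 ⊗ # 3) (‵ 1 ⊕ # 3 ⊗ # 1) (#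
    0 ⊗ # 1 ⊕ # 2 ⊗ # 3 ⊗ # 1 ≼ ‵ 1 ⊕ # 4 ⊗ # 3 ∷ (# 3 , # 5 ⊕ # 4 , # 1 ⊕ # 2 ⊗ # 1) ∷ []) refl (E , m∸n+n≡m k≤ , tt))
    where
    x = X % p
    d = X / p
    -- From X = x + dp one gets xq = 1 + (k - dq)p; adding pq to both sides makes the coefficient of
    -- p natural.
    y = q + d * q ∸ k
    x<p : x < p
    x<p = m%n<n X p
    E : x * q + d * p * q ≡ 1 + k * p
    E = (equate (X ∷ x ∷ d ∷ p ∷ q ∷ k ∷ []) 1 (# 1 ⊗ # 4 ⊕ # 2 ⊗ # 3 ⊗ # 4) (‵ 1 ⊕ # 5 ⊗ # 3) ((# 4 , # 1 ⊕ # 2 ⊗ # 3 ,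
      # 0) ∷ # 0 ⊗ # 4 ≼ ‵ 1 ⊕ # 5 ⊗ # 3 ∷ []) refl (sym (m≡m%n+[m/n]*n X p) , e , tt))
    k≤ : k ≤ q + d * q
    k≤ = (entail (x ∷ q ∷ d ∷ p ∷ k ∷ []) (# 3) (# 4) (# 1 ⊕ # 2 ⊗ # 1) (# 4 ⊗ # 3 ≺ # 0 ⊗ # 1 ⊕ # 2 ⊗ # 3 ⊗ # 1 ∷ (# 1
      , ‵ 1 ⊕ # 0 , # 3) ∷ ‵ 1 ≺ # 3 ∷ []) refl (≤-reflexive (sym E) , x<p , 1<p , tt))
    y≤q : y ≤ q
    y≤q = (entail (y ∷ k ∷ q ∷ d ∷ []) (‵ 1) (# 0) (# 2) (# 0 ⊕ # 1 ≼ # 2 ⊕ # 3 ⊗ # 2 ∷ # 3 ⊗ # 2 ≼ # 1 ∷ []) refl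
      (≤-reflexive (m∸n+n≡m k≤) , dq≤k , tt))
      where dq≤k : d * q ≤ k
            dq≤k = (entail (x ∷ q ∷ d ∷ p ∷ k ∷ []) (# 3) (# 2 ⊗ # 1) (# 4) (# 0 ⊗ # 1 ⊕ # 2 ⊗ # 3 ⊗ # 1 ≼ ‵ 1 ⊕ # 4 ⊗ #
              3 ∷ ‵ 1 ≺ # 3 ∷ []) refl (≤-reflexive E , 1<p , tt))

unit-positive : ∀ {p q α B e⁺ e⁻} → 1 < p → Unit p q α B e⁺ e⁻ → 0 < α
unit-positive {α = suc _} _ _ = s≤s z≤n
unit-positive {p} {q} {zero} {B} {e⁺} {e⁻} 1<p U with m≤n⇒m<n∨m≡n (Unit.B≤q U)
... | inj₁ B<q  = ⊥-elim (refute (B ∷ p ∷ e⁻ ∷ q ∷ e⁺ ∷ []) (# 1 ⊗ # 3 ⊕ # 4 ≼ ‵ 0 ⊕ # 0 ⊗ # 1 ⊕ # 2 ∷ (# 1 , ‵ 1 ⊕ # 0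
  , # 3) ∷ # 2 ≼ ‵ 1 ∷ ‵ 1 ≺ # 1 ∷ []) refl (≤-reflexive (sym (Unit.α-B U)) , B<q , Unit.e⁻≤1 U , 1<p , tt))
... | inj₂ refl = ⊥-elim (odd e⁻ (trans (cong (_+ e⁻) e≡) (Unit.±1 U)))
  where
  e≡ : e⁻ ≡ e⁺
  e≡ = (equate (B ∷ p ∷ e⁻ ∷ e⁺ ∷ []) 1 (# 2) (# 3) (‵ 0 ⊕ # 0 ⊗ # 1 ⊕ # 2 ≼ # 1 ⊗ # 0 ⊕ # 3 ∷ []) refl (Unit.α-B U ,
    tt))
  odd : ∀ e → e + e ≢ 1
  odd (suc e) eq = 1+n≢0 (trans (sym (+-suc e e)) (suc-injective eq))

-- Replacing (x, y) by (p - x, q - y) turns pq + 1 into pq - 1, and one of x and p - x is at most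
-- p/2. The sign of the unit is the price of the smaller size.
balanced-unit : ∀ {p q} → 1 < p → Coprime q p → ∃₂ λ α B → ∃₂ λ e⁺ e⁻ → Unit p q α B e⁺ e⁻ × 0 < α × α + α ≤ p
balanced-unit {p} {q} 1<p q⊥p = case reduced-inverse 1<p q⊥p of λ { (x , y , x≤p , y≤q , e) → go x y x≤p y≤q e }
  where
  go : ∀ x y → x ≤ p → y ≤ q → x * q + y * p ≡ 1 + p * q → ∃₂ λ α B → ∃₂ λ e⁺ e⁻ → Unit p q α B e⁺ e⁻ × 0 < α × α + α ≤ p
  go x y x≤p y≤q e with ≤-total (x + x) p
  ... | inj₁ 2x≤p = x , y , 1 , 0 , U , unit-positive 1<p U , 2x≤p
    where
    U : Unit p q x y 1 0
    U = record { α≤p = x≤p ; B≤q = y≤q ; e⁺≤1 = ≤-refl ; e⁻≤1 = z≤n ; ±1 = refl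
               ; α-B = (equate (x ∷ q ∷ y ∷ p ∷ []) 1 (# 0 ⊗ # 1 ⊕ # 2 ⊗ # 3 ⊕ ‵ 0) (# 3 ⊗ # 1 ⊕ ‵ 1) (# 0 ⊗ # 1 ⊕ # 2 ⊗
                 # 3 ≼ ‵ 1 ⊕ # 3 ⊗ # 1 ∷ []) refl (e , tt)) }
  ... | inj₂ p≤2x = p ∸ x , q ∸ y , 0 , 1 , U , unit-positive 1<p U
      , (entail ((p ∸ x) ∷ x ∷ p ∷ []) (‵ 1) (# 0 ⊕ # 0) (# 2) ((‵ 2 , # 0 ⊕ # 1 , # 2) ∷ # 2 ≼ # 1 ⊕ # 1 ∷ []) refl
        (≤-reflexive (m∸n+n≡m x≤p) , p≤2x , tt))
    where
    U : Unit p q (p ∸ x) (q ∸ y) 0 1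
    U = record { α≤p = m∸n≤m p x ; B≤q = m∸n≤m q y ; e⁺≤1 = z≤n ; e⁻≤1 = ≤-refl ; ±1 = refl
               ; α-B = (equate (x ∷ q ∷ y ∷ p ∷ (p ∸ x) ∷ (q ∸ y) ∷ []) 1 (# 4 ⊗ # 1 ⊕ # 5 ⊗ # 3 ⊕ ‵ 1) (# 3 ⊗ # 1 ⊕ ‵
                 0) (# 3 ⊗ # 1 ≺ # 0 ⊗ # 1 ⊕ # 2 ⊗ # 3 ∷ (# 1 , # 4 ⊕ # 0 , # 3) ∷ (# 3 , # 5 ⊕ # 2 , # 1) ∷ []) refl
                 (sym e , m∸n+n≡m x≤p , m∸n+n≡m y≤q , tt)) }

coprime-* : ∀ {p m n} → Prime p → ¬ p ∣ m → ¬ p ∣ n → Coprime p (m * n)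
coprime-* {p} {m} {n} pp p∤m p∤n (d∣p , d∣mn) = case prime⇒irreducible pp d∣p of λ where
  (inj₁ d≡1)  → d≡1
  (inj₂ refl) → ⊥-elim ([ p∤m , p∤n ]′ (euclidsLemma m n pp d∣mn))

prime-∤ : ∀ {p q} → Prime q → 1 < p → p ≢ q → ¬ p ∣ q
prime-∤ pq 1<p p≢q p∣q = [ (λ { refl → <-irrefl refl 1<p }) , p≢q ]′ (prime⇒irreducible pq p∣q)

module _ {p q r : ℕ} (pp : Prime p) (pq : Prime q) (pr : Prime r) (1<p : 1 < p) (p<q : p < q) (q<r : q < r) where

  private
    1<q = <-trans 1<p p<q
    1<r = <-trans 1<q q<r
    p<r = <-trans p<q q<r
    instance
      p≢0 : NonZero p
      p≢0 = >-nonZero (<⇒≤ 1<p)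
      q≢0 : NonZero q
      q≢0 = >-nonZero (<⇒≤ 1<q)
      r≢0 : NonZero r
      r≢0 = >-nonZero (<⇒≤ 1<r)

    q⊥p : Coprime q p
    q⊥p = subst (Coprime q) (*-identityʳ p) (coprime-* pq (prime-∤ pp 1<q (>⇒≢ p<q)) (λ q∣1 → <⇒≱ 1<q (∣⇒≤ q∣1)))

    p⊥qr : Coprime p (q * r)
    p⊥qr = coprime-* pp (prime-∤ pq 1<p (<⇒≢ p<q)) (prime-∤ pr 1<p (<⇒≢ p<r))
    q⊥pr : Coprime q (p * r)
    q⊥pr = coprime-* pq (prime-∤ pp 1<q (>⇒≢ p<q)) (prime-∤ pr 1<q (<⇒≢ q<r))
    r⊥pq : Coprime r (p * q)
    r⊥pq = coprime-* pr (prime-∤ pp 1<r (>⇒≢ p<r)) (prime-∤ pq 1<r (>⇒≢ q<r))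

    B : ℕ
    B = p * q * r

    -- Partial fractions of 1/(pqr) up to an integer, obtained by splitting off r from pq and then p
    -- from q.
    generator : ∃₂ λ x y → ∃₂ λ z t → x * (q * r) + y * (p * r) + z * (p * q) ≡ 1 + p * q * r * t
    generator = case reduced-inverse 1<p q⊥p of λ { (x , y , _ , _ , e) → case reduced-inverse 1<r (Coprimality.sym r⊥pq) of λ { (z , u , _ , _ , f) →
      u * x , u * y , z , 1 + u ,
      (equate (x ∷ q ∷ y ∷ p ∷ u ∷ r ∷ z ∷ []) 1 (# 4 ⊗ # 0 ⊗ (# 1 ⊗ # 5) ⊕ # 4 ⊗ # 2 ⊗ (# 3 ⊗ # 5) ⊕ # 6 ⊗ (# 3 ⊗ # 1))
        (‵ 1 ⊕ # 3 ⊗ # 1 ⊗ # 5 ⊗ (‵ 1 ⊕ # 4)) ((# 4 ⊗ # 5 , # 0 ⊗ # 1 ⊕ # 2 ⊗ # 3 , ‵ 1 ⊕ # 3 ⊗ # 1) ∷ # 6 ⊗ (# 3 ⊗ # 1)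
        ⊕ # 4 ⊗ # 5 ≼ ‵ 1 ⊕ # 5 ⊗ (# 3 ⊗ # 1) ∷ []) refl (e , f , tt)) } }

  system : System p q r (p * q * r ∸ (p + q + r)) (p * q * r + p * q * r)
  system = case generator of λ { (x , y , z , t , gen) → go x y z t gen }
    where
    module _ (x y z t : ℕ) (gen : x * (q * r) + y * (p * r) + z * (p * q) ≡ 1 + p * q * r * t) where
      a b c u N : ℕ → ℕ
      a M = (M * x) % p
      b M = (M * y) % q
      c M = (M * z) % r
      u M = (M * x) / p + (M * y) / q + (M * z) / r
      -- M·t is the multiple of pqr in M times the generator, and `u` collects the multiples removed
      -- by reducing the coordinates. By `u≤` nothing is truncated below 2pqr.
      N M = suc (M * t) ∸ u M

      total : ∀ M → a M * (q * r) + b M * (p * r) + c M * (p * q) + p * q * r * u M ≡ M + p * q * r * (M * t)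
      total M = (equate (M ∷ x ∷ (a M) ∷ (M * x / p) ∷ p ∷ q ∷ r ∷ y ∷ (b M) ∷ (M * y / q) ∷ z ∷ (c M) ∷ (M * z / r) ∷ t
        ∷ []) 1 (# 2 ⊗ (# 5 ⊗ # 6) ⊕ # 8 ⊗ (# 4 ⊗ # 6) ⊕ # 11 ⊗ (# 4 ⊗ # 5) ⊕ # 4 ⊗ # 5 ⊗ # 6 ⊗ (# 3 ⊕ # 9 ⊕ # 12)) (# 0
        ⊕ # 4 ⊗ # 5 ⊗ # 6 ⊗ (# 0 ⊗ # 13)) ((# 5 ⊗ # 6 , # 2 ⊕ # 3 ⊗ # 4 , # 0 ⊗ # 1) ∷ (# 4 ⊗ # 6 , # 8 ⊕ # 9 ⊗ # 5 , #
        0 ⊗ # 7) ∷ (# 4 ⊗ # 5 , # 11 ⊕ # 12 ⊗ # 6 , # 0 ⊗ # 10) ∷ (# 0 , # 1 ⊗ (# 5 ⊗ # 6) ⊕ # 7 ⊗ (# 4 ⊗ # 6) ⊕ # 10 ⊗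
        (# 4 ⊗ # 5) , ‵ 1 ⊕ # 4 ⊗ # 5 ⊗ # 6 ⊗ # 13) ∷ []) refl (sym (m≡m%n+[m/n]*n (M * x) p) , sym (m≡m%n+[m/n]*n (M *
        y) q) , sym (m≡m%n+[m/n]*n (M * z) r) , gen , tt))

      u≤ : ∀ {M} → M < B + B → u M ≤ suc (M * t)
      u≤ {M} M< = s≤s⁻¹ (entail ((a M) ∷ q ∷ r ∷ (b M) ∷ p ∷ (c M) ∷ (u M) ∷ M ∷ t ∷ []) (# 4 ⊗ # 1 ⊗ # 2) (‵ 1 ⊕ # 6)
        (‵ 2 ⊕ # 7 ⊗ # 8) (# 0 ⊗ (# 1 ⊗ # 2) ⊕ # 3 ⊗ (# 4 ⊗ # 2) ⊕ # 5 ⊗ (# 4 ⊗ # 1) ⊕ # 4 ⊗ # 1 ⊗ # 2 ⊗ # 6 ≼ # 7 ⊕ # 4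
        ⊗ # 1 ⊗ # 2 ⊗ (# 7 ⊗ # 8) ∷ # 7 ≺ # 4 ⊗ # 1 ⊗ # 2 ⊕ # 4 ⊗ # 1 ⊗ # 2 ∷ []) refl (≤-reflexive (total M) , M< ,
        tt))

      rep : ∀ {M} → M < B + B → a M * (q * r) + b M * (p * r) + c M * (p * q) + p * q * r ≡ M + p * q * r * N M
      rep {M} M< = (equate ((a M) ∷ q ∷ r ∷ (b M) ∷ p ∷ (c M) ∷ (u M) ∷ M ∷ t ∷ (N M) ∷ []) 1 (repᵉ 0 3 5 4 1 2) (# 7 ⊕
        # 4 ⊗ # 1 ⊗ # 2 ⊗ # 9) (# 0 ⊗ (# 1 ⊗ # 2) ⊕ # 3 ⊗ (# 4 ⊗ # 2) ⊕ # 5 ⊗ (# 4 ⊗ # 1) ⊕ # 4 ⊗ # 1 ⊗ # 2 ⊗ # 6 ≼ # 7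
        ⊕ # 4 ⊗ # 1 ⊗ # 2 ⊗ (# 7 ⊗ # 8) ∷ (# 4 ⊗ # 1 ⊗ # 2 , ‵ 1 ⊕ # 7 ⊗ # 8 , # 9 ⊕ # 6) ∷ []) refl (total M , sym
        (m∸n+n≡m (u≤ M<)) , tt))

      go : System p q r (p * q * r ∸ (p + q + r)) (p * q * r + p * q * r)
      go = record
        { a = a ; b = b ; c = c ; N = N
        ; a<p = λ M → m%n<n (M * x) p ; b<q = λ M → m%n<n (M * y) q ; c<r = λ M → m%n<n (M * z) r
        ; rep = rep
        -- With reduced coordinates the left side of `rep` is at most 4pqr - (qr + pr + pq). So N =
        -- 3 would need M to fall short of pqr by at least qr + pr + pq, which is more than p + q +
        -- r.
        ; N≤2 = λ {M} lo≤M M< → (entail ((a M) ∷ q ∷ r ∷ (b M) ∷ p ∷ (c M) ∷ M ∷ (N M) ∷ (B ∸ (p + q + r)) ∷ []) (# 4 ⊗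
          # 1 ⊗ # 2) (# 7) (‵ 2) (# 6 ⊕ # 4 ⊗ # 1 ⊗ # 2 ⊗ # 7 ≼ repᵉ 0 3 5 4 1 2 ∷ # 4 ⊗ # 1 ⊗ # 2 ≼ # 4 ⊕ # 1 ⊕ # 2 ⊕ #
          8 ∷ # 8 ≼ # 6 ∷ (# 1 ⊗ # 2 , ‵ 1 ⊕ # 0 , # 4) ∷ (# 4 ⊗ # 2 , ‵ 1 ⊕ # 3 , # 1) ∷ (# 4 ⊗ # 1 , ‵ 1 ⊕ # 5 , # 2)
          ∷ (# 1 , ‵ 1 ⊕ ‵ 1 , # 4) ∷ (# 4 , ‵ 1 ⊕ ‵ 1 , # 2) ∷ (# 2 , ‵ 1 ⊕ ‵ 1 , # 1) ∷ ‵ 1 ≺ # 4 ∷ ‵ 1 ≺ # 1 ∷ ‵ 1 ≺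
          # 2 ∷ []) refl (≤-reflexive (sym (rep M<)) , m≤n+m∸n B (p + q + r) , lo≤M , m%n<n (M * x) p , m%n<n (M * y) q
          , m%n<n (M * z) r , 1<p , 1<r , 1<q , 1<p , 1<q , 1<r , tt))
        ; p⊥qr = p⊥qr ; q⊥pr = q⊥pr ; r⊥pq = r⊥pq ; 1<p = 1<p ; 1<q = 1<q ; 1<r = 1<r }

-- Removing the coordinates from the series one at a time

rotate : ∀ {p q r lo hi} → System p q r lo hi → System q p r lo hi
rotate {p} {q} {r} S = record
  { a = b ; b = a ; c = c ; N = N ; a<p = b<q ; b<q = a<p ; c<r = c<r
  ; rep = λ {M} M< → (equate ((a M) ∷ q ∷ r ∷ (b M) ∷ p ∷ (c M) ∷ M ∷ (N M) ∷ []) 1 (repᵉ 3 0 5 1 4 2) (# 6 ⊕ # 1 ⊗ # 4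
    ⊗ # 2 ⊗ # 7) (repᵉ 0 3 5 4 1 2 ≼ # 6 ⊕ # 4 ⊗ # 1 ⊗ # 2 ⊗ # 7 ∷ []) refl (rep M< , tt))
  ; N≤2 = N≤2 ; p⊥qr = q⊥pr ; q⊥pr = p⊥qr ; r⊥pq = subst (λ n → Coprime r n) (*-comm p q) r⊥pq
  ; 1<p = 1<q ; 1<q = 1<p ; 1<r = 1<r }
  where open System S

module Steps {p q r lo hi} (S : System p q r lo hi) where
  open System S

  private
    0<pqr : 0 < p * q * r
    0<pqr = (entail (p ∷ q ∷ r ∷ []) (‵ 1) (‵ 1 ⊕ ‵ 0) (# 0 ⊗ # 1 ⊗ # 2) ((# 1 ⊗ # 2 , ‵ 1 ⊕ ‵ 1 , # 0) ∷ (‵ 2 ⊗ # 2 , ‵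
      1 ⊕ ‵ 1 , # 1) ∷ (‵ 4 , ‵ 1 ⊕ ‵ 1 , # 2) ∷ []) refl (1<p , 1<q , 1<r , tt))

  module _ {M M′ : ℕ} (M< : M < hi) (e : M′ + q * r ≡ M) where
    private
      M′< : M′ < hi
      M′< = ≤-<-trans (m+n≤o⇒m≤o M′ (≤-reflexive e)) M<

    b-step : b M′ ≡ b M
    b-step = cancel-≡ q⊥pr (a M′ * r + c M′ * p + r + p * r * N M) (a M * r + c M * p + p * r * N M′) (b<q M′) (b<q M)
      (equate ((a M) ∷ q ∷ r ∷ (b M) ∷ p ∷ (c M) ∷ M ∷ (N M) ∷ (a M′) ∷ (b M′) ∷ (c M′) ∷ M′ ∷ (N M′) ∷ []) 1 (# 9 ⊗ (#
        4 ⊗ # 2) ⊕ # 1 ⊗ (# 8 ⊗ # 2 ⊕ # 10 ⊗ # 4 ⊕ # 2 ⊕ # 4 ⊗ # 2 ⊗ # 7)) (# 3 ⊗ (# 4 ⊗ # 2) ⊕ # 1 ⊗ (# 0 ⊗ # 2 ⊕ # 5 ⊗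
        # 4 ⊕ # 4 ⊗ # 2 ⊗ # 12)) (# 6 ⊕ # 4 ⊗ # 1 ⊗ # 2 ⊗ # 7 ≼ repᵉ 0 3 5 4 1 2 ∷ repᵉ 8 9 10 4 1 2 ≼ # 11 ⊕ # 4 ⊗ # 1
        ⊗ # 2 ⊗ # 12 ∷ # 11 ⊕ # 1 ⊗ # 2 ≼ # 6 ∷ []) refl (sym (rep M<) , rep M′< , e , tt))

    c-step : c M′ ≡ c M
    c-step = cancel-≡ r⊥pq (a M′ * q + b M′ * p + q + p * q * N M) (a M * q + b M * p + p * q * N M′) (c<r M′) (c<r M)
      (equate ((a M) ∷ q ∷ r ∷ (b M) ∷ p ∷ (c M) ∷ M ∷ (N M) ∷ (a M′) ∷ (b M′) ∷ (c M′) ∷ M′ ∷ (N M′) ∷ []) 1 (# 10 ⊗ (#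
        4 ⊗ # 1) ⊕ # 2 ⊗ (# 8 ⊗ # 1 ⊕ # 9 ⊗ # 4 ⊕ # 1 ⊕ # 4 ⊗ # 1 ⊗ # 7)) (# 5 ⊗ (# 4 ⊗ # 1) ⊕ # 2 ⊗ (# 0 ⊗ # 1 ⊕ # 3 ⊗
        # 4 ⊕ # 4 ⊗ # 1 ⊗ # 12)) (# 6 ⊕ # 4 ⊗ # 1 ⊗ # 2 ⊗ # 7 ≼ repᵉ 0 3 5 4 1 2 ∷ repᵉ 8 9 10 4 1 2 ≼ # 11 ⊕ # 4 ⊗ # 1
        ⊗ # 2 ⊗ # 12 ∷ # 11 ⊕ # 1 ⊗ # 2 ≼ # 6 ∷ []) refl (sym (rep M<) , rep M′< , e , tt))

    private
      a-N : a M′ + 1 + p * N M ≡ a M + p * N M′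
      a-N = *-cancelˡ-≡ _ _ (q * r) {{>-nonZero (entail (q ∷ r ∷ []) (‵ 1) (‵ 1 ⊕ ‵ 0) (# 0 ⊗ # 1) ((# 1 , ‵ 1 ⊕ ‵ 1 , #
        0) ∷ (‵ 2 , ‵ 1 ⊕ ‵ 1 , # 1) ∷ []) refl (1<q , 1<r , tt))}}
        (equate ((a M) ∷ q ∷ r ∷ (b M) ∷ p ∷ (c M) ∷ M ∷ (N M) ∷ (a M′) ∷ (b M′) ∷ (c M′) ∷ M′ ∷ (N M′) ∷ []) 1 (# 1 ⊗ #
          2 ⊗ (# 8 ⊕ ‵ 1 ⊕ # 4 ⊗ # 7)) (# 1 ⊗ # 2 ⊗ (# 0 ⊕ # 4 ⊗ # 12)) (# 6 ⊕ # 4 ⊗ # 1 ⊗ # 2 ⊗ # 7 ≼ repᵉ 0 3 5 4 1 2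
          ∷ repᵉ 8 9 10 4 1 2 ≼ # 11 ⊕ # 4 ⊗ # 1 ⊗ # 2 ⊗ # 12 ∷ # 11 ⊕ # 1 ⊗ # 2 ≼ # 6 ∷ (# 4 ⊗ # 2 , # 3 , # 9) ∷ (# 4
          ⊗ # 1 , # 5 , # 10) ∷ []) refl (sym (rep M<) , rep M′< , e , sym b-step , sym c-step , tt))

    -- The factor 1 - x^(qr) keeps just the terms with a = 0. Lowering M by qr lowers a by 1 at
    -- constant N, except at a = 0, where a becomes p - 1 and N grows, so that M′ does not count.
    χ-step : χ (N M′) + χ (N M) * χ (a M) ≡ χ (N M)
    χ-step = go (a M) (N M′) refl refl
      where
      go : ∀ x n → a M ≡ x → N M′ ≡ n → χ n + χ (N M) * χ x ≡ χ (N M)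
      go (suc x) n ea en = trans (cong₂ _+_ (cong χ (sym N≡)) (*-zeroʳ (χ (N M)))) (+-identityʳ _)
        where
        N≡ : N M ≡ n
        N≡ with <-cmp (N M) n
        ... | tri≈ _ e _ = e
        ... | tri< lt _ _ = ⊥-elim (refute ((a M′) ∷ p ∷ (N M) ∷ (a M) ∷ (N M′) ∷ x ∷ n ∷ []) (# 3 ⊕ # 1 ⊗ # 4 ≼ # 0 ⊕ ‵
          1 ⊕ # 1 ⊗ # 2 ∷ # 5 ≺ # 3 ∷ (# 1 , # 6 , # 4) ∷ (# 1 , ‵ 1 ⊕ # 2 , # 6) ∷ # 0 ≺ # 1 ∷ []) refl (≤-reflexive
          (sym a-N) , ≤-reflexive (sym ea) , ≤-reflexive (sym en) , lt , a<p M′ , tt))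
        ... | tri> _ _ gt = ⊥-elim (refute ((a M′) ∷ p ∷ (N M) ∷ (a M) ∷ (N M′) ∷ x ∷ n ∷ []) (# 0 ⊕ ‵ 1 ⊕ # 1 ⊗ # 2 ≼ #
          3 ⊕ # 1 ⊗ # 4 ∷ (# 1 , # 4 , # 6) ∷ (# 1 , ‵ 1 ⊕ # 6 , # 2) ∷ # 3 ≺ # 1 ∷ []) refl (≤-reflexive a-N ,
          ≤-reflexive en , gt , a<p M , tt))
      go zero zero ea en = ⊥-elim (refute ((a M′) ∷ p ∷ (N M) ∷ (a M) ∷ (N M′) ∷ []) (# 0 ⊕ ‵ 1 ⊕ # 1 ⊗ # 2 ≼ # 3 ⊕ # 1
        ⊗ # 4 ∷ # 3 ≼ ‵ 0 ∷ (# 1 , # 4 , ‵ 0) ∷ []) refl (≤-reflexive a-N , ≤-reflexive ea , ≤-reflexive en , tt))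
      go zero (suc n) ea en = *-identityʳ (χ (N M))

  χ-< : ∀ {M} → M < hi → M < p * q * r → χ (N M) ≡ 0
  χ-< {M} M<hi M< = go (N M) refl
    where
    go : ∀ n → N M ≡ n → χ n ≡ 0
    go (suc n) _ = refl
    go zero    e = ⊥-elim (refute ((a M) ∷ q ∷ r ∷ (b M) ∷ p ∷ (c M) ∷ M ∷ (N M) ∷ []) (repᵉ 0 3 5 4 1 2 ≼ # 6 ⊕ # 4 ⊗ #
      1 ⊗ # 2 ⊗ # 7 ∷ (# 4 ⊗ # 1 ⊗ # 2 , # 7 , ‵ 0) ∷ # 6 ≺ # 4 ⊗ # 1 ⊗ # 2 ∷ []) refl (≤-reflexive (rep M<hi) ,
      ≤-reflexive e , M< , tt))

  χ-corner : ∀ {M} → M < hi → p * q * r < M → χ (N M) * χ (a M) * χ (b M) * χ (c M) ≡ 0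
  χ-corner {M} M<hi <M = go (N M) (a M) (b M) (c M) refl refl refl refl
    where
    go : ∀ n x y z → N M ≡ n → a M ≡ x → b M ≡ y → c M ≡ z → χ n * χ x * χ y * χ z ≡ 0
    go (suc n) x y z _ _ _ _ = refl
    go zero (suc x) y z _ _ _ _ = refl
    go zero zero (suc y) z _ _ _ _ = refl
    go zero zero zero (suc z) _ _ _ _ = refl
    go zero zero zero zero en ea eb ec =
      ⊥-elim (refute ((a M) ∷ q ∷ r ∷ (b M) ∷ p ∷ (c M) ∷ M ∷ (N M) ∷ []) (# 6 ⊕ # 4 ⊗ # 1 ⊗ # 2 ⊗ # 7 ≼ repᵉ 0 3 5 4 1
        2 ∷ (# 1 ⊗ # 2 , # 0 , ‵ 0) ∷ (# 4 ⊗ # 2 , # 3 , ‵ 0) ∷ (# 4 ⊗ # 1 , # 5 , ‵ 0) ∷ # 4 ⊗ # 1 ⊗ # 2 ≺ # 6 ∷ [])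
        refl (≤-reflexive (sym (rep M<hi)) , ≤-reflexive ea , ≤-reflexive eb , ≤-reflexive ec , <M , tt))

  origin : p * q * r < hi → N (p * q * r) ≡ 0 × a (p * q * r) ≡ 0 × b (p * q * r) ≡ 0 × c (p * q * r) ≡ 0
  origin M< = N≡0 , a≡0 , b≡0 , c≡0
    where
    M = p * q * r
    a≡0 : a M ≡ 0
    a≡0 = cancel-≡ p⊥qr (b M * r + c M * q) (q * r * N M) (a<p M) (<⇒≤ 1<p)
      (equate ((a M) ∷ q ∷ r ∷ (b M) ∷ p ∷ (c M) ∷ (N M) ∷ []) 1 (# 0 ⊗ (# 1 ⊗ # 2) ⊕ # 4 ⊗ (# 3 ⊗ # 2 ⊕ # 5 ⊗ # 1)) (‵
        0 ⊗ (# 1 ⊗ # 2) ⊕ # 4 ⊗ (# 1 ⊗ # 2 ⊗ # 6)) (repᵉ 0 3 5 4 1 2 ≼ # 4 ⊗ # 1 ⊗ # 2 ⊕ # 4 ⊗ # 1 ⊗ # 2 ⊗ # 6 ∷ [])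
        refl (rep M< , tt))
    b≡0 : b M ≡ 0
    b≡0 = cancel-≡ q⊥pr (a M * r + c M * p) (p * r * N M) (b<q M) (<⇒≤ 1<q)
      (equate ((a M) ∷ q ∷ r ∷ (b M) ∷ p ∷ (c M) ∷ (N M) ∷ []) 1 (# 3 ⊗ (# 4 ⊗ # 2) ⊕ # 1 ⊗ (# 0 ⊗ # 2 ⊕ # 5 ⊗ # 4)) (‵
        0 ⊗ (# 4 ⊗ # 2) ⊕ # 1 ⊗ (# 4 ⊗ # 2 ⊗ # 6)) (repᵉ 0 3 5 4 1 2 ≼ # 4 ⊗ # 1 ⊗ # 2 ⊕ # 4 ⊗ # 1 ⊗ # 2 ⊗ # 6 ∷ [])
        refl (rep M< , tt))
    c≡0 : c M ≡ 0
    c≡0 = cancel-≡ r⊥pq (a M * q + b M * p) (p * q * N M) (c<r M) (<⇒≤ 1<r)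
      (equate ((a M) ∷ q ∷ r ∷ (b M) ∷ p ∷ (c M) ∷ (N M) ∷ []) 1 (# 5 ⊗ (# 4 ⊗ # 1) ⊕ # 2 ⊗ (# 0 ⊗ # 1 ⊕ # 3 ⊗ # 4)) (‵
        0 ⊗ (# 4 ⊗ # 1) ⊕ # 2 ⊗ (# 4 ⊗ # 1 ⊗ # 6)) (repᵉ 0 3 5 4 1 2 ≼ # 4 ⊗ # 1 ⊗ # 2 ⊕ # 4 ⊗ # 1 ⊗ # 2 ⊗ # 6 ∷ [])
        refl (rep M< , tt))
    N≡0 : N M ≡ 0
    N≡0 = *-cancelˡ-≡ _ _ (p * q * r) {{>-nonZero 0<pqr}}
      (equate ((a M) ∷ q ∷ r ∷ (b M) ∷ p ∷ (c M) ∷ (N M) ∷ []) 1 (# 4 ⊗ # 1 ⊗ # 2 ⊗ # 6) (# 4 ⊗ # 1 ⊗ # 2 ⊗ ‵ 0) (# 4 ⊗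
        # 1 ⊗ # 2 ⊕ # 4 ⊗ # 1 ⊗ # 2 ⊗ # 6 ≼ repᵉ 0 3 5 4 1 2 ∷ (# 1 ⊗ # 2 , # 0 , ‵ 0) ∷ (# 4 ⊗ # 2 , # 3 , ‵ 0) ∷ (# 4
        ⊗ # 1 , # 5 , ‵ 0) ∷ []) refl (sym (rep M<) , a≡0 , b≡0 , c≡0 , tt))

  χ-origin : p * q * r < hi → χ (N (p * q * r)) * χ (a (p * q * r)) * χ (b (p * q * r)) * χ (c (p * q * r)) ≡ 1
  χ-origin M< = case origin M< of λ { (N≡0 , a≡0 , b≡0 , c≡0) →
    cong₂ _*_ (cong₂ _*_ (cong₂ _*_ (cong χ N≡0) (cong χ a≡0)) (cong χ b≡0)) (cong χ c≡0) }

-- The bound over the four windows of a coefficient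

record TwoSided (p m n : ℕ) : Set where
  constructor two-sided
  field
    upper : 3 * m ≤ 3 * n + 2 * p
    lower : 3 * n ≤ 3 * m + 2 * p

TwoSided-sym : ∀ {p m n} → TwoSided p m n → TwoSided p n m
TwoSided-sym (two-sided u l) = two-sided l u

module _ {p q r lo hi α β B C : ℕ} (S : System p q r lo hi) (pp : Prime p) (p≤q : p ≤ q) (p≤r : p ≤ r)
  (0<α : 0 < α) (α≤β : α ≤ β) (2β≤p : β + β ≤ p) {L : ℕ} (lo≤L : lo ≤ L) (L-hi : L + q + r + p ≤ hi) where
  open System S

  private
    X : ℕ → ℕ
    X M = χ (N M)

    hi₀ : L + p ≤ hi
    hi₀ = (entail (L ∷ q ∷ r ∷ p ∷ hi ∷ []) (‵ 1) (# 0 ⊕ # 3) (# 4) (# 0 ⊕ # 1 ⊕ # 2 ⊕ # 3 ≼ # 4 ∷ []) refl (L-hi , tt))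
    hi-q : L + q + p ≤ hi
    hi-q = (entail (L ∷ q ∷ r ∷ p ∷ hi ∷ []) (‵ 1) (# 0 ⊕ # 1 ⊕ # 3) (# 4) (# 0 ⊕ # 1 ⊕ # 2 ⊕ # 3 ≼ # 4 ∷ []) refl (L-hi
      , tt))
    hi-r : L + r + p ≤ hi
    hi-r = (entail (L ∷ q ∷ r ∷ p ∷ hi ∷ []) (‵ 1) (# 0 ⊕ # 2 ⊕ # 3) (# 4) (# 0 ⊕ # 1 ⊕ # 2 ⊕ # 3 ≼ # 4 ∷ []) refl (L-hi
      , tt))

  -- The signs of the two units decide which of the four windows is W, from which both shifts lower
  -- a. Opposite signs exchange the positive and the negative pair, so the bound has to be
  -- two-sided.
  ordered-bound : ∀ e⁺ e⁻ f⁺ f⁻ → Unit p q α B e⁺ e⁻ → Unit p r β C f⁺ f⁻ →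
    TwoSided p (sum (λ i → X (L + i) + X (L + q + r + i)) p) (sum (λ i → X (L + q + i) + X (L + r + i)) p)
  ordered-bound e⁺ e⁻ f⁺ f⁻ U V = go e⁺ e⁻ f⁺ f⁻ (Unit.±1 U) (Unit.±1 V) U V
    where
    flip : ∀ (f g : ℕ → ℕ) → sum (λ i → f i + g i) p ≡ sum (λ i → g i + f i) p
    flip f g = sum-cong (λ i → +-comm (f i) (g i)) p
    bound : ∀ {e⁺ e⁻ f⁺ f⁻} (U : Unit p q α B e⁺ e⁻) (V : Unit p r β C f⁺ f⁻) (Ws : Windows p q r lo hi e⁺ e⁻ f⁺ f⁻) →
      let open Windows Ws in
      TwoSided p (sum (λ i → X (W + i) + X (W₁₂ + i)) p) (sum (λ i → X (W₁ + i) + X (W₂ + i)) p)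
    bound U V Ws = case window-bound S U V Ws pp p≤q p≤r 0<α α≤β 2β≤p of λ { (u , l) → two-sided u l }
    go : ∀ e⁺ e⁻ f⁺ f⁻ → e⁺ + e⁻ ≡ 1 → f⁺ + f⁻ ≡ 1 → Unit p q α B e⁺ e⁻ → Unit p r β C f⁺ f⁻ →
      TwoSided p (sum (λ i → X (L + i) + X (L + q + r + i)) p) (sum (λ i → X (L + q + i) + X (L + r + i)) p)
    go 1 0 1 0 _ _ U V = subst₂ (TwoSided p) (flip (λ i → X (L + q + r + i)) (λ i → X (L + i))) refl
      (bound U V record { W = L + q + r ; W₁ = L + q ; W₂ = L + r ; W₁₂ = L
        ; lo≤W = ≤-trans lo≤L (entail (L ∷ q ∷ r ∷ []) (‵ 1) (# 0) (# 0 ⊕ # 1 ⊕ # 2) ([]) refl (tt)) ; W-hi = L-hi ; W₁-hi = hi-q ; W₂-hi = hi-r ; W₁₂-hi = hi₀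
        ; W₁-r = (identity (L ∷ q ∷ r ∷ []) (# 0 ⊕ # 1 ⊕ (# 2 ⊕ ‵ 0)) (# 0 ⊕ # 1 ⊕ # 2 ⊕ ‵ 0) refl) ; W₂-q = (identity
          (L ∷ r ∷ q ∷ []) (# 0 ⊕ # 1 ⊕ (# 2 ⊕ ‵ 0)) (# 0 ⊕ # 2 ⊕ # 1 ⊕ ‵ 0) refl) ; W₁₂-q = (identity (L ∷ q ∷ []) (# 0
            ⊕ (# 1 ⊕ ‵ 0)) (# 0 ⊕ # 1 ⊕ ‵ 0) refl) })
    go 0 1 0 1 _ _ U V = subst₂ (TwoSided p) refl (flip (λ i → X (L + r + i)) (λ i → X (L + q + i)))
      (bound U V record { W = L ; W₁ = L + r ; W₂ = L + q ; W₁₂ = L + q + r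
        ; lo≤W = lo≤L ; W-hi = hi₀ ; W₁-hi = hi-r ; W₂-hi = hi-q ; W₁₂-hi = L-hi
        ; W₁-r = (identity (L ∷ r ∷ []) (# 0 ⊕ # 1 ⊕ ‵ 0) (# 0 ⊕ (# 1 ⊕ ‵ 0)) refl) ; W₂-q = (identity (L ∷ q ∷ []) (# 0
          ⊕ # 1 ⊕ ‵ 0) (# 0 ⊕ (# 1 ⊕ ‵ 0)) refl) ; W₁₂-q = (identity (L ∷ q ∷ r ∷ []) (# 0 ⊕ # 1 ⊕ # 2 ⊕ ‵ 0) (# 0 ⊕ # 2
            ⊕ (# 1 ⊕ ‵ 0)) refl) })
    go 1 0 0 1 _ _ U V = subst₂ (TwoSided p) refl (flip (λ i → X (L + r + i)) (λ i → X (L + q + i)))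
      (TwoSided-sym (bound U V record { W = L + r ; W₁ = L ; W₂ = L + q + r ; W₁₂ = L + q
        ; lo≤W = ≤-trans lo≤L (entail (L ∷ r ∷ []) (‵ 1) (# 0) (# 0 ⊕ # 1) ([]) refl (tt)) ; W-hi = hi-r ; W₁-hi = hi₀ ; W₂-hi = L-hi ; W₁₂-hi = hi-q
        ; W₁-r = (identity (L ∷ r ∷ []) (# 0 ⊕ (# 1 ⊕ ‵ 0)) (# 0 ⊕ # 1 ⊕ ‵ 0) refl) ; W₂-q = (identity (L ∷ q ∷ r ∷ [])
          (# 0 ⊕ # 1 ⊕ # 2 ⊕ ‵ 0) (# 0 ⊕ # 2 ⊕ (# 1 ⊕ ‵ 0)) refl) ; W₁₂-q = (identity (L ∷ q ∷ []) (# 0 ⊕ # 1 ⊕ ‵ 0) (#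
            0 ⊕ (# 1 ⊕ ‵ 0)) refl) }))
    go 0 1 1 0 _ _ U V = subst₂ (TwoSided p) (flip (λ i → X (L + q + r + i)) (λ i → X (L + i))) refl
      (TwoSided-sym (bound U V record { W = L + q ; W₁ = L + q + r ; W₂ = L ; W₁₂ = L + r
        ; lo≤W = ≤-trans lo≤L (entail (L ∷ q ∷ []) (‵ 1) (# 0) (# 0 ⊕ # 1) ([]) refl (tt)) ; W-hi = hi-q ; W₁-hi = L-hi ; W₂-hi = hi₀ ; W₁₂-hi = hi-r
        ; W₁-r = (identity (L ∷ q ∷ r ∷ []) (# 0 ⊕ # 1 ⊕ # 2 ⊕ ‵ 0) (# 0 ⊕ # 1 ⊕ (# 2 ⊕ ‵ 0)) refl) ; W₂-q = (identity
          (L ∷ q ∷ []) (# 0 ⊕ (# 1 ⊕ ‵ 0)) (# 0 ⊕ # 1 ⊕ ‵ 0) refl) ; W₁₂-q = (identity (L ∷ r ∷ q ∷ []) (# 0 ⊕ # 1 ⊕ (#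
            2 ⊕ ‵ 0)) (# 0 ⊕ # 2 ⊕ # 1 ⊕ ‵ 0) refl) }))


open import Data.Integer using (ℤ; +_; -_) renaming (_+_ to _+ᶻ_; _*_ to _*ᶻ_; _-_ to _-ᶻ_; ∣_∣ to abs)
import Data.Integer.Properties as ℤ
open import Algebra.Properties.AbelianGroup ℤ.+-0-abelianGroup using () renaming (∙-cancelʳ to +ᶻ-cancelʳ)
open import Data.Integer.Solver using (module +-*-Solver)
open +-*-Solver using (solve; _:=_; _:+_; _:*_; :-_; con)

-- Polynomials acting on sequences

Seq : Set
Seq = ℕ → ℤ

shift : Seq → Seq
shift s zero    = + 0
shift s (suc n) = s n

δ₀ : Seq
δ₀ zero    = + 1
δ₀ (suc _) = + 0

infixr 7 _⊛_
_⊛_ : Poly → Seq → Seq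
([]      ⊛ s) n = + 0
((a ∷ l) ⊛ s) n = a *ᶻ s n +ᶻ shift (l ⊛ s) n

coef : Poly → Seq
coef []      n       = + 0
coef (a ∷ l) zero    = a
coef (a ∷ l) (suc n) = coef l n

Agree : ℕ → Seq → Seq → Set
Agree k s t = ∀ n → n < k → s n ≡ t n

shift-cong : ∀ {s t} → s ≗ t → shift s ≗ shift t
shift-cong e zero    = refl
shift-cong e (suc n) = e n

shift-agree : ∀ {k s t} → Agree k s t → Agree (suc k) (shift s) (shift t)
shift-agree e zero    _   = refl
shift-agree e (suc n) n<k = e n (s≤s⁻¹ n<k)

shift-+ : ∀ {s t u : Seq} → (∀ n → u n ≡ s n +ᶻ t n) → ∀ n → shift u n ≡ shift s n +ᶻ shift t n
shift-+ e zero    = refl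
shift-+ e (suc n) = e n

shift-* : ∀ c {s t : Seq} → (∀ n → t n ≡ c *ᶻ s n) → ∀ n → shift t n ≡ c *ᶻ shift s n
shift-* c e zero    = sym (ℤ.*-zeroʳ c)
shift-* c e (suc n) = e n

⊛-agree : ∀ l {k s t} → Agree k s t → Agree k (l ⊛ s) (l ⊛ t)
⊛-agree []      e n n<k = refl
⊛-agree (a ∷ l) e n n<k = cong₂ (λ x y → a *ᶻ x +ᶻ y) (e n n<k) (shift-agree (⊛-agree l e) n (m<n⇒m<1+n n<k))

⊛-cong : ∀ l {s t} → s ≗ t → l ⊛ s ≗ l ⊛ t
⊛-cong l e n = ⊛-agree l {suc n} (λ m _ → e m) n ≤-refl

⊛-+ₚ : ∀ p q s n → ((p +ₚ q) ⊛ s) n ≡ (p ⊛ s) n +ᶻ (q ⊛ s) n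
⊛-+ₚ []      q       s n = sym (ℤ.+-identityˡ _)
⊛-+ₚ (a ∷ p) []      s n = sym (ℤ.+-identityʳ _)
⊛-+ₚ (a ∷ p) (b ∷ q) s n = trans (cong (λ y → (a +ᶻ b) *ᶻ s n +ᶻ y) (shift-+ (⊛-+ₚ p q s) n))
  (solve 5 (λ a b x u v → (a :+ b) :* x :+ (u :+ v) := a :* x :+ u :+ (b :* x :+ v)) refl
    a b (s n) (shift (p ⊛ s) n) (shift (q ⊛ s) n))

⊛-scale : ∀ c p s n → (scale c p ⊛ s) n ≡ c *ᶻ (p ⊛ s) n
⊛-scale c []      s n = sym (ℤ.*-zeroʳ c)
⊛-scale c (a ∷ p) s n = trans (cong (λ y → c *ᶻ a *ᶻ s n +ᶻ y) (shift-* c (⊛-scale c p s) n))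
  (solve 4 (λ c a x u → c :* a :* x :+ c :* u := c :* (a :* x :+ u)) refl c a (s n) (shift (p ⊛ s) n))

0∷-⊛ : ∀ l s n → ((+ 0 ∷ l) ⊛ s) n ≡ shift (l ⊛ s) n
0∷-⊛ l s n = ℤ.+-identityˡ _

⊛-*ₚ : ∀ p q s → (p *ₚ q) ⊛ s ≗ p ⊛ q ⊛ s
⊛-*ₚ []      q s n = refl
⊛-*ₚ (a ∷ p) q s n = trans (⊛-+ₚ (scale a q) (+ 0 ∷ p *ₚ q) s n)
  (cong₂ _+ᶻ_ (⊛-scale a q s n) (trans (0∷-⊛ (p *ₚ q) s n) (shift-cong (⊛-*ₚ p q s) n)))

⊛-linear : ∀ p c s t n → (p ⊛ (λ m → c *ᶻ s m +ᶻ t m)) n ≡ c *ᶻ (p ⊛ s) n +ᶻ (p ⊛ t) n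
⊛-linear []      c s t n = sym (trans (ℤ.+-identityʳ _) (ℤ.*-zeroʳ c))
⊛-linear (a ∷ p) c s t n = trans (cong (λ y → a *ᶻ (c *ᶻ s n +ᶻ t n) +ᶻ y) (trans
    (shift-+ (⊛-linear p c s t) n) (cong (_+ᶻ shift (p ⊛ t) n) (shift-* c (λ _ → refl) n))))
  (solve 6 (λ a c x y u v → a :* (c :* x :+ y) :+ (c :* u :+ v) := c :* (a :* x :+ u) :+ (a :* y :+ v)) refl
    a c (s n) (t n) (shift (p ⊛ s) n) (shift (p ⊛ t) n))

⊛-shift : ∀ p s → p ⊛ shift s ≗ shift (p ⊛ s)
⊛-shift []      s zero    = refl
⊛-shift []      s (suc n) = refl
⊛-shift (a ∷ p) s zero    = trans (ℤ.+-identityʳ _) (ℤ.*-zeroʳ a)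
⊛-shift (a ∷ p) s (suc n) = cong (a *ᶻ s n +ᶻ_) (⊛-shift p s n)

⊛-comm : ∀ p q s → p ⊛ q ⊛ s ≗ q ⊛ p ⊛ s
⊛-comm []      q s n = sym (zero-out q n)
  where
  zero-out : ∀ l n → (l ⊛ ([] ⊛ s)) n ≡ + 0
  zero-out []      n       = refl
  zero-out (a ∷ l) zero    = trans (ℤ.+-identityʳ _) (ℤ.*-zeroʳ a)
  zero-out (a ∷ l) (suc n) = cong₂ _+ᶻ_ (ℤ.*-zeroʳ a) (zero-out l n)
⊛-comm (a ∷ p) q s n = sym (trans (⊛-linear q a s (shift (p ⊛ s)) n)
  (cong (a *ᶻ (q ⊛ s) n +ᶻ_) (trans (⊛-shift q (p ⊛ s) n) (shift-cong (λ m → sym (⊛-comm p q s m)) n))))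

⊛-δ₀ : ∀ l → l ⊛ δ₀ ≗ coef l
⊛-δ₀ []      n       = refl
⊛-δ₀ (a ∷ l) zero    = trans (ℤ.+-identityʳ _) (ℤ.*-identityʳ a)
⊛-δ₀ (a ∷ l) (suc n) = trans (cong₂ _+ᶻ_ (ℤ.*-zeroʳ a) (⊛-δ₀ l n)) (ℤ.+-identityˡ _)

-- Lists may differ by trailing zeros; the action sees coefficients only.
⊛-coef : ∀ p q s → coef p ≗ coef q → p ⊛ s ≗ q ⊛ s
⊛-coef []      []      s e n = refl
⊛-coef []      (b ∷ q) s e n rewrite sym (e 0) = trans (sym (ℤ.+-identityˡ (+ 0))) (cong (+ 0 +ᶻ_)
  (trans (shift-[] n) (shift-cong (⊛-coef [] q s (λ m → e (suc m))) n)))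
  where shift-[] : ∀ n → + 0 ≡ shift ([] ⊛ s) n
        shift-[] zero    = refl
        shift-[] (suc n) = refl
⊛-coef (a ∷ p) []      s e n rewrite e 0 = cong (+ 0 +ᶻ_)
  (trans (shift-cong (⊛-coef p [] s (λ m → e (suc m))) n) (shift-[] n))
  where shift-[] : ∀ n → shift ([] ⊛ s) n ≡ + 0
        shift-[] zero    = refl
        shift-[] (suc n) = refl
⊛-coef (a ∷ p) (b ∷ q) s e n = cong₂ (λ x y → x *ᶻ s n +ᶻ y) (e 0) (shift-cong (⊛-coef p q s (λ m → e (suc m))) n)

coef-*ₚ : ∀ p q → coef (p *ₚ q) ≗ p ⊛ coef q
coef-*ₚ p q n = trans (sym (⊛-δ₀ (p *ₚ q) n)) (trans (⊛-*ₚ p q δ₀ n) (⊛-cong p (⊛-δ₀ q) n))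

coef-+ₚ : ∀ p q n → coef (p +ₚ q) n ≡ coef p n +ᶻ coef q n
coef-+ₚ p q n = trans (sym (⊛-δ₀ (p +ₚ q) n)) (trans (⊛-+ₚ p q δ₀ n) (cong₂ _+ᶻ_ (⊛-δ₀ p n) (⊛-δ₀ q n)))

coef-scale : ∀ c p n → coef (scale c p) n ≡ c *ᶻ coef p n
coef-scale c p n = trans (sym (⊛-δ₀ (scale c p) n)) (trans (⊛-scale c p δ₀ n) (cong (c *ᶻ_) (⊛-δ₀ p n)))

coef-head0 : ∀ p → coef p 0 ≡ head0 p
coef-head0 []      = refl
coef-head0 (_ ∷ _) = refl

coef-tail0 : ∀ p n → coef (tail0 p) n ≡ coef p (suc n)
coef-tail0 []      n = refl
coef-tail0 (_ ∷ _) n = refl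

coef-≥ : ∀ p {n} → length p ≤ n → coef p n ≡ + 0
coef-≥ []      _         = refl
coef-≥ (_ ∷ p) (s≤s le) = coef-≥ p le

Unital : Poly → Set
Unital p = head0 p *ᶻ head0 p ≡ + 1

head0-*ₚ : ∀ p q → head0 (p *ₚ q) ≡ head0 p *ᶻ head0 q
head0-*ₚ []      q = refl
head0-*ₚ (a ∷ p) q = trans (sym (coef-head0 ((a ∷ p) *ₚ q))) (trans (coef-*ₚ (a ∷ p) q 0)
  (trans (ℤ.+-identityʳ _) (cong (a *ᶻ_) (coef-head0 q))))

unital-* : ∀ {p q} x → Unital p → Unital q → x ≡ head0 p *ᶻ head0 q → x *ᶻ x ≡ + 1
unital-* {p} {q} _ u v refl = trans
  (solve 2 (λ a b → a :* b :* (a :* b) := a :* a :* (b :* b)) refl (head0 p) (head0 q)) (cong₂ _*ᶻ_ u v)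

unital-*ₚ : ∀ p q → Unital p → Unital q → Unital (p *ₚ q)
unital-*ₚ p q u v = unital-* {p} {q} _ u v (head0-*ₚ p q)

unital-divLow : ∀ k f g → Unital f → Unital g → Unital (divLow (suc k) f g)
unital-divLow k f g uf ug = unital-* {f} {g} _ uf ug refl

-- A constant term ±1 is its own inverse, which justifies the coefficient c. Only the first k
-- coefficients are controlled; exactness of a division is a separate question.
divLow-spec : ∀ k f g → Unital g → Agree k (g ⊛ coef (divLow k f g)) (coef f)
divLow-spec (suc k) f g ug n n<k = trans (trans (⊛-cong g split n) (⊛-linear g c δ₀ (shift (coef φ)) n))
    (trans (cong₂ (λ x y → c *ᶻ x +ᶻ y) (⊛-δ₀ g n) (⊛-shift g (coef φ) n)) (go n n<k))
  where
  c = head0 f *ᶻ head0 g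
  f′ = f +ₚ scale (- c) g
  φ = divLow k (tail0 f′) g
  split : coef (c ∷ φ) ≗ λ m → c *ᶻ δ₀ m +ᶻ shift (coef φ) m
  split zero    = sym (trans (ℤ.+-identityʳ _) (ℤ.*-identityʳ c))
  split (suc m) = sym (trans (cong (_+ᶻ coef φ m) (ℤ.*-zeroʳ c)) (ℤ.+-identityˡ _))
  go : ∀ n → n < suc k → c *ᶻ coef g n +ᶻ shift (g ⊛ coef φ) n ≡ coef f n
  go zero _ = trans (ℤ.+-identityʳ _) (trans (cong (c *ᶻ_) (coef-head0 g))
    (trans (ℤ.*-assoc (head0 f) (head0 g) (head0 g)) (trans (cong (head0 f *ᶻ_) ug) (trans (ℤ.*-identityʳ _) (sym (coef-head0 f))))))
  go (suc n) n<k = trans (cong (c *ᶻ coef g (suc n) +ᶻ_) (trans (divLow-spec k (tail0 f′) g ug n (s≤s⁻¹ n<k))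
      (trans (coef-tail0 f′ n) (trans (coef-+ₚ f (scale (- c) g) (suc n)) (cong (coef f (suc n) +ᶻ_) (coef-scale (- c) g (suc n)))))))
    (solve 3 (λ c x y → c :* x :+ (y :+ (:- c) :* x) := y) refl c (coef g (suc n)) (coef f (suc n)))

length-divLow : ∀ k f g → length (divLow k f g) ≡ k
length-divLow zero    f g = refl
length-divLow (suc k) f g = cong suc (length-divLow k _ g)

-- Induction on the degree: once the lower terms agree, only the constant term of g, which is ±1,
-- still multiplies s n and t n.
⊛-cancel : ∀ g {k s t} → Unital g → Agree k (g ⊛ s) (g ⊛ t) → Agree k s t
⊛-cancel []      {k}     () e
⊛-cancel (b ∷ g) {suc k} {s} {t} u e n n<1+k with m≤n⇒m<n∨m≡n (s≤s⁻¹ n<1+k)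
... | inj₁ n<k  = ⊛-cancel (b ∷ g) u (λ m m<k → e m (m<n⇒m<1+n m<k)) n n<k
... | inj₂ refl = trans (sym (unit (s n))) (trans (cong (b *ᶻ_) b*s≡b*t) (unit (t n)))
  where
  unit : ∀ x → b *ᶻ (b *ᶻ x) ≡ x
  unit x = trans (sym (ℤ.*-assoc b b x)) (trans (cong (_*ᶻ x) u) (ℤ.*-identityˡ x))
  below : Agree n s t
  below = ⊛-cancel (b ∷ g) u (λ m m<n → e m (m<n⇒m<1+n m<n))
  b*s≡b*t : b *ᶻ s n ≡ b *ᶻ t n
  b*s≡b*t = +ᶻ-cancelʳ (shift (g ⊛ s) n) (b *ᶻ s n) (b *ᶻ t n) (trans (e n n<1+k)
    (cong (b *ᶻ t n +ᶻ_) (sym (shift-agree (⊛-agree g below) n (n<1+n n)))))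

delay : ℕ → Seq → Seq
delay zero    s = s
delay (suc d) s = shift (delay d s)

xPow-⊛ : ∀ m s n → (xPowMinusOne (suc m) ⊛ s) n ≡ delay (suc m) s n -ᶻ s n
xPow-⊛ m s n = trans (cong₂ _+ᶻ_ (ℤ.-1*i≡-i (s n)) (shift-cong (monomial m) n)) (ℤ.+-comm (- s n) _)
  where
  monomial : ∀ m → (replicate m (+ 0) ++ [ + 1 ]) ⊛ s ≗ delay m s
  monomial zero    zero    = trans (ℤ.+-identityʳ _) (ℤ.*-identityˡ (s 0))
  monomial zero    (suc n) = trans (ℤ.+-identityʳ _) (ℤ.*-identityˡ (s (suc n)))
  monomial (suc m) n       = trans (0∷-⊛ (replicate m (+ 0) ++ [ + 1 ]) s n) (shift-cong (monomial m) n)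

delay-< : ∀ d s {n} → n < d → delay d s n ≡ + 0
delay-< (suc d) s {zero}  _         = refl
delay-< (suc d) s {suc n} (s≤s n<d) = delay-< d s n<d

delay-+ : ∀ d s n → delay d s (d + n) ≡ s n
delay-+ zero    s n = refl
delay-+ (suc d) s n = delay-+ d s n

-- Cyclotomic polynomials

prodΦ : List ℕ → Poly
prodΦ []       = [ + 1 ]
prodΦ (d ∷ ds) = Φ d *ₚ prodΦ ds

-- The product as iterated action, so that reordering factors is a permutation of the list.
acts : List ℕ → Seq → Seq
acts []       s = s
acts (d ∷ ds) s = Φ d ⊛ acts ds s

prodΦ-⊛ : ∀ ds s → prodΦ ds ⊛ s ≗ acts ds s
prodΦ-⊛ [] s zero    = trans (ℤ.+-identityʳ _) (ℤ.*-identityˡ (s 0))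
prodΦ-⊛ [] s (suc n) = trans (ℤ.+-identityʳ _) (ℤ.*-identityˡ (s (suc n)))
prodΦ-⊛ (d ∷ ds) s n = trans (⊛-*ₚ (Φ d) (prodΦ ds) s n) (⊛-cong (Φ d) (prodΦ-⊛ ds s) n)

acts-cong : ∀ ds {s t} → s ≗ t → acts ds s ≗ acts ds t
acts-cong []       e = e
acts-cong (d ∷ ds) e = ⊛-cong (Φ d) (acts-cong ds e)

acts-↭ : ∀ {ds es} → ds ↭ es → ∀ s → acts ds s ≗ acts es s
acts-↭ ↭-refl s n = refl
acts-↭ (prep d π) s n = ⊛-cong (Φ d) (acts-↭ π s) n
acts-↭ {_ ∷ _ ∷ ds} (↭-swap d e π) s n = trans (⊛-comm (Φ d) (Φ e) (acts ds s) n) (⊛-cong (Φ e) (⊛-cong (Φ d) (acts-↭ π s)) n)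
acts-↭ (↭-trans π ρ) s n = trans (acts-↭ π s n) (acts-↭ ρ s n)

unital-prodΦ : ∀ {ds} → All (Unital ∘ Φ) ds → Unital (prodΦ ds)
unital-prodΦ []                 = refl
unital-prodΦ {d ∷ ds} (u ∷ us) = unital-*ₚ (Φ d) (prodΦ ds) u (unital-prodΦ us)

unital⇒nonempty : ∀ p → Unital p → 0 < length p
unital⇒nonempty (_ ∷ _) _ = s≤s z≤n

length-+ₚ : ∀ p q → length (p +ₚ q) ≡ length p ⊔ length q
length-+ₚ []      q       = refl
length-+ₚ (a ∷ p) []      = refl
length-+ₚ (a ∷ p) (b ∷ q) = cong suc (length-+ₚ p q)

length-*ₚ : ∀ p q → 0 < length p → 0 < length q → suc (length (p *ₚ q)) ≡ length p + length q
length-*ₚ (a ∷ p) q _ 0<q = cong suc (trans (length-+ₚ (scale a q) (+ 0 ∷ p *ₚ q)) (trans (cong (_⊔ suc (length (p *ₚ q))) (length-map (a *ᶻ_) q)) (go p)))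
  where
  go : ∀ p → length q ⊔ suc (length (p *ₚ q)) ≡ length p + length q
  go []         = m≥n⇒m⊔n≡m 0<q
  go p′@(b ∷ p) = trans (cong (length q ⊔_) (length-*ₚ p′ q (s≤s z≤n) 0<q)) (m≤n⇒m⊔n≡n (m≤n+m (length q) (length p′)))

degree : ℕ → ℕ
degree d = pred (length (Φ d))

length-prodΦ : ∀ {ds} → All (Unital ∘ Φ) ds → length (prodΦ ds) ≡ suc (sumᴸ (map degree ds))
length-prodΦ [] = refl
length-prodΦ {d ∷ ds} (u ∷ us) = suc-injective (begin
  suc (length (Φ d *ₚ prodΦ ds))                    ≡⟨ length-*ₚ (Φ d) (prodΦ ds) 0<Φ (unital⇒nonempty (prodΦ ds) (unital-prodΦ us)) ⟩
  length (Φ d) + length (prodΦ ds)                  ≡⟨ cong₂ _+_ (sym (suc-pred _ {{>-nonZero 0<Φ}})) (length-prodΦ us) ⟩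
  suc (degree d) + suc (sumᴸ (map degree ds))       ≡⟨ +-suc (suc (degree d)) _ ⟩
  suc (suc (degree d + sumᴸ (map degree ds)))       ∎)
  where open ≡-Reasoning
        0<Φ = unital⇒nonempty (Φ d) u

ramp : ℕ → ℕ → List ℕ
ramp i zero    = []
ramp i (suc n) = i ∷ ramp (suc i) n

ramp-∷ʳ : ∀ i n → ramp i (suc n) ≡ ramp i n ++ [ i + n ]
ramp-∷ʳ i zero    = cong [_] (sym (+-identityʳ i))
ramp-∷ʳ i (suc n) = cong (i ∷_) (trans (ramp-∷ʳ (suc i) n) (cong (λ x → ramp (suc i) n ++ [ x ]) (sym (+-suc i n))))

∈-ramp⁺ : ∀ {i n x} → i ≤ x → x < i + n → x ∈ ramp i n
∈-ramp⁺ {i} {zero}  i≤x x< = ⊥-elim (<⇒≱ x< (subst (_≤ _) (sym (+-identityʳ i)) i≤x))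
∈-ramp⁺ {i} {suc n} {x} i≤x x< with m≤n⇒m<n∨m≡n i≤x
... | inj₂ refl = here refl
... | inj₁ i<x  = there (∈-ramp⁺ i<x (subst (x <_) (+-suc i n) x<))

∈-ramp⁻ : ∀ {i n x} → x ∈ ramp i n → i ≤ x × x < i + n
∈-ramp⁻ {i} {suc n} (here refl) = ≤-refl , m<m+n i (s≤s z≤n)
∈-ramp⁻ {i} {suc n} (there m)   with ∈-ramp⁻ {suc i} {n} m
... | i<x , x< = <⇒≤ i<x , ≤-trans x< (≤-reflexive (sym (+-suc i n)))

ramp-unique : ∀ i n → Unique (ramp i n)
ramp-unique i zero    = []
ramp-unique i (suc n) = All.tabulate (λ m i≡x → <⇒≢ (proj₁ (∈-ramp⁻ {suc i} {n} m)) i≡x) ∷ ramp-unique (suc i) n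

cycloTable-ramp : ∀ n → cycloTable n ≡ map Φ (ramp 1 n)
cycloTable-ramp zero    = refl
cycloTable-ramp (suc n) = trans (cong (_++ [ Φ (suc n) ]) (cycloTable-ramp n))
  (sym (trans (cong (map Φ) (ramp-∷ʳ 1 n)) (map-++ Φ (ramp 1 n) [ suc n ])))

divisors : ℕ → List ℕ
divisors m = filter (_∣? m) (ramp 1 (pred m))

prodDiv-prodΦ : ∀ m i n → prodDiv m i (map Φ (ramp i n)) ≡ prodΦ (filter (_∣? m) (ramp i n))
prodDiv-prodΦ m i zero    = refl
prodDiv-prodΦ m i (suc n) with does (i ∣? m)
... | true  = cong (Φ i *ₚ_) (prodDiv-prodΦ m (suc i) n)
... | false = prodDiv-prodΦ m (suc i) n

Φ-quotient : ∀ m {{_ : NonZero m}} → Φ m ≡ divLow (2 + m ∸ length (prodΦ (divisors m))) (xPowMinusOne m) (prodΦ (divisors m))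
Φ-quotient (suc n) = cong (λ g → divLow (3 + n ∸ length g) (xPowMinusOne (suc n)) g)
  (trans (cong (prodDiv (suc n) 1) (cycloTable-ramp n)) (prodDiv-prodΦ (suc n) 1 n))

divisors-↭ : ∀ {m ds} → 0 < m → Unique ds → All (λ d → d ∣ m × d < m) ds → (∀ {d} → d ∣ m → d < m → d ∈ ds) → divisors m ↭ ds
divisors-↭ {m@(suc n)} {ds} _ uniq sound complete = ∼bag⇒↭ (unique∧set⇒bag (filter⁺ (_∣? m) (ramp-unique 1 n)) uniq (mk⇔ to from))
  where
  to : ∀ {d} → d ∈ divisors m → d ∈ ds
  to d∈ with ∈-filter⁻ (_∣? m) {xs = ramp 1 n} d∈
  ... | d∈ramp , d∣m = complete d∣m (proj₂ (∈-ramp⁻ d∈ramp))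
  from : ∀ {d} → d ∈ ds → d ∈ divisors m
  from {d} d∈ with All.lookup sound d∈
  ... | d∣m , d<m = ∈-filter⁺ (_∣? m) (∈-ramp⁺ (positive d∣m) d<m) d∣m
    where positive : ∀ {d} → d ∣ suc n → 1 ≤ d
          positive {zero}  0∣m = ⊥-elim (0≢1+n (sym (0∣⇒≡0 0∣m)))
          positive {suc _} _   = s≤s z≤n

-- The recursion that defines Φ m, with its filtered list of proper divisors exchanged for any
-- convenient permutation.
module Quotient {m ds} (0<m : 0 < m) (ds-↭ : divisors m ↭ ds) (us : All (Unital ∘ Φ) ds) where
  private
    instance
      m≢0 : NonZero m
      m≢0 = >-nonZero 0<m
    g = prodΦ (divisors m)
    us′ : All (Unital ∘ Φ) (divisors m)
    us′ = All-resp-↭ (↭-sym ds-↭) us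
    unital-xPow : ∀ {m} → 0 < m → Unital (xPowMinusOne m)
    unital-xPow (s≤s _) = refl

  Φ-length : length (Φ m) ≡ suc m ∸ sumᴸ (map degree ds)
  Φ-length = trans (trans (cong length (Φ-quotient m)) (length-divLow (2 + m ∸ length g) _ _))
    (cong (2 + m ∸_) (trans (length-prodΦ us′) (cong suc (sum-↭ (map⁺ degree ds-↭)))))

  Φ-unital : sumᴸ (map degree ds) ≤ m → Unital (Φ m)
  Φ-unital le = subst Unital (sym (Φ-quotient m)) (go (2 + m ∸ length g) refl)
    where
    go : ∀ k → k ≡ 2 + m ∸ length g → Unital (divLow k (xPowMinusOne m) g)
    go zero e = ⊥-elim (<⇒≱ (m<n⇒0<n∸m {sumᴸ (map degree ds)} (s≤s le)) (≤-reflexive (trans (sym (trans (sym (length-divLow _ _ g)) (trans (cong length (sym (Φ-quotient m))) Φ-length))) (sym e))))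
    go (suc k) e = unital-divLow k (xPowMinusOne m) g (unital-xPow 0<m) (unital-prodΦ us′)

  acts-Φ : Agree (length (Φ m)) (acts ds (coef (Φ m))) (coef (xPowMinusOne m))
  acts-Φ n n< = trans (sym (acts-↭ ds-↭ (coef (Φ m)) n)) (trans (sym (prodΦ-⊛ (divisors m) (coef (Φ m)) n))
    (trans (cong (λ φ → (g ⊛ coef φ) n) (Φ-quotient m))
      (divLow-spec (2 + m ∸ length g) (xPowMinusOne m) g (unital-prodΦ us′) n
        (subst (n <_) (trans (cong length (Φ-quotient m)) (length-divLow _ _ g)) n<))))

  -- As far as the computed length reaches, both sequences become x^m - 1 under the same cancellable
  -- product.
  Φ-unique : ∀ {h} → Agree (length (Φ m)) (acts ds h) (coef (xPowMinusOne m)) → Agree (length (Φ m)) (coef (Φ m)) h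
  Φ-unique {h} e = ⊛-cancel g (unital-prodΦ us′) λ n n< → trans (trans (prodΦ-⊛ (divisors m) (coef (Φ m)) n) (acts-↭ ds-↭ (coef (Φ m)) n))
    (trans (acts-Φ n n<) (trans (sym (e n n<)) (sym (trans (prodΦ-⊛ (divisors m) h n) (acts-↭ ds-↭ h n)))))

  -- A sequence that solves the equation in all degrees and stops where Φ m stops shows that the
  -- truncated division was exact. Then the factorisation of x^m - 1 may be applied to any sequence.
  module Exact {h : Seq} (h-acts : acts ds h ≗ coef (xPowMinusOne m)) (h-tail : ∀ n → length (Φ m) ≤ n → h n ≡ + 0) where

    Φ-coef : coef (Φ m) ≗ h
    Φ-coef n with n <? length (Φ m)
    ... | yes n< = Φ-unique (λ k _ → h-acts k) n n<
    ... | no n≮  = trans (coef-≥ (Φ m) (≮⇒≥ n≮)) (sym (h-tail n (≮⇒≥ n≮)))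

    Φ-exact : ∀ s → acts ds (Φ m ⊛ s) ≗ xPowMinusOne m ⊛ s
    Φ-exact s n = trans (sym (prodΦ-⊛ ds (Φ m ⊛ s) n)) (trans (sym (⊛-*ₚ (prodΦ ds) (Φ m) s n))
      (⊛-coef (prodΦ ds *ₚ Φ m) (xPowMinusOne m) s (λ k → trans (coef-*ₚ (prodΦ ds) (Φ m) k)
        (trans (⊛-cong (prodΦ ds) Φ-coef k) (trans (prodΦ-⊛ ds h k) (h-acts k)))) n))

xPow-coef : ∀ {m} → 0 < m → ∀ n → coef (xPowMinusOne m) n ≡ delay m δ₀ n -ᶻ δ₀ n
xPow-coef {suc m} _ n = trans (sym (⊛-δ₀ (xPowMinusOne (suc m)) n)) (xPow-⊛ m δ₀ n)

delay-δ₀-refl : ∀ d → delay d δ₀ d ≡ + 1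
delay-δ₀-refl zero    = refl
delay-δ₀-refl (suc d) = delay-δ₀-refl d

delay-δ₀-≢ : ∀ {d n} → n ≢ d → delay d δ₀ n ≡ + 0
delay-δ₀-≢ {zero}  {zero}  n≢d = ⊥-elim (n≢d refl)
delay-δ₀-≢ {zero}  {suc n} _   = refl
delay-δ₀-≢ {suc d} {zero}  _   = refl
delay-δ₀-≢ {suc d} {suc n} n≢d = delay-δ₀-≢ (λ e → n≢d (cong suc e))

ones : ℕ → Poly
ones k = replicate k (+ 1)

ones-telescope : ∀ k n → shift (coef (ones k)) n -ᶻ coef (ones k) n ≡ delay k δ₀ n -ᶻ δ₀ n
ones-telescope zero    zero    = refl
ones-telescope zero    (suc n) = refl
ones-telescope (suc k) zero    = refl
ones-telescope (suc k) (suc n) = trans (cong (_-ᶻ coef (ones k) n) (unfold n))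
  (trans (solve 3 (λ x y z → x :+ y :+ :- z := x :+ (y :+ :- z)) refl (δ₀ n) (shift (coef (ones k)) n) (coef (ones k) n))
  (trans (cong (δ₀ n +ᶻ_) (ones-telescope k n))
         (solve 2 (λ x y → x :+ (y :+ :- x) := y :+ :- con (+ 0)) refl (δ₀ n) (delay k δ₀ n))))
  where
  unfold : ∀ n → coef (ones (suc k)) n ≡ δ₀ n +ᶻ shift (coef (ones k)) n
  unfold zero    = refl
  unfold (suc n) = sym (ℤ.+-identityˡ _)

xPow-⊛-> : ∀ {d} → 0 < d → ∀ s n → (xPowMinusOne d ⊛ s) n ≡ delay d s n -ᶻ s n
xPow-⊛-> {suc d} _ = xPow-⊛ d

module PrimeCyclotomic {p : ℕ} (pp : Prime p) where

  1<p : 1 < p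
  1<p = nonTrivial⇒n>1 p {{prime⇒nonTrivial pp}}

  0<p : 0 < p
  0<p = <⇒≤ 1<p

  divisors-prime : divisors p ↭ 1 ∷ []
  divisors-prime = divisors-↭ 0<p ([] ∷ []) ((1∣ p , 1<p) ∷ []) λ d∣p d<p → case prime⇒irreducible pp d∣p of λ where
    (inj₁ refl) → here refl
    (inj₂ refl) → ⊥-elim (<-irrefl refl d<p)

  open Quotient 0<p divisors-prime (refl ∷ []) using () renaming (Φ-length to Φp-length; module Exact to ExactP) public
  Φp-unital : Unital (Φ p)
  Φp-unital = Quotient.Φ-unital 0<p divisors-prime (refl ∷ []) 0<p

  open ExactP {coef (ones p)}
    (λ n → trans (xPow-⊛ 0 (coef (ones p)) n) (trans (ones-telescope p n) (sym (xPow-coef 0<p n))))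
    (λ n le → coef-≥ (ones p) (≤-trans (≤-reflexive (trans (length-replicate p) (sym Φp-length))) le))
    public renaming (Φ-coef to Φp-coef; Φ-exact to Φp-exact)

-- Φ_pq and the numerical semigroup of p and q

𝟙 : ∀ {P : Set} → Dec P → ℤ
𝟙 (yes _) = + 1
𝟙 (no _)  = + 0

𝟙-yes : ∀ {P : Set} (d : Dec P) → P → 𝟙 d ≡ + 1
𝟙-yes (yes _) _ = refl
𝟙-yes (no ¬p) p = ⊥-elim (¬p p)

𝟙-no : ∀ {P : Set} (d : Dec P) → ¬ P → 𝟙 d ≡ + 0
𝟙-no (yes p) ¬p = ⊥-elim (¬p p)
𝟙-no (no _)  _  = refl

-- With x the inverse of q mod p, ψ is minus the indicator of the numerical semigroup ⟨p, q⟩, whose series is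
-- (1 - x^pq) / ((1 - x^p) (1 - x^q)).
module Semigroup {p q x k : ℕ} (1<p : 1 < p) (1<q : 1 < q) (inv : x * q ≡ 1 + k * p) where

  private
    instance
      p≢0 : NonZero p
      p≢0 = >-nonZero (<⇒≤ 1<p)

  -- The j < p with jq ≡ n modulo p. As jq is the least multiple of q in its class, n lies in the
  -- semigroup exactly when jq ≤ n.
  res : ℕ → ℕ
  res n = (n * x) % p

  res<p : ∀ n → res n < p
  res<p n = m%n<n (n * x) p

  res-≡ : ∀ n → res n * q + p * ((n * x) / p * q) ≡ n + p * (n * k)
  res-≡ n = (equate (n ∷ x ∷ (res n) ∷ ((n * x) / p) ∷ p ∷ q ∷ k ∷ []) 1 (# 2 ⊗ # 5 ⊕ # 4 ⊗ (# 3 ⊗ # 5)) (# 0 ⊕ # 4 ⊗ (#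
    0 ⊗ # 6)) ((# 5 , # 2 ⊕ # 3 ⊗ # 4 , # 0 ⊗ # 1) ∷ (# 0 , # 1 ⊗ # 5 , ‵ 1 ⊕ # 6 ⊗ # 4) ∷ []) refl (sym (m≡m%n+[m/n]*n
    (n * x) p) , inv , tt))

  res-+p : ∀ n → res (p + n) ≡ res n
  res-+p n = trans (cong (_% p) (identity (p ∷ n ∷ x ∷ []) ((# 0 ⊕ # 1) ⊗ # 2) (# 1 ⊗ # 2 ⊕ # 2 ⊗ # 0) refl)) ([m+kn]%n≡m%n (n * x) x p)

  res-multiple : ∀ {j} → j < p → res (j * q) ≡ j
  res-multiple {j} j<p = trans (cong (_% p) (equate (x ∷ q ∷ k ∷ p ∷ j ∷ []) 1 (# 4 ⊗ # 1 ⊗ # 0) (# 4 ⊕ # 4 ⊗ # 2 ⊗ # 3)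
    ((# 4 , # 0 ⊗ # 1 , ‵ 1 ⊕ # 2 ⊗ # 3) ∷ []) refl (inv , tt)))
    (trans ([m+kn]%n≡m%n j (j * k) p) (m<n⇒m%n≡m j<p))

  -- θ is the indicator of 0, q, ..., (p - 1)q, which is what the factor x^p - 1 leaves of ψ.
  ψ θ : Seq
  ψ n = - 𝟙 (res n * q ≤? n)
  θ n = 𝟙 (res n * q ≟ n)

  res-close : ∀ n → res n * q ≤ n → n < res n * q + p → res n * q ≡ n
  res-close n u≤n n< = close ((n * x) / p * q) (n * k) u≤n n< (res-≡ n)

  private
    θ-< : ∀ n → n < p → + 0 -ᶻ ψ n ≡ θ n
    θ-< n n<p with res n * q ≤? n | res n * q ≟ n
    ... | yes _   | yes _  = refl
    ... | yes u≤n | no u≢n = ⊥-elim (u≢n (res-close n u≤n (<-≤-trans n<p (m≤n+m p _))))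
    ... | no u≰n  | yes e  = ⊥-elim (u≰n (≤-reflexive e))
    ... | no _    | no _   = refl

    θ-+ : ∀ n → ψ n -ᶻ ψ (p + n) ≡ θ (p + n)
    θ-+ n rewrite res-+p n with res n * q ≤? n | res n * q ≤? p + n | res n * q ≟ p + n
    ... | yes u≤n | yes _  | yes e = ⊥-elim (<⇒≱ (m<n+m n (<⇒≤ 1<p)) (subst (_≤ n) e u≤n))
    ... | yes _   | yes _  | no _  = refl
    ... | yes u≤n | no u≰  | _     = ⊥-elim (u≰ (≤-trans u≤n (m≤n+m n p)))
    ... | no _    | yes _  | yes _ = refl
    ... | no u≰n  | yes u≤ | no u≢ = ⊥-elim (u≢ (trans (cong (_* q) (sym (res-+p n)))
            (res-close (p + n) (subst (λ y → y * q ≤ p + n) (sym (res-+p n)) u≤)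
              (subst (λ y → p + n < y * q + p) (sym (res-+p n)) (subst (p + n <_) (+-comm p _) (+-monoʳ-< p (≰⇒> u≰n)))))))
    ... | no _    | no u≰  | yes e = ⊥-elim (u≰ (≤-reflexive e))
    ... | no _    | no _   | no _  = refl

  xPow-ψ : xPowMinusOne p ⊛ ψ ≗ θ
  xPow-ψ n = trans (xPow-⊛-> (<⇒≤ 1<p) ψ n) (split n)
    where
    split : ∀ n → delay p ψ n -ᶻ ψ n ≡ θ n
    split n with n <? p
    ... | yes n<p = trans (cong (_-ᶻ ψ n) (delay-< p ψ n<p)) (θ-< n n<p)
    ... | no n≮p  = subst (λ m → delay p ψ m -ᶻ ψ m ≡ θ m) (m+[n∸m]≡n (≮⇒≥ n≮p))
      (trans (cong (_-ᶻ ψ (p + (n ∸ p))) (delay-+ p ψ (n ∸ p))) (θ-+ (n ∸ p)))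

  private
    θ-multiple : ∀ {j} → j < p → θ (j * q) ≡ + 1
    θ-multiple {j} j<p = 𝟙-yes (res (j * q) * q ≟ j * q) (cong (_* q) (res-multiple j<p))

    θ-0 : θ 0 ≡ + 1
    θ-0 = θ-multiple (<⇒≤ 1<p)

    0<pq : 0 < p * q
    0<pq = (entail (p ∷ q ∷ []) (‵ 1) (‵ 1 ⊕ ‵ 0) (# 0 ⊗ # 1) ((# 1 , ‵ 1 ⊕ ‵ 1 , # 0) ∷ (‵ 2 , ‵ 1 ⊕ ‵ 1 , # 1) ∷ [])
      refl (1<p , 1<q , tt))

    δ-< : ∀ n → n < q → + 0 -ᶻ θ n ≡ delay (p * q) δ₀ n -ᶻ δ₀ n
    δ-< zero    _   = cong₂ _-ᶻ_ (sym (delay-< (p * q) δ₀ 0<pq)) θ-0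
    δ-< (suc n) n<q = cong₂ _-ᶻ_ (sym (delay-< (p * q) δ₀ (<-≤-trans n<q (m≤n*m q p)))) (𝟙-no (res (suc n) * q ≟ suc n) not)
      where
      not : res (suc n) * q ≢ suc n
      not e with res (suc n)
      ... | zero  = 0≢1+n e
      ... | suc j = <⇒≱ n<q (≤-trans (m≤m+n q (j * q)) (≤-reflexive e))

    δ-+ : ∀ n → θ n -ᶻ θ (q + n) ≡ delay (p * q) δ₀ (q + n)
    δ-+ n = go (res n * q ≟ n) (res (q + n) * q ≟ q + n)
      where
      multiple⇒ : ∀ j {m} → j < p → j * q ≡ m → res m * q ≡ m
      multiple⇒ j j<p refl = cong (_* q) (res-multiple j<p)
      pred-multiple : ∀ j → suc j * q ≡ q + n → j * q ≡ n
      pred-multiple j e = +-cancelˡ-≡ q (j * q) n e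
      go : (d : Dec (res n * q ≡ n)) (d′ : Dec (res (q + n) * q ≡ q + n)) → 𝟙 d -ᶻ 𝟙 d′ ≡ delay (p * q) δ₀ (q + n)
      go (yes e) (yes e′) = sym (delay-δ₀-≢ λ q+n≡pq →
        <⇒≢ (res<p (q + n)) (*-cancelʳ-≡ (res (q + n)) p q {{>-nonZero (<⇒≤ 1<q)}} (trans e′ q+n≡pq)))
      go (yes e) (no ne) = sym (trans (cong (delay (p * q) δ₀) (trans (cong (_+_ q) (sym e)) (cong (_* q) 1+j≡p))) (delay-δ₀-refl (p * q)))
        where
        1+j≡p : suc (res n) ≡ p
        1+j≡p with m≤n⇒m<n∨m≡n (res<p n)
        ... | inj₂ e″ = e″
        ... | inj₁ lt = ⊥-elim (ne (multiple⇒ (suc (res n)) lt (cong (_+_ q) e)))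
      go (no ne) (yes e′) = ⊥-elim (from (res (q + n)) (res<p (q + n)) e′)
        where
        from : ∀ j → j < p → j * q ≡ q + n → ⊥
        from zero    _  e = <⇒≢ (<-≤-trans (<⇒≤ 1<q) (m≤m+n q n)) e
        from (suc j) lt e = ne (multiple⇒ j (<⇒≤ lt) (pred-multiple j e))
      go (no ne) (no _) = sym (delay-δ₀-≢ λ q+n≡pq → ne (multiple⇒ (pred p) (≤-reflexive (suc-pred p))
        (pred-multiple (pred p) (trans (cong (_* q) (suc-pred p)) (sym q+n≡pq)))))

  xPow-θ : xPowMinusOne q ⊛ θ ≗ coef (xPowMinusOne (p * q))
  xPow-θ n = trans (xPow-⊛-> (<⇒≤ 1<q) θ n) (trans (split n) (sym (xPow-coef 0<pq n)))
    where
    split : ∀ n → delay q θ n -ᶻ θ n ≡ delay (p * q) δ₀ n -ᶻ δ₀ n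
    split n with n <? q
    ... | yes n<q = trans (cong (_-ᶻ θ n) (delay-< q θ n<q)) (δ-< n n<q)
    ... | no n≮q  = subst (λ m → delay q θ m -ᶻ θ m ≡ delay (p * q) δ₀ m -ᶻ δ₀ m) (m+[n∸m]≡n (≮⇒≥ n≮q))
      (trans (cong (_-ᶻ θ (q + (n ∸ q))) (delay-+ q θ (n ∸ q)))
      (trans (δ-+ (n ∸ q)) (sym (trans (cong (delay (p * q) δ₀ (q + (n ∸ q)) +ᶻ_) (cong -_ (δ₀-> (m≤m+n q (n ∸ q))))) (ℤ.+-identityʳ _)))))
      where
      δ₀-> : ∀ {m} → q ≤ m → δ₀ m ≡ + 0
      δ₀-> {zero}  le = ⊥-elim (<⇒≱ (<⇒≤ 1<q) le)
      δ₀-> {suc m} _  = refl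

  h : Seq
  h = Φ 1 ⊛ ψ

  -- From (p - 1)(q - 1) on every number lies in the semigroup, so ψ is constant there and the
  -- factor x - 1 annihilates it.
  h-tail : ∀ n → 2 + p * q ≤ p + q + n → h n ≡ + 0
  h-tail zero    le = ⊥-elim (refute (p ∷ q ∷ []) ((‵ 2 , ‵ 2 ⊕ # 0 ⊗ # 1 , # 0 ⊕ # 1 ⊕ ‵ 0) ∷ (# 1 , ‵ 1 ⊕ ‵ 1 , # 0) ∷
    (# 0 , ‵ 1 ⊕ ‵ 1 , # 1) ∷ []) refl (le , 1<p , 1<q , tt))
  h-tail (suc n) le = trans (xPow-⊛ 0 ψ (suc n)) (cong₂ _-ᶻ_ (const n (s≤s⁻¹ (≤-trans le (≤-reflexive (+-suc (p + q) n)))))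
      (const (suc n) (≤-trans (n≤1+n _) le)))
    where
    const : ∀ n → 1 + p * q ≤ p + q + n → ψ n ≡ - (+ 1)
    const n le = cong -_ (𝟙-yes (res n * q ≤? n) (≮⇒≥ λ n<u → ⊥-elim
      (refute (p ∷ q ∷ n ∷ (res n) ∷ []) (# 0 ⊗ # 1 ≺ # 0 ⊕ # 1 ⊕ # 2 ∷ # 2 ⊕ # 0 ≼ # 3 ⊗ # 1 ∷ (# 1 , ‵ 1 ⊕ # 3 , # 0)
        ∷ []) refl (le , far n<u , res<p n , tt))))
      where
      far : n < res n * q → n + p ≤ res n * q
      far n<u = ≮⇒≥ λ u< → <⇒≢ n<u (close (n * k) ((n * x) / p * q) (<⇒≤ n<u) u< (sym (res-≡ n)))

divisor-of-product : ∀ {p m d} → Prime p → d ∣ p * m → d ∣ m ⊎ (∃ λ y → d ≡ p * y × y ∣ m)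
divisor-of-product {p} {m} {d} pp d∣pm with p ∣? d
... | yes (divides y refl) = inj₂ (y , *-comm y p , *-cancelˡ-∣ p {{prime⇒nonZero pp}} (subst (_∣ p * m) (*-comm y p) d∣pm))
... | no p∤d = inj₁ (coprime-divisor coprime d∣pm)
  where
  coprime : Coprime d p
  coprime (i∣d , i∣p) = case prime⇒irreducible pp i∣p of λ where
    (inj₁ i≡1)  → i≡1
    (inj₂ refl) → ⊥-elim (p∤d i∣d)

module PairCyclotomic {p q : ℕ} (pp : Prime p) (pq : Prime q) (p<q : p < q) where

  open PrimeCyclotomic pp
  private
    module Q = PrimeCyclotomic pq

  divisor-pq : ∀ {d} → d ∣ p * q → d ≡ 1 ⊎ d ≡ p ⊎ d ≡ q ⊎ d ≡ p * q
  divisor-pq d∣pq = case divisor-of-product pp d∣pq of λ where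
    (inj₁ d∣q) → case prime⇒irreducible pq d∣q of λ where
      (inj₁ e) → inj₁ e
      (inj₂ e) → inj₂ (inj₂ (inj₁ e))
    (inj₂ (y , refl , y∣q)) → case prime⇒irreducible pq y∣q of λ where
      (inj₁ refl) → inj₂ (inj₁ (*-identityʳ p))
      (inj₂ refl) → inj₂ (inj₂ (inj₂ refl))

  p<pq : p < p * q
  p<pq = (entail (p ∷ q ∷ []) (‵ 1) (‵ 1 ⊕ # 0) (# 0 ⊗ # 1) ((# 1 , ‵ 1 ⊕ ‵ 1 , # 0) ∷ (‵ 2 , ‵ 1 ⊕ # 0 , # 1) ∷ [])
    refl (1<p , p<q , tt))

  q<pq : q < p * q
  q<pq = (entail (p ∷ q ∷ []) (‵ 1) (‵ 1 ⊕ # 1) (# 0 ⊗ # 1) ((# 1 , ‵ 1 ⊕ ‵ 1 , # 0) ∷ ‵ 1 ≺ # 1 ∷ []) refl (1<p , Q.1<p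
    , tt))

  0<pq : 0 < p * q
  0<pq = <-trans 0<p p<pq

  divisors-pq : divisors (p * q) ↭ 1 ∷ p ∷ q ∷ []
  divisors-pq = divisors-↭ 0<pq
    ((<⇒≢ 1<p ∷ <⇒≢ Q.1<p ∷ []) ∷ (<⇒≢ p<q ∷ []) ∷ [] ∷ [])
    ((1∣ (p * q) , <-trans 1<p p<pq) ∷ (m∣m*n q , p<pq) ∷ (n∣m*n p , q<pq) ∷ [])
    λ d∣pq d<pq → case divisor-pq d∣pq of λ where
      (inj₁ refl)                      → here refl
      (inj₂ (inj₁ refl))               → there (here refl)
      (inj₂ (inj₂ (inj₁ refl)))        → there (there (here refl))
      (inj₂ (inj₂ (inj₂ refl)))        → ⊥-elim (<-irrefl refl d<pq)

  private
    module Quo = Quotient 0<pq divisors-pq (refl ∷ Φp-unital ∷ Q.Φp-unital ∷ [])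

    degrees : sumᴸ (map degree (1 ∷ p ∷ q ∷ [])) + 1 ≡ p + q
    degrees = (equate ((degree p) ∷ (pred p) ∷ (degree q) ∷ (pred q) ∷ p ∷ q ∷ []) 1 (‵ 1 ⊕ (# 0 ⊕ (# 2 ⊕ ‵ 0)) ⊕ ‵ 1)
      (# 4 ⊕ # 5) (# 0 ≼ # 1 ∷ # 2 ≼ # 3 ∷ # 1 ≺ # 4 ∷ # 3 ≺ # 5 ∷ []) refl (cong pred Φp-length , cong pred Q.Φp-length
      , suc-pred p {{>-nonZero 0<p}} , suc-pred q {{>-nonZero Q.0<p}} , tt))

    degrees≤ : sumᴸ (map degree (1 ∷ p ∷ q ∷ [])) ≤ p * q
    degrees≤ = (entail ((degree p) ∷ (degree q) ∷ p ∷ q ∷ []) (‵ 2) (‵ 1 ⊕ (# 0 ⊕ (# 1 ⊕ ‵ 0))) (# 2 ⊗ # 3) ((‵ 2 , ‵ 1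
      ⊕ (# 0 ⊕ (# 1 ⊕ ‵ 0)) ⊕ ‵ 1 , # 2 ⊕ # 3) ∷ (# 3 , ‵ 1 ⊕ ‵ 1 , # 2) ∷ (# 2 , ‵ 1 ⊕ ‵ 1 , # 3) ∷ []) refl
      (≤-reflexive degrees , 1<p , Q.1<p , tt))

    length-Φpq : ∀ {n} → length (Φ (p * q)) ≤ n → 2 + p * q ≤ p + q + n
    length-Φpq {n} le = (entail ((degree p) ∷ (degree q) ∷ p ∷ q ∷ (suc (p * q) ∸ sumᴸ (map degree (1 ∷ p ∷ q ∷ []))) ∷
      n ∷ []) (‵ 1) (‵ 2 ⊕ # 2 ⊗ # 3) (# 2 ⊕ # 3 ⊕ # 5) (‵ 1 ⊕ (# 0 ⊕ (# 1 ⊕ ‵ 0)) ⊕ ‵ 1 ≼ # 2 ⊕ # 3 ∷ # 2 ⊗ # 3 ≺ ‵ 1 ⊕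
      (# 0 ⊕ (# 1 ⊕ ‵ 0)) ⊕ # 4 ∷ # 4 ≼ # 5 ∷ []) refl (≤-reflexive degrees , m≤n+m∸n (suc (p * q)) (sumᴸ (map degree (1
      ∷ p ∷ q ∷ []))) , subst (_≤ n) Quo.Φ-length le , tt))

    inv = inverse 1<p (prime⇒coprime pq {{>-nonZero 0<p}} p<q)
    module SG = Semigroup {p} {q} {proj₁ inv} {proj₁ (proj₂ inv)} 1<p Q.1<p (proj₂ (proj₂ inv))

    h-acts : acts (1 ∷ p ∷ q ∷ []) SG.h ≗ coef (xPowMinusOne (p * q))
    h-acts n = begin
      acts (1 ∷ p ∷ q ∷ 1 ∷ []) SG.ψ n                      ≡⟨ Φp-exact (acts (q ∷ 1 ∷ []) SG.ψ) n ⟩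
      (xPowMinusOne p ⊛ acts (q ∷ 1 ∷ []) SG.ψ) n           ≡⟨ ⊛-cong (xPowMinusOne p) (⊛-comm (Φ q) (Φ 1) SG.ψ) n ⟩
      (xPowMinusOne p ⊛ acts (1 ∷ q ∷ []) SG.ψ) n           ≡⟨ ⊛-cong (xPowMinusOne p) (Q.Φp-exact SG.ψ) n ⟩
      (xPowMinusOne p ⊛ xPowMinusOne q ⊛ SG.ψ) n            ≡⟨ ⊛-comm (xPowMinusOne p) (xPowMinusOne q) SG.ψ n ⟩
      (xPowMinusOne q ⊛ xPowMinusOne p ⊛ SG.ψ) n            ≡⟨ ⊛-cong (xPowMinusOne q) SG.xPow-ψ n ⟩
      (xPowMinusOne q ⊛ SG.θ) n                             ≡⟨ SG.xPow-θ n ⟩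
      coef (xPowMinusOne (p * q)) n                         ∎
      where open ≡-Reasoning

  Φpq-unital : Unital (Φ (p * q))
  Φpq-unital = Quo.Φ-unital degrees≤

  Φpq-exact : ∀ s → acts (1 ∷ p ∷ q ∷ p * q ∷ []) s ≗ xPowMinusOne (p * q) ⊛ s
  Φpq-exact = Quo.Exact.Φ-exact h-acts (λ n le → SG.h-tail n (length-Φpq le))

-- Φ_pqr through the binomials of its divisors

module TripleCyclotomic {p q r : ℕ} (pp : Prime p) (pq : Prime q) (pr : Prime r) (p<q : p < q) (q<r : q < r) where

  open PrimeCyclotomic pp
  private
    module Q = PrimeCyclotomic pq
    module R = PrimeCyclotomic pr
    module PQ = PairCyclotomic pp pq p<q
    module PR = PairCyclotomic pp pr (<-trans p<q q<r)
    module QR = PairCyclotomic pq pr q<r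

    p<r  = <-trans p<q q<r
    pq<pr : p * q < p * r
    pq<pr = (entail (q ∷ r ∷ p ∷ []) (‵ 1) (‵ 1 ⊕ # 2 ⊗ # 0) (# 2 ⊗ # 1) ((# 2 , ‵ 1 ⊕ # 0 , # 1) ∷ ‵ 1 ≺ # 2 ∷ []) refl
      (q<r , 1<p , tt))
    pr<qr : p * r < q * r
    pr<qr = (entail (p ∷ q ∷ r ∷ []) (‵ 1) (‵ 1 ⊕ # 0 ⊗ # 2) (# 1 ⊗ # 2) ((# 2 , ‵ 1 ⊕ # 0 , # 1) ∷ ‵ 1 ≺ # 2 ∷ []) refl
      (p<q , R.1<p , tt))
    qr<pqr : q * r < p * q * r
    qr<pqr = (entail (p ∷ q ∷ r ∷ []) (‵ 1) (‵ 1 ⊕ # 1 ⊗ # 2) (# 0 ⊗ # 1 ⊗ # 2) ((# 1 ⊗ # 2 , ‵ 1 ⊕ ‵ 1 , # 0) ∷ ‵ 0 ≺ #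
      1 ⊗ # 2 ∷ []) refl (1<p , QR.0<pq , tt))
    r<qr = QR.q<pq
    r<pr = PR.q<pq
    -- Neither order of pq and r is excluded by size; they differ because r is prime.
    pq≢r : p * q ≢ r
    pq≢r refl = case prime⇒irreducible pr (m∣m*n {p} q) of λ where
      (inj₁ refl) → <-irrefl refl 1<p
      (inj₂ e)    → <⇒≢ PQ.p<pq e

  ds : List ℕ
  ds = 1 ∷ p ∷ q ∷ p * q ∷ r ∷ p * r ∷ q * r ∷ []

  0<pqr : 0 < p * q * r
  0<pqr = <-trans QR.0<pq qr<pqr

  divisors-pqr : divisors (p * q * r) ↭ ds
  divisors-pqr = divisors-↭ 0<pqr
    ( (<⇒≢ 1<p ∷ <⇒≢ Q.1<p ∷ <⇒≢ (<-trans 1<p PQ.p<pq) ∷ <⇒≢ R.1<p ∷ <⇒≢ (<-trans 1<p PR.p<pq) ∷ <⇒≢ (<-trans Q.1<p QR.p<pq) ∷ [])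
    ∷ (<⇒≢ p<q ∷ <⇒≢ PQ.p<pq ∷ <⇒≢ p<r ∷ <⇒≢ PR.p<pq ∷ <⇒≢ (<-trans p<q QR.p<pq) ∷ [])
    ∷ (<⇒≢ PQ.q<pq ∷ <⇒≢ q<r ∷ <⇒≢ (<-trans q<r r<pr) ∷ <⇒≢ QR.p<pq ∷ [])
    ∷ (pq≢r ∷ <⇒≢ pq<pr ∷ <⇒≢ (<-trans pq<pr pr<qr) ∷ [])
    ∷ (<⇒≢ r<pr ∷ <⇒≢ r<qr ∷ [])
    ∷ (<⇒≢ pr<qr ∷ [])
    ∷ [] ∷ [])
    ( (1∣ (p * q * r) , <-trans (<-trans Q.1<p QR.p<pq) qr<pqr)
    ∷ (∣-trans (m∣m*n q) (m∣m*n r) , <-trans (<-trans p<q QR.p<pq) qr<pqr)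
    ∷ (∣-trans (n∣m*n p) (m∣m*n r) , <-trans QR.p<pq qr<pqr)
    ∷ (m∣m*n r , <-trans (<-trans pq<pr pr<qr) qr<pqr)
    ∷ (n∣m*n (p * q) , <-trans r<qr qr<pqr)
    ∷ (subst (p * r ∣_) (identity (p ∷ r ∷ q ∷ []) (# 0 ⊗ # 1 ⊗ # 2) (# 0 ⊗ # 2 ⊗ # 1) refl) (m∣m*n q) , <-trans pr<qr qr<pqr)
    ∷ (subst (q * r ∣_) (sym (*-assoc p q r)) (n∣m*n p) , qr<pqr)
    ∷ [])
    λ {d} d∣ d< → case divisor-of-product pr (subst (d ∣_) (*-comm (p * q) r) d∣) of λ where
      (inj₁ d∣pq) → case PQ.divisor-pq d∣pq of λ where
        (inj₁ refl)               → here refl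
        (inj₂ (inj₁ refl))        → there (here refl)
        (inj₂ (inj₂ (inj₁ refl))) → there (there (here refl))
        (inj₂ (inj₂ (inj₂ refl))) → there (there (there (here refl)))
      (inj₂ (y , refl , y∣pq)) → case PQ.divisor-pq y∣pq of λ where
        (inj₁ refl)               → there (there (there (there (here (*-identityʳ r)))))
        (inj₂ (inj₁ refl))        → there (there (there (there (there (here (*-comm r p))))))
        (inj₂ (inj₂ (inj₁ refl))) → there (there (there (there (there (there (here (*-comm r q)))))))
        (inj₂ (inj₂ (inj₂ refl))) → ⊥-elim (<-irrefl (*-comm r (p * q)) d<)

  private
    module Quo = Quotient 0<pqr divisors-pqr
      (refl ∷ Φp-unital ∷ Q.Φp-unital ∷ PQ.Φpq-unital ∷ R.Φp-unital ∷ PR.Φpq-unital ∷ QR.Φpq-unital ∷ [])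

    regroup : r ∷ p * r ∷ q * r ∷ p ∷ 1 ∷ q ∷ 1 ∷ r ∷ [] ↭ 1 ∷ p ∷ r ∷ p * r ∷ 1 ∷ q ∷ r ∷ q * r ∷ []
    regroup = ↭-trans (↭-shift 1 (r ∷ p * r ∷ q * r ∷ p ∷ []) (q ∷ 1 ∷ r ∷ []))
      (prep 1 (↭-trans (↭-shift p (r ∷ p * r ∷ q * r ∷ []) (q ∷ 1 ∷ r ∷ []))
      (prep p (prep r (prep (p * r) (↭-trans (↭-shift 1 (q * r ∷ q ∷ []) (r ∷ []))
      (prep 1 (↭-trans (↭-shift q (q * r ∷ []) (r ∷ [])) (prep q (↭-swap (q * r) r ↭-refl))))))))))

  length-Φpqr : length (Φ (p * q * r)) ≤ p * q * r
  length-Φpqr = ≤-trans (≤-reflexive Quo.Φ-length) (m∸n≤m (p * q * r) (sumᴸ (map degree (p ∷ q ∷ p * q ∷ r ∷ p * r ∷ q * r ∷ []))))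

  -- The Möbius formula for Φ_pqr: Y represents (x^pqr - 1) / ((x^pq - 1)(x^pr - 1)(x^qr - 1)), and
  -- (x^p - 1) / (x - 1) is written as Φ p.
  Φpqr-coef : ∀ {Y} →
    Agree (p * q * r) (xPowMinusOne (p * q) ⊛ xPowMinusOne (p * r) ⊛ xPowMinusOne (q * r) ⊛ Y) (coef (xPowMinusOne (p * q * r))) →
    Agree (length (Φ (p * q * r))) (coef (Φ (p * q * r))) (Φ p ⊛ xPowMinusOne q ⊛ xPowMinusOne r ⊛ Y)
  Φpqr-coef {Y} e = Quo.Φ-unique λ n n< → trans (collect n) (e n (<-≤-trans n< length-Φpqr))
    where
    open ≡-Reasoning
    collect : acts ds (Φ p ⊛ xPowMinusOne q ⊛ xPowMinusOne r ⊛ Y) ≗ xPowMinusOne (p * q) ⊛ xPowMinusOne (p * r) ⊛ xPowMinusOne (q * r) ⊛ Y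
    -- Expanding x^q - 1 and x^r - 1 gives second copies of Φ_q and Φ_r and two more of Φ_1; with
    -- the extra Φ_p these are just what the three binomials of pq, pr and qr require.
    collect n = begin
      acts ds (Φ p ⊛ xPowMinusOne q ⊛ xPowMinusOne r ⊛ Y) n
        ≡⟨ acts-cong (1 ∷ p ∷ q ∷ p * q ∷ r ∷ p * r ∷ q * r ∷ p ∷ []) (λ k → trans
             (⊛-cong (xPowMinusOne q) (λ m → sym (R.Φp-exact Y m)) k) (sym (Q.Φp-exact (acts (1 ∷ r ∷ []) Y) k))) n ⟩
      acts (1 ∷ p ∷ q ∷ p * q ∷ []) (acts (r ∷ p * r ∷ q * r ∷ p ∷ 1 ∷ q ∷ 1 ∷ r ∷ []) Y) n
        ≡⟨ PQ.Φpq-exact (acts (r ∷ p * r ∷ q * r ∷ p ∷ 1 ∷ q ∷ 1 ∷ r ∷ []) Y) n ⟩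
      (xPowMinusOne (p * q) ⊛ acts (r ∷ p * r ∷ q * r ∷ p ∷ 1 ∷ q ∷ 1 ∷ r ∷ []) Y) n
        ≡⟨ ⊛-cong (xPowMinusOne (p * q)) (λ k → trans (acts-↭ regroup Y k)
             (trans (PR.Φpq-exact (acts (1 ∷ q ∷ r ∷ q * r ∷ []) Y) k)
                    (⊛-cong (xPowMinusOne (p * r)) (QR.Φpq-exact Y) k))) n ⟩
      (xPowMinusOne (p * q) ⊛ xPowMinusOne (p * r) ⊛ xPowMinusOne (q * r) ⊛ Y) n ∎

module _ {p q r lo hi : ℕ} (S : System p q r lo hi) (pp : Prime p) (p≤q : p ≤ q) (p≤r : p ≤ r)
  (q⊥p : Coprime q p) (r⊥p : Coprime r p) {L : ℕ} (lo≤L : lo ≤ L) (L-hi : L + q + r + p ≤ hi) where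
  open System S

  private
    X : ℕ → ℕ
    X M = χ (N M)

  corner-bound : TwoSided p (sum (λ i → X (L + i) + X (L + q + r + i)) p) (sum (λ i → X (L + q + i) + X (L + r + i)) p)
  corner-bound = case balanced-unit 1<p q⊥p of λ { (α , B , e⁺ , e⁻ , U , 0<α , 2α≤p) →
    case balanced-unit 1<p r⊥p of λ { (β , C , f⁺ , f⁻ , V , 0<β , 2β≤p) →
    [ (λ α≤β → ordered-bound S pp p≤q p≤r 0<α α≤β 2β≤p lo≤L L-hi e⁺ e⁻ f⁺ f⁻ U V)
    , (λ β≤α → subst₂ (TwoSided p)
        (sum-cong (λ i → cong (λ M → X (L + i) + X (M + i)) (identity (L ∷ r ∷ q ∷ []) (# 0 ⊕ # 1 ⊕ # 2) (# 0 ⊕ # 2 ⊕ #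
          1) refl)) p)
        (sum-cong (λ i → +-comm (X (L + r + i)) (X (L + q + i))) p)
        (ordered-bound (swap S) pp p≤r p≤q 0<β β≤α 2α≤p lo≤L (entail (L ∷ q ∷ r ∷ p ∷ hi ∷ []) (‵ 1) (# 0 ⊕ # 2 ⊕ # 1 ⊕
          # 3) (# 4) (# 0 ⊕ # 1 ⊕ # 2 ⊕ # 3 ≼ # 4 ∷ []) refl (L-hi , tt)) f⁺ f⁻ e⁺ e⁻ V U))
    ]′ (≤-total α β) } }

-- Reading off the coefficients

-- Sequences supported on [B, ∞), read from B on: there truncated subtraction in the index is harmless.
module Lifted (B : ℕ) where

  lift : (ℕ → ℤ) → Seq
  lift F n = F (B + n)

  Vanishing : (ℕ → ℤ) → Set
  Vanishing F = ∀ {M} → M < B → F M ≡ + 0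

  Δ : ℕ → (ℕ → ℤ) → ℕ → ℤ
  Δ d F M = F (M ∸ d) -ᶻ F M

  Δ-vanishing : ∀ d {F} → Vanishing F → Vanishing (Δ d F)
  Δ-vanishing d F0 {M} M<B = cong₂ _-ᶻ_ (F0 (≤-<-trans (m∸n≤m M d) M<B)) (F0 M<B)

  delay-lift : ∀ {d F} → Vanishing F → d ≤ B → ∀ n → delay d (lift F) n ≡ F (B + n ∸ d)
  delay-lift {d} {F} F0 d≤B n with n <? d
  ... | yes n<d = trans (delay-< d (lift F) n<d) (sym (F0 (+-cancelʳ-< d (B + n ∸ d) B
          (subst (_< B + d) (sym (m∸n+n≡m (≤-trans d≤B (m≤m+n B n)))) (+-monoʳ-< B n<d)))))
  ... | no n≮d  = subst (λ m → delay d (lift F) m ≡ F (B + m ∸ d)) (m+[n∸m]≡n (≮⇒≥ n≮d))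
          (trans (delay-+ d (lift F) (n ∸ d)) (cong F (sym (trans (cong (_∸ d) (identity (B ∷ d ∷ (n ∸ d) ∷ []) (# 0 ⊕
            (# 1 ⊕ # 2)) (# 0 ⊕ # 2 ⊕ # 1) refl)) (m+n∸n≡m (B + (n ∸ d)) d)))))

  xPow-lift : ∀ {d F} → Vanishing F → 0 < d → d ≤ B → xPowMinusOne d ⊛ lift F ≗ lift (Δ d F)
  xPow-lift {d} {F} F0 0<d d≤B n = trans (xPow-⊛-> 0<d (lift F) n) (cong (_-ᶻ F (B + n)) (delay-lift F0 d≤B n))

  -- One binomial turns the series of f into that of g with a change of sign, which `c` tracks.
  -- Agreement ends at B because `step` is available only below 2B.
  telescope : ∀ {d s} (f g : ℕ → ℕ) c → (∀ {M} → M < B → f M ≡ 0) → 0 < d → d ≤ B →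
    (∀ {M} → d ≤ M → M < B + B → f (M ∸ d) + g M ≡ f M) →
    Agree B s (lift (λ M → c *ᶻ + f M)) → Agree B (xPowMinusOne d ⊛ s) (lift (λ M → - c *ᶻ + g M))
  telescope {d} {s} f g c f0 0<d d≤B step e n n<B = trans (⊛-agree (xPowMinusOne d) e n n<B)
    (trans (xPow-lift (λ M<B → trans (cong (λ k → c *ᶻ + k) (f0 M<B)) (ℤ.*-zeroʳ c)) 0<d d≤B n)
    (trans (cong (λ y → c *ᶻ + f (B + n ∸ d) -ᶻ c *ᶻ y) (trans (cong +_ (sym (step (≤-trans d≤B (m≤m+n B n)) (+-monoʳ-< B n<B)))) (ℤ.pos-+ (f (B + n ∸ d)) (g (B + n)))))
      (solve 3 (λ c x y → c :* x :+ :- (c :* (x :+ y)) := (:- c) :* y) refl c (+ f (B + n ∸ d)) (+ g (B + n)))))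

delay-shift : ∀ d s → delay d (shift s) ≗ shift (delay d s)
delay-shift zero    s n = refl
delay-shift (suc d) s n = shift-cong (delay-shift d s) n

ones-⊛ : ∀ k s (f g : ℕ → ℕ) n → (∀ {i} → i < k → delay i s n ≡ + f i -ᶻ + g i) → (ones k ⊛ s) n ≡ + sum f k -ᶻ + sum g k
ones-⊛ zero    s f g n e = refl
ones-⊛ (suc k) s f g n e = trans
  (cong₂ _+ᶻ_ (trans (ℤ.*-identityˡ (s n)) (e (s≤s z≤n)))
    (trans (sym (⊛-shift (ones k) s n)) (ones-⊛ k (shift s) (λ i → f (suc i)) (λ i → g (suc i)) n
      (λ {i} i<k → trans (delay-shift i s n) (e (s≤s i<k))))))
  (trans (solve 4 (λ a b c d → a :+ :- b :+ (c :+ :- d) := a :+ c :+ :- (b :+ d)) refl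
      (+ f 0) (+ g 0) (+ sum (λ i → f (suc i)) k) (+ sum (λ i → g (suc i)) k))
    (cong₂ _-ᶻ_ (peel f) (peel g)))
  where
  peel : ∀ f → + f 0 +ᶻ + sum (λ i → f (suc i)) k ≡ + sum f (suc k)
  peel f = trans (sym (ℤ.pos-+ (f 0) _)) (cong +_ (sym (sum-split f 1 k)))

height-bound : ∀ p l → (∀ n → n < length l → 3 * abs (coef l n) ≤ 2 * p) → 3 * height l ≤ 2 * p
height-bound p []      _ = z≤n
height-bound p (a ∷ l) h with ≤-total (abs a) (height l)
... | inj₁ le = subst (λ x → 3 * x ≤ _) (sym (m≤n⇒m⊔n≡n le)) (height-bound p l (λ n n< → h (suc n) (s≤s n<)))
... | inj₂ ge = subst (λ x → 3 * x ≤ _) (sym (m≥n⇒m⊔n≡m ge)) (h 0 (s≤s z≤n))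

TwoSided-abs : ∀ {p m n} → TwoSided p m n → 3 * abs (+ m -ᶻ + n) ≤ 2 * p
TwoSided-abs {p} {m} {n} (two-sided u l) with ≤-total m n
... | inj₁ m≤n = subst (λ x → 3 * x ≤ 2 * p) (sym (trans (cong abs (ℤ.m-n≡m⊖n m n)) (ℤ.∣⊖∣-≤ m≤n)))
  (entail (n ∷ m ∷ p ∷ (n ∸ m) ∷ []) (‵ 1) (‵ 3 ⊗ # 3) (‵ 2 ⊗ # 2) (‵ 3 ⊗ # 0 ≼ ‵ 3 ⊗ # 1 ⊕ ‵ 2 ⊗ # 2 ∷ (‵ 3 , # 1 ⊕ # 3
    , # 0) ∷ []) refl (l , ≤-reflexive (m+[n∸m]≡n m≤n) , tt))
... | inj₂ n≤m = subst (λ x → 3 * x ≤ 2 * p) (sym (cong abs (trans (ℤ.m-n≡m⊖n m n) (ℤ.⊖-≥ n≤m))))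
  (entail (m ∷ n ∷ p ∷ (m ∸ n) ∷ []) (‵ 1) (‵ 3 ⊗ # 3) (‵ 2 ⊗ # 2) (‵ 3 ⊗ # 0 ≼ ‵ 3 ⊗ # 1 ⊕ ‵ 2 ⊗ # 2 ∷ (‵ 3 , # 1 ⊕ # 3
    , # 0) ∷ []) refl (u , ≤-reflexive (m+[n∸m]≡n n≤m) , tt))

module Coefficients {p q r : ℕ} (pp : Prime p) (pq : Prime q) (pr : Prime r) (p<q : p < q) (q<r : q < r) where
  open PrimeCyclotomic pp using (1<p; 0<p; Φp-coef)
  open TripleCyclotomic pp pq pr p<q q<r using (Φpqr-coef; length-Φpqr; 0<pqr)

  private
    1<q = <-trans 1<p p<q
    1<r = <-trans 1<q q<r
    B : ℕ
    B = p * q * r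
    S : System p q r (B ∸ (p + q + r)) (B + B)
    S = system pp pq pr 1<p p<q q<r
    open System S using (a; b; c; N)
    module Sᵃ = Steps S
    module Sᵇ = Steps (rotate S)
    module Sᶜ = Steps (rotate (swap S))
    open Lifted B

    X : ℕ → ℕ
    X M = χ (N M)

    X₀ : ∀ {M} → M < B → X M ≡ 0
    X₀ M<B = Sᵃ.χ-< (<-≤-trans M<B (m≤m+n B B)) M<B

    B-large : p + q + r ≤ B
    B-large = (entail (p ∷ q ∷ r ∷ []) (‵ 1) (# 0 ⊕ # 1 ⊕ # 2) (# 0 ⊗ # 1 ⊗ # 2) ((# 1 ⊗ # 2 , ‵ 1 ⊕ ‵ 1 , # 0) ∷ (‵ 2 ⊗
      # 2 , ‵ 1 ⊕ ‵ 1 , # 1) ∷ (‵ 2 , ‵ 1 ⊕ # 0 , # 1) ∷ (‵ 3 , ‵ 1 ⊕ # 1 , # 2) ∷ []) refl (1<p , 1<q , p<q , q<r ,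
      tt))

    Y : Seq
    Y = lift (λ M → + X M)

    scale-step : ∀ {x y z} k → x + y * z ≡ y → x * k + y * k * z ≡ y * k
    scale-step {x} {y} {z} k e = (equate (x ∷ y ∷ z ∷ k ∷ []) 1 (# 0 ⊗ # 3 ⊕ # 1 ⊗ # 3 ⊗ # 2) (# 1 ⊗ # 3) ((# 3 , # 0 ⊕
      # 1 ⊗ # 2 , # 1) ∷ []) refl (e , tt))

    qr≤B : q * r ≤ B
    qr≤B = (entail (p ∷ q ∷ r ∷ []) (‵ 2) (# 1 ⊗ # 2) (# 0 ⊗ # 1 ⊗ # 2) ((# 1 ⊗ # 2 , ‵ 1 ⊕ ‵ 1 , # 0) ∷ []) refl (1<p ,
      tt))
    pr≤B : p * r ≤ B
    pr≤B = (entail (q ∷ p ∷ r ∷ []) (‵ 2) (# 1 ⊗ # 2) (# 1 ⊗ # 0 ⊗ # 2) ((# 1 ⊗ # 2 , ‵ 1 ⊕ ‵ 1 , # 0) ∷ []) refl (1<q ,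
      tt))
    pq≤B : p * q ≤ B
    pq≤B = (entail (r ∷ p ∷ q ∷ []) (‵ 2) (# 1 ⊗ # 2) (# 1 ⊗ # 2 ⊗ # 0) ((# 1 ⊗ # 2 , ‵ 1 ⊕ ‵ 1 , # 0) ∷ []) refl (1<r ,
      tt))

    T₁ T₂ T₃ : ℕ → ℕ
    T₁ M = X M * χ (a M)
    T₂ M = T₁ M * χ (b M)
    T₃ M = T₂ M * χ (c M)

    step₂ : ∀ {M} → p * r ≤ M → M < B + B → T₁ (M ∸ p * r) + T₂ M ≡ T₁ M
    step₂ {M} le M< = trans (cong (λ x → X (M ∸ p * r) * χ x + T₂ M) (Sᵇ.b-step M< (m∸n+n≡m le)))
      (scale-step (χ (a M)) (Sᵇ.χ-step M< (m∸n+n≡m le)))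

    step₃ : ∀ {M} → p * q ≤ M → M < B + B → T₂ (M ∸ p * q) + T₃ M ≡ T₂ M
    step₃ {M} le M< = trans
      (cong₂ (λ x y → X (M ∸ p * q) * χ x * χ y + T₃ M) (Sᶜ.b-step M< (m∸n+n≡m le)) (Sᶜ.c-step M< (m∸n+n≡m le)))
      (scale-step (χ (b M)) (scale-step (χ (a M)) (Sᶜ.χ-step M< (m∸n+n≡m le))))

    -- After three telescopings only the term at M = pqr survives, with coefficient -1; below degree
    -- pqr this is x^pqr - 1.
    product : Agree B (xPowMinusOne (p * q) ⊛ xPowMinusOne (p * r) ⊛ xPowMinusOne (q * r) ⊛ Y) (coef (xPowMinusOne B))
    product n n<B = trans
      (telescope T₂ T₃ (+ 1) (λ {M} M<B → cong (λ x → x * χ (a M) * χ (b M)) (X₀ M<B)) 0<pq pq≤B step₃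
        (telescope T₁ T₂ (- (+ 1)) (λ {M} M<B → cong (_* χ (a M)) (X₀ M<B)) 0<pr pr≤B step₂
        (telescope X T₁ (+ 1) X₀ 0<qr qr≤B (λ le M< → Sᵃ.χ-step M< (m∸n+n≡m le))
          (λ n _ → sym (ℤ.*-identityˡ (Y n))))) n n<B)
      (trans (corner n n<B) (sym (trans (xPow-coef 0<pqr n) (trans (cong (_-ᶻ δ₀ n) (delay-< B δ₀ n<B)) (ℤ.+-identityˡ (- δ₀ n))))))
      where
      0<pq = (entail (p ∷ q ∷ []) (‵ 1) (‵ 1 ⊕ ‵ 0) (# 0 ⊗ # 1) ((# 1 , ‵ 1 ⊕ ‵ 1 , # 0) ∷ (‵ 2 , ‵ 1 ⊕ ‵ 1 , # 1) ∷ [])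
        refl (1<p , 1<q , tt))
      0<pr = (entail (p ∷ r ∷ []) (‵ 1) (‵ 1 ⊕ ‵ 0) (# 0 ⊗ # 1) ((# 1 , ‵ 1 ⊕ ‵ 1 , # 0) ∷ (‵ 2 , ‵ 1 ⊕ ‵ 1 , # 1) ∷ [])
        refl (1<p , 1<r , tt))
      0<qr = (entail (q ∷ r ∷ []) (‵ 1) (‵ 1 ⊕ ‵ 0) (# 0 ⊗ # 1) ((# 1 , ‵ 1 ⊕ ‵ 1 , # 0) ∷ (‵ 2 , ‵ 1 ⊕ ‵ 1 , # 1) ∷ [])
        refl (1<q , 1<r , tt))
      B<2B : B < B + B
      B<2B = m<m+n B 0<pqr
      origin : T₃ B ≡ 1
      origin = Sᵃ.χ-origin B<2B
      corner : ∀ n → n < B → - (+ 1) *ᶻ + T₃ (B + n) ≡ - δ₀ n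
      corner zero    _   = cong (λ x → - (+ 1) *ᶻ + x) (trans (cong T₃ (+-identityʳ B)) origin)
      corner (suc n) n<B = cong (λ x → - (+ 1) *ᶻ + x) (Sᵃ.χ-corner (+-monoʳ-< B n<B) (m<m+n B (s≤s z≤n)))

    module _ {n : ℕ} (n<K : n < length (Φ B)) where
      top = B + n
      -- The four windows of length p end at top, top - q, top - r and top - q - r; L is the start
      -- of the lowest one.
      L = suc top ∸ (p + q + r)

      L-+ : L + (p + q + r) ≡ suc top
      L-+ = m∸n+n≡m (≤-trans B-large (≤-trans (m≤m+n B n) (n≤1+n top)))

      L-hi : L + q + r + p ≤ B + B
      L-hi = (entail (L ∷ p ∷ q ∷ r ∷ top ∷ B ∷ []) (‵ 1) (# 0 ⊕ # 2 ⊕ # 3 ⊕ # 1) (# 5 ⊕ # 5) (# 0 ⊕ (# 1 ⊕ # 2 ⊕ # 3) ≼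
        ‵ 1 ⊕ # 4 ∷ # 4 ≺ # 5 ⊕ # 5 ∷ []) refl (≤-reflexive L-+ , +-monoʳ-< B (<-≤-trans n<K length-Φpqr) , tt))

      f g f′ g′ : ℕ → ℕ
      f  i = X (L + i) + X (L + q + r + i)
      g  i = X (L + q + i) + X (L + r + i)
      f′ i = X (top ∸ i ∸ q ∸ r) + X (top ∸ i)
      g′ i = X (top ∸ i ∸ q) + X (top ∸ i ∸ r)

      -- The factor Φ p reads each window downwards from its end, the bound reads it upwards from
      -- its start.
      mirror : ℕ → ℕ
      mirror = reflect p

      top∸ : ∀ {i} → i < p → top ∸ i ≡ L + q + r + mirror i
      top∸ {i} i<p = trans (cong (_∸ i) (equate (L ∷ p ∷ q ∷ r ∷ top ∷ (mirror i) ∷ i ∷ []) 1 (# 4) (# 0 ⊕ # 2 ⊕ # 3 ⊕ #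
        5 ⊕ # 6) (# 4 ≺ # 0 ⊕ (# 1 ⊕ # 2 ⊕ # 3) ∷ # 1 ≼ # 5 ⊕ (‵ 1 ⊕ # 6) ∷ []) refl (sym L-+ , sym (m∸n+n≡m i<p) , tt))) (m+n∸n≡m (L + q + r + mirror i) i)

      top∸∸ : ∀ {i x} d → i < p → x + d ≡ L + q + r + mirror i → top ∸ i ∸ d ≡ x
      top∸∸ {i} {x} d i<p e = trans (cong (_∸ d) (trans (top∸ i<p) (sym e))) (m+n∸n≡m x d)

      f′≡ : ∀ {i} → i < p → f′ i ≡ f (mirror i)
      f′≡ {i} i<p = cong₂ (λ x y → X x + X y)
        (trans (cong (_∸ r) (top∸∸ {x = L + r + mirror i} q i<p (identity (L ∷ r ∷ (mirror i) ∷ q ∷ []) (# 0 ⊕ # 1 ⊕ # 2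
          ⊕ # 3) (# 0 ⊕ # 3 ⊕ # 1 ⊕ # 2) refl)))
          (trans (cong (_∸ r) (identity (L ∷ r ∷ (mirror i) ∷ []) (# 0 ⊕ # 1 ⊕ # 2) (# 0 ⊕ # 2 ⊕ # 1) refl)) (m+n∸n≡m (L + mirror i) r)))
        (top∸ i<p)

      g′≡ : ∀ {i} → i < p → g′ i ≡ g (mirror i)
      g′≡ {i} i<p = trans (+-comm (X (top ∸ i ∸ q)) (X (top ∸ i ∸ r))) (cong₂ (λ x y → X x + X y)
        (top∸∸ {x = L + q + mirror i} r i<p (identity (L ∷ q ∷ (mirror i) ∷ r ∷ []) (# 0 ⊕ # 1 ⊕ # 2 ⊕ # 3) (# 0 ⊕ # 1 ⊕
          # 3 ⊕ # 2) refl))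
        (top∸∸ {x = L + r + mirror i} q i<p (identity (L ∷ r ∷ (mirror i) ∷ q ∷ []) (# 0 ⊕ # 1 ⊕ # 2 ⊕ # 3) (# 0 ⊕ # 3 ⊕
          # 1 ⊕ # 2) refl)))

      sum-mirror : ∀ (h h′ : ℕ → ℕ) → (∀ {i} → i < p → h′ i ≡ h (mirror i)) → sum h′ p ≡ sum h p
      sum-mirror h h′ e = trans (sum-cong-< p e) (sum-permute h mirror mirror p mirror< mirror< involutive involutive)
        where
        mirror< : ∀ {i} → i < p → mirror i < p
        mirror< {i} i<p = (entail ((mirror i) ∷ i ∷ p ∷ []) (‵ 1) (‵ 1 ⊕ # 0) (# 2) (# 0 ⊕ (‵ 1 ⊕ # 1) ≼ # 2 ∷ []) refl
          (≤-reflexive (m∸n+n≡m i<p) , tt))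
        involutive : ∀ {i} → i < p → mirror (mirror i) ≡ i
        involutive {i} i<p = trans (cong (_∸ suc (mirror i)) (equate ((mirror i) ∷ i ∷ p ∷ []) 1 (# 2) (# 1 ⊕ (‵ 1 ⊕ #
          0)) (# 2 ≼ # 0 ⊕ (‵ 1 ⊕ # 1) ∷ []) refl (sym (m∸n+n≡m i<p) , tt))) (m+n∸n≡m i (suc (mirror i)))

      F : ℕ → ℤ
      F = Δ q (Δ r (λ M → + X M))

      F-vanishing : Vanishing F
      F-vanishing = Δ-vanishing q {Δ r (λ M → + X M)} (Δ-vanishing r {λ M → + X M} (λ M<B → cong +_ (X₀ M<B)))

      r≤B : r ≤ B
      r≤B = ≤-trans (m≤n+m r (p + q)) B-large

      q≤B : q ≤ B
      q≤B = (entail (p ∷ q ∷ r ∷ B ∷ []) (‵ 1) (# 1) (# 3) (# 0 ⊕ # 1 ⊕ # 2 ≼ # 3 ∷ []) refl (B-large , tt))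

      window : xPowMinusOne q ⊛ xPowMinusOne r ⊛ Y ≗ lift F
      window k = trans (⊛-cong (xPowMinusOne q) (xPow-lift {r} {λ M → + X M} (λ M<B → cong +_ (X₀ M<B)) (<⇒≤ 1<r) r≤B) k)
        (xPow-lift {q} {Δ r (λ M → + X M)} (Δ-vanishing r {λ M → + X M} (λ M<B → cong +_ (X₀ M<B))) (<⇒≤ 1<q) q≤B k)

      summand : ∀ {i} → i < p → delay i (lift F) n ≡ + f′ i -ᶻ + g′ i
      summand {i} i<p = trans (delay-lift F-vanishing (≤-trans (<⇒≤ i<p) (≤-trans (m≤m+n p q) (≤-trans (m≤m+n (p + q) r) B-large))) n)
        (trans (solve 4 (λ x y z w → x :+ :- y :+ :- (z :+ :- w) := x :+ w :+ :- (y :+ z)) refl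
            (+ X (top ∸ i ∸ q ∸ r)) (+ X (top ∸ i ∸ q)) (+ X (top ∸ i ∸ r)) (+ X (top ∸ i)))
          (sym (cong₂ _-ᶻ_ (ℤ.pos-+ (X (top ∸ i ∸ q ∸ r)) (X (top ∸ i))) (ℤ.pos-+ (X (top ∸ i ∸ q)) (X (top ∸ i ∸ r))))))

      coefficient : coef (Φ B) n ≡ + sum f p -ᶻ + sum g p
      coefficient = trans (Φpqr-coef {Y} product n n<K) (trans (⊛-cong (Φ p) window n)
        (trans (⊛-coef (Φ p) (ones p) (lift F) Φp-coef n) (trans (ones-⊛ p (lift F) f′ g′ n summand)
          (cong₂ (λ x y → + x -ᶻ + y) (sum-mirror f f′ f′≡) (sum-mirror g g′ g′≡)))))

      coefficient-bound : 3 * abs (coef (Φ B) n) ≤ 2 * p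
      coefficient-bound = subst (λ x → 3 * abs x ≤ 2 * p) (sym coefficient) (TwoSided-abs
        (corner-bound S pp (<⇒≤ p<q) (<⇒≤ (<-trans p<q q<r))
          (prime⇒coprime pq {{>-nonZero 0<p}} p<q) (prime⇒coprime pr {{>-nonZero 0<p}} (<-trans p<q q<r))
          (∸-monoˡ-≤ (p + q + r) (≤-trans (m≤m+n B n) (n≤1+n top))) L-hi))

  A-bound : 3 * A (p * q * r) ≤ 2 * p
  A-bound = height-bound p (Φ (p * q * r)) (λ n n<K → coefficient-bound n<K)

theorem1p3 : (p q r : ℕ) → Prime p → Prime q → Prime r → p < q → q < r →
    3 * A (p * q * r) ≤ 2 * p
theorem1p3 p q r pp pq pr p<q q<r = Coefficients.A-bound pp pq pr p<q q<r
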